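{- Let $n,m$ be positive integers and let $\alpha_1,\dots,\alpha_n$ be the simple roots of type $A_n$. There exists a bijection $\omega_n:\mathcal{D}^m_n\to\mathcal{R}^m_n$ such that for every $i\in\{1,\dots,n\}$ and every $D\in\mathcal{D}^m_n$, the facet $D$ contains the negative simple root $-\alpha_i$ if and only if the hyperplane $H_{\alpha_i,m}$ is a separating wall of the region $\omega_n(D)$.
   Context: Type $A_n$: let $\varepsilon_1,\dots,\varepsilon_{n+1}$ be the standard basis of $\mathbb{R}^{n+1}$, $V=\{x\in\mathbb{R}^{n+1}:\sum x_i=0\}$ with the standard inner product $\langle\cdot,\cdot\rangle$. The positive roots are $\alpha_{ij}=\varepsilon_i-\varepsilon_{j+1}$ for $1\le i\le j\le n$, and the simple roots are $\alpha_i=\alpha_{ii}=\varepsilon_i-\varepsilon_{i+1}$. For a root $\alpha$ and $k\in\mathbb{Z}$ let $H_{\alpha,k}=\{v\in V:\langle v,\alpha\rangle=k\}$. The $m$-Catalan arrangement $\mathrm{Cat}^m(A_n)$ is the set of hyperplanes $H_{\alpha,k}$ with $\alpha$ a positive root and $0\le k\le m$; its regions are the connected components of the complement of the union of these hyperplanes in $V$. A region is dominant if it lies in the dominant chamber $\{v\in V:\langle v,\alpha\rangle\ge 0 \text{ for all positive roots }\alpha\}$. $\mathcal{R}^m_n$ denotes the set of dominant regions of $\mathrm{Cat}^m(A_n)$. A wall of a region $R$ is a hyperplane of the arrangement supporting a facet of $R$; it is a separating wall if $R$ and the origin lie in different open half-spaces determined by it. Facets of the $m$-generalized cluster complex $\Delta^m(A_n)$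 (Fomin–Reading), realized as dissections: let $P$ be a convex polygon with $m(n+1)+2$ vertices labeled $0,1,\dots,m(n+1)+1$ counterclockwise. An $m$-diagonal is a diagonal of $P$ dividing it into two polygons each of whose number of vertices is congruent to $2$ modulo $m$. An $m$-dissection is a set of $n$ pairwise non-crossing (in the interior) $m$-diagonals (equivalently a subdivision of $P$ into $(m+2)$-gons). $\mathcal{D}^m_n$ is the set of $m$-dissections of $P$; these are the facets of $\Delta^m(A_n)$. The negative simple roots are identified with the following diagonals: for $1\le i\le \frac{n+1}{2}$, $-\alpha_{2i-1}$ is the diagonal joining vertices $(i-1)m$ and $(n+1-i)m+1$; for $1\le i\le \frac n2$, $-\alpha_{2i}$ is the diagonal joining vertices $im$ and $(n+1-i)m+1$. A dissection $D$ contains $-\alpha_i$ if the diagonal identified with $-\alpha_i$ belongs to $D$. -}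

module Defs where

open import Algebra.Apartness.Bundles using (HeytingField; HeytingCommutativeRing)
open import Algebra.Bundles using (CommutativeRing)
import Algebra.Definitions.RawMonoid as RawMonoidDefinitions
open import Data.Fin.Base using (Fin; zero; suc; toℕ; inject₁)
import Data.Fin.Base as Fin
import Data.Fin.Properties as Fin
open import Data.List.Base using (List; length)
open import Data.List.Membership.Propositional using (_∈_)
open import Data.List.Relation.Binary.BagAndSetEquality using ([_]-Equality; set)
open import Data.List.Relation.Unary.All using (All)
open import Data.List.Relation.Unary.AllPairs using (AllPairs)
open import Data.List.Relation.Unary.Unique.Propositional using (Unique)
open import Data.Nat.Base as ℕ using (ℕ; NonZero; ⌊_/2⌋; ⌈_/2⌉)
open import Data.Nat.DivMod using (_%_)
import Data.Nat.Properties as ℕ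
open import Data.Product.Base using (Σ; ∃; _×_; _,_; proj₁; proj₂)
open import Data.Sum.Base using (_⊎_; inj₁; inj₂; [_,_]′)
open import Data.Vec.Functional using (Vector)
open import Function.Base using (_∘_)
open import Function.Bundles using (_⇔_)
open import Level using (0ℓ) renaming (suc to lsuc)
open import Relation.Binary.Bundles using (Setoid)
open import Relation.Binary.Core using (Rel)
import Relation.Binary.Construct.On as On
open import Relation.Binary.PropositionalEquality.Core using (_≡_; refl)
open import Relation.Binary.Structures using (IsStrictPartialOrder)
open import Relation.Nullary.Decidable.Core using (does)
open import Relation.Nullary.Negation.Core using (¬_)
open import Relation.Unary using (Pred; _⊆_; _∩_; _∪_; Satisfiable)
open import Data.Bool.Base using (if_then_else_)

-- The real numbers, axiomatised as a Cauchy complete Archimedean ordered field.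
-- The order is not assumed decidable, so that Bishop's constructive reals
-- satisfy these axioms; classically every model is isomorphic to ℝ.

record RealNumbers : Set₁ where
  infix 4 _<_
  field
    heytingField : HeytingField 0ℓ 0ℓ 0ℓ

  open HeytingField heytingField public
    using (Carrier; _≈_; _#_; _+_; _*_; -_; _-_; 0#; 1#; heytingCommutativeRing)

  commutativeRing : CommutativeRing 0ℓ 0ℓ
  commutativeRing = HeytingCommutativeRing.commutativeRing heytingCommutativeRing

  open RawMonoidDefinitions (CommutativeRing.+-rawMonoid commutativeRing) public
    using (sum) renaming (_×_ to _·_)

  field
    _<_                  : Rel Carrier 0ℓ
    isStrictPartialOrder : IsStrictPartialOrder _≈_ _<_
    #⇔<⊎>                : ∀ {x y} → x # y ⇔ (x < y ⊎ y < x)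
    +-monoˡ-<            : ∀ z {x y} → x < y → x + z < y + z
    *-positive           : ∀ {x y} → 0# < x → 0# < y → 0# < x * y
    archimedean          : ∀ x → ∃ λ (n : ℕ) → x < n · 1#

  Within : Carrier → Rel Carrier 0ℓ
  Within ε x y = x < y + ε × y < x + ε

  IsCauchy : (ℕ → Carrier) → Set
  IsCauchy a = ∀ ε → 0# < ε →
    ∃ λ N → ∀ p q → N ℕ.≤ p → N ℕ.≤ q → Within ε (a p) (a q)

  ConvergesTo : (ℕ → Carrier) → Carrier → Set
  ConvergesTo a l = ∀ ε → 0# < ε →
    ∃ λ N → ∀ p → N ℕ.≤ p → Within ε (a p) l

  field
    complete : ∀ a → IsCauchy a → ∃ (ConvergesTo a)

-- With indices counted from 0, (i , j) stands for the root α_{i+1,j+1}.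

record PositiveRoot (n : ℕ) : Set where
  constructor root
  field
    i j : Fin n
    i≤j : i Fin.≤ j

simple : ∀ {n} → Fin n → PositiveRoot n
simple i = root i i Fin.≤-refl

record CatHyperplane (n m : ℕ) : Set where
  constructor H
  field
    α   : PositiveRoot n
    k   : ℕ
    k≤m : k ℕ.≤ m

module Arrangement (ℝ : RealNumbers) (n m : ℕ) where
  open RealNumbers ℝ

  ⟨_,_⟩ : ∀ {d} → Vector Carrier d → Vector Carrier d → Carrier
  ⟨ x , y ⟩ = sum (λ i → x i * y i)

  ε : ∀ {d} → Fin d → Vector Carrier d
  ε i j = if does (i Fin.≟ j) then 1# else 0#

  record V : Set where
    constructor vec
    field
      coord : Vector Carrier (ℕ.suc n)
      sum≈0 : sum coord ≈ 0#
  open V public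

  origin : V
  origin = vec (λ _ → 0#) (sum-zero (ℕ.suc n))
    where
    module R = CommutativeRing commutativeRing
    sum-zero : ∀ d → sum {d} (λ _ → 0#) ≈ 0#
    sum-zero ℕ.zero    = R.refl
    sum-zero (ℕ.suc d) = R.trans (R.+-identityˡ _) (sum-zero d)

  rootVector : PositiveRoot n → Vector Carrier (ℕ.suc n)
  rootVector (root i j _) l = ε (inject₁ i) l - ε (suc j) l

  On Below Above : CatHyperplane n m → Pred V 0ℓ
  On    (H α k _) v = ⟨ coord v , rootVector α ⟩ ≈ k · 1#
  Below (H α k _) v = ⟨ coord v , rootVector α ⟩ < k · 1#
  Above (H α k _) v = k · 1# < ⟨ coord v , rootVector α ⟩

  -- Lying off a hyperplane is expressed with the apartness relation, which
  -- classically is the negation of ≈.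
  Complement : Pred V 0ℓ
  Complement v = ∀ ((H α k _) : CatHyperplane n m) →
    ⟨ coord v , rootVector α ⟩ # k · 1#

  DominantChamber : Pred V 0ℓ
  DominantChamber v = ∀ α → ¬ (⟨ coord v , rootVector α ⟩ < 0#)

  -- The usual topology of V, with the balls of the maximum norm as basis.
  Near : Carrier → Rel V 0ℓ
  Near r v w = ∀ l → Within r (coord v l) (coord w l)

  IsOpen : Pred V 0ℓ → Set
  IsOpen U = ∀ v → U v → ∃ λ r → 0# < r × (∀ w → Near r v w → U w)

  Closure : ∀ {ℓ} → Pred V ℓ → Pred V ℓ
  Closure S v = ∀ r → 0# < r → ∃ λ w → Near r v w × S w

  IsConnected : Pred V 0ℓ → Set₁
  IsConnected S = ∀ (U W : Pred V 0ℓ) → IsOpen U → IsOpen W → S ⊆ U ∪ W →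
    Satisfiable (S ∩ U) → Satisfiable (S ∩ W) → Satisfiable (S ∩ (U ∩ W))

  SameComponent : Rel V (lsuc 0ℓ)
  SameComponent v w = ∃ λ (S : Pred V 0ℓ) →
    S ⊆ Complement × IsConnected S × S v × S w

  -- A region is given by any of its points; two points give the same region
  -- when they lie in the same connected component of the complement.
  record Region : Set where
    constructor region
    field
      point        : V
      inComplement : Complement point

  infix 4 _∋_ _≈ᴿ_

  _∋_ : Region → Pred V (lsuc 0ℓ)
  R ∋ v = SameComponent (Region.point R) v

  _≈ᴿ_ : Rel Region (lsuc 0ℓ)
  R ≈ᴿ R′ = R ∋ Region.point R′

  singleton-connected : ∀ v → IsConnected (_≡ v)
  singleton-connected v U W _ _ _ (_ , refl , u) (_ , refl , w) = v , refl , u , w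

  ∪-connected : ∀ {S T} z → S z → T z →
                IsConnected S → IsConnected T → IsConnected (S ∪ T)
  ∪-connected {S} {T} z sz tz cS cT U W oU oW cover = meet
    where
    inS : Satisfiable (S ∩ (U ∩ W)) → Satisfiable ((S ∪ T) ∩ (U ∩ W))
    inS (y , sy , uw) = y , inj₁ sy , uw
    inT : Satisfiable (T ∩ (U ∩ W)) → Satisfiable ((S ∪ T) ∩ (U ∩ W))
    inT (y , ty , uw) = y , inj₂ ty , uw
    viaS : Satisfiable (S ∩ U) → Satisfiable (S ∩ W) → Satisfiable ((S ∪ T) ∩ (U ∩ W))
    viaS su sw = inS (cS U W oU oW (cover ∘ inj₁) su sw)
    viaT : Satisfiable (T ∩ U) → Satisfiable (T ∩ W) → Satisfiable ((S ∪ T) ∩ (U ∩ W))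
    viaT tu tw = inT (cT U W oU oW (cover ∘ inj₂) tu tw)
    meet : Satisfiable ((S ∪ T) ∩ U) → Satisfiable ((S ∪ T) ∩ W) →
           Satisfiable ((S ∪ T) ∩ (U ∩ W))
    meet (x , inj₁ sx , ux) (y , inj₁ sy , wy) = viaS (x , sx , ux) (y , sy , wy)
    meet (x , inj₂ tx , ux) (y , inj₂ ty , wy) = viaT (x , tx , ux) (y , ty , wy)
    meet (x , inj₁ sx , ux) (y , inj₂ ty , wy) =
      [ (λ uz → viaT (z , tz , uz) (y , ty , wy))
      , (λ wz → viaS (x , sx , ux) (z , sz , wz)) ]′ (cover (inj₁ sz))
    meet (x , inj₂ tx , ux) (y , inj₁ sy , wy) =
      [ (λ uz → viaS (z , sz , uz) (y , sy , wy))
      , (λ wz → viaT (x , tx , ux) (z , tz , wz)) ]′ (cover (inj₁ sz))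

  regionSetoid : Setoid 0ℓ (lsuc 0ℓ)
  regionSetoid = record
    { Carrier       = Region
    ; _≈_           = _≈ᴿ_
    ; isEquivalence = record
      { refl  = λ {R} → (_≡ Region.point R)
                      , (λ { refl → Region.inComplement R })
                      , singleton-connected _ , refl , refl
      ; sym   = λ { (S , S⊆ , cS , a , b) → S , S⊆ , cS , b , a }
      ; trans = λ { (S , S⊆ , cS , a , b) (T , T⊆ , cT , b′ , c) →
                    S ∪ T , [ S⊆ , T⊆ ]′ , ∪-connected _ b b′ cS cT
                    , inj₁ a , inj₂ c }
      }
    }

  IsDominant : Region → Set₁
  IsDominant R = (R ∋_) ⊆ DominantChamber

  DominantRegion : Set₁
  DominantRegion = Σ Region IsDominant

  dominantRegions : Setoid (lsuc 0ℓ) (lsuc 0ℓ)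
  dominantRegions = On.setoid regionSetoid (proj₁ {B = IsDominant})

  AffineHull : ∀ {ℓ} → Pred V ℓ → Pred V ℓ
  AffineHull S v = ∃ λ (r : ℕ) →
    Σ (Vector V r) λ p → Σ (Vector Carrier r) λ t →
      (∀ a → S (p a)) × sum t ≈ 1# ×
      (∀ l → coord v l ≈ sum (λ a → t a * coord (p a) l))

  -- h supports a facet of R: the intersection of h with the closure of R has
  -- dimension n − 1, i.e. its affine hull is all of h.
  IsWall : Region → CatHyperplane n m → Set₁
  IsWall R h = On h ⊆ AffineHull (Closure (R ∋_) ∩ On h)

  Separates : Region → CatHyperplane n m → Set₁
  Separates R h = ((R ∋_) ⊆ Above h × Below h origin)
                ⊎ ((R ∋_) ⊆ Below h × Above h origin)

  IsSeparatingWall : Region → CatHyperplane n m → Set₁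
  IsSeparatingWall R h = IsWall R h × Separates R h

-- A chord of the convex polygon with vertices 0, …, N − 1 joining a and b,
-- for a < b, is the pair (a , b).

Chord : Set
Chord = ℕ × ℕ

IsDiagonal : ℕ → Pred Chord 0ℓ
IsDiagonal N (a , b) = 2 ℕ.+ a ℕ.≤ b × b ℕ.< N × ¬ (a ≡ 0 × ℕ.suc b ≡ N)

-- The chord (a , b) cuts off the polygon on a, a + 1, …, b; the other part is
-- the polygon on b, …, N − 1, 0, …, a.

IsMDiagonal : (N m : ℕ) .{{_ : NonZero m}} → Pred Chord 0ℓ
IsMDiagonal N m (a , b) = IsDiagonal N (a , b)
  × (b ℕ.∸ a ℕ.+ 1) % m ≡ 2 % m
  × (N ℕ.∸ (b ℕ.∸ a) ℕ.+ 1) % m ≡ 2 % m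

Crossing : Rel Chord 0ℓ
Crossing (a , b) (c , d) = (a ℕ.< c × c ℕ.< b × b ℕ.< d)
                         ⊎ (c ℕ.< a × a ℕ.< d × d ℕ.< b)

record Dissection (n m : ℕ) .{{_ : NonZero m}} : Set where
  field
    diagonals   : List Chord
    unique      : Unique diagonals
    size        : length diagonals ≡ n
    mDiagonal   : All (IsMDiagonal (m ℕ.* (n ℕ.+ 1) ℕ.+ 2) m) diagonals
    nonCrossing : AllPairs (λ d d′ → ¬ Crossing d d′) diagonals

dissections : (n m : ℕ) .{{_ : NonZero m}} → Setoid 0ℓ 0ℓ
dissections n m = On.setoid ([ set ]-Equality Chord) (Dissection.diagonals {n} {m})

-- For s = 2k − 1 this joins (k − 1)m and (n + 1 − k)m + 1; for s = 2k it joins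
-- km and (n + 1 − k)m + 1.  Here s is the index of the simple root counted from 1.

negativeSimple : ∀ {n} → ℕ → Fin n → Chord
negativeSimple {n} m i =
  let s = ℕ.suc (toℕ i) in
  ⌊ s /2⌋ ℕ.* m , (n ℕ.+ 1 ℕ.∸ ⌈ s /2⌉) ℕ.* m ℕ.+ 1

ContainsNegativeSimple : ∀ {n m} .{{_ : NonZero m}} → Dissection n m → Fin n → Set
ContainsNegativeSimple {n} {m} D i = negativeSimple m i ∈ Dissection.diagonals D

{-# OPTIONS --safe #-}
module Submission where

open import Defs
open import Data.Fin.Base using (Fin)
open import Data.Nat.Base using (ℕ; NonZero)
open import Data.Nat.Properties using (≤-refl)
open import Data.Product.Base using (∃; proj₁)
open import Function.Bundles using (Bijection; _⇔_)

-- Remove the vertices of the polygon one at a time, m from one end of the interval 0, …, M, then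
-- m from the other end, and so on, so that −α_j joins the end vertices of what is left after m j
-- removals.  Let Λ_p be the number of diagonals of D with both ends among the vertices left after
-- p removals.  An m-dissection is determined by Λ, since otherwise the first diagonal on which two
-- dissections differ could be added to one of them; and every decreasing Λ with m Λ_p at most the
-- number of remaining edges minus 1 occurs, by cutting off an ear at the innermost vertex
-- where Λ jumps.  Moreover −α_j lies in D exactly when Λ_{mj} ≥ n + 1 − j.
--
-- On the other side, a dominant region is determined by the numbers λ_j of pairs (i , k) with
-- i < j, 1 ≤ k ≤ m and x_i − x_j > k: inductively, λ_j says where x_j lies among the thresholds
-- x_i − k, whose order is known from the earlier coordinates.  The possible λ are the weakly
-- increasing sequences with λ_j ≤ m j, counting j from 0, so they are the conjugates of the
-- possible Λ.  Finally H_{α_i,m} is a wall of every dominant region above it, because such a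
-- region can be moved in the direction of the fundamental coweight until it touches H_{α_i,m}
-- without meeting another hyperplane, and being above it means that λ_i attains its bound m i.

-- On the polygon side everything rests on one inequality: a non-crossing family of m-chords on the
-- vertices 0, ..., d + 1 has at most d / m members, where the closing side (0 , d + 1) may be
-- counted too. It makes an m-dissection maximal, bounds Λ_p, and decides whether -α_j is present.
-- The two statistics meet through conjugation: λ_j is the number of p with Λ_{p+1} ≥ n + 1 - j, so
-- for 1 ≤ j ≤ n the equation λ_j = m j says precisely that Λ_{mj} ≥ n + 1 - j. On the real side the
-- obstacle is that the order is not decidable. A side of a hyperplane is never found by comparing
-- numbers but is read off the apartness evidence that a point of the complement carries; minima are
-- replaced by explicit smaller quantities; and connectedness of a convex cell is proved by
-- bisection with positive margins. Points with prescribed λ are constructed in ℕ, where comparison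
-- is decidable, and only then scaled into V.

module Combinatorics where

  open import Data.Bool.Base using (Bool; true; false; if_then_else_; not)
  import Data.Bool.Properties as Bool
  open import Data.Empty using (⊥; ⊥-elim)
  open import Data.Fin.Base using (toℕ)
  open import Data.Fin.Properties using (toℕ<n)
  open import Data.List.Base using (List; []; _∷_; length; map; filter)
  open import Data.List.Membership.Propositional using (_∈_; _∉_; find; lose)
  open import Data.List.Membership.Propositional.Properties using (∈-map⁺; ∈-map⁻; ∈-filter⁺; ∈-filter⁻)
  open import Data.List.Properties using (length-map; filter-notAll; filter-accept; filter-reject; filter-all)
  open import Data.List.Relation.Unary.All as All using (All)
  open import Data.List.Relation.Unary.AllPairs as AllPairs using (AllPairs)
  open import Data.List.Relation.Unary.Any as Any using (Any; here; there)
  open import Data.List.Relation.Unary.Unique.Propositional using (Unique)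
  import Data.List.Relation.Unary.Unique.Propositional.Properties as Unique
  open import Data.Nat.Base
  open import Data.Nat.DivMod
  open import Data.Nat.Divisibility using (_∣_; divides; ∣m+n∣m⇒∣n; n∣m*n)
  open import Data.Nat.Induction using (<-rec)
  open import Data.Nat.Properties
  open import Data.Nat.Tactic.RingSolver using (solve)
  open import Data.Product.Base as Product using (_×_; _,_; proj₁; proj₂)
  open import Data.Product.Properties using (≡-dec)
  open import Data.Sum.Base using (_⊎_; inj₁; inj₂; swap; [_,_]′)
  open import Function.Base using (_∘_; case_of_)
  open import Function.Bundles using (mk⇔; Equivalence)
  open import Level using (0ℓ)
  open import Relation.Binary.Bundles using (Setoid)
  open import Relation.Binary.Definitions using (DecidableEquality; Tri; tri<; tri≈; tri>)
  open import Relation.Binary.PropositionalEquality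
  open import Relation.Nullary.Decidable using (yes; no; does; ¬?; _×-dec_)
  open import Relation.Nullary.Negation using (¬_; contradiction)
  open import Relation.Unary using (Pred; Decidable)

  -- A Farkas certificate: `_⊕_` and `_⊛_` combine the hypotheses into one inequality a ≤ b, `s` is
  -- the slack, and what is left is an identity for the ring solver, so truncated subtraction never
  -- enters.
  lin : ∀ {a b c d} → a ≤ b → (s : ℕ) → c + b + s ≡ d + a → c ≤ d
  lin {a} {b} {c} {d} h s e = +-cancelʳ-≤ a c d
    (≤-trans (+-monoʳ-≤ c h) (≤-trans (m≤m+n (c + b) s) (≤-reflexive e)))

  lin-⊥ : ∀ {a b} → a ≤ b → (s : ℕ) → 1 + b + s ≡ a → ⊥
  lin-⊥ h s e with lin {c = 1} {d = 0} h s e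
  ... | ()

  infixl 6 _⊕_
  _⊕_ : ∀ {a b c d} → a ≤ b → c ≤ d → a + c ≤ b + d
  _⊕_ = +-mono-≤

  _≟ᶜ_ : DecidableEquality Chord
  _≟ᶜ_ = ≡-dec _≟_ _≟_

  infixr 7 _⊛_
  _⊛_ : ∀ m {a b} → a ≤ b → m * a ≤ m * b
  m ⊛ h = *-monoʳ-≤ m h

  open import Data.List.Membership.DecPropositional _≟ᶜ_ using (_∈?_)

  module _ {A : Set} (_≟′_ : DecidableEquality A) where

    without : A → List A → List A
    without c = filter (λ x → ¬? (x ≟′ c))

    unique-⊆⇒length-≤ : ∀ {xs ys : List A} → Unique xs → (∀ {x} → x ∈ xs → x ∈ ys) →
      length xs ≤ length ys
    unique-⊆⇒length-≤ AllPairs.[] _ = z≤n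
    unique-⊆⇒length-≤ {x ∷ xs} {ys} (x∉ AllPairs.∷ u) sub = ≤-trans
      (s≤s (unique-⊆⇒length-≤ {ys = without x ys} u
        (λ z∈ → ∈-filter⁺ (λ z → ¬? (z ≟′ x)) (sub (there z∈)) (λ { refl → All.lookup x∉ z∈ refl }))))
      (filter-notAll (λ z → ¬? (z ≟′ x)) ys (Any.map (λ { refl ¬r → ¬r refl }) (sub (here refl))))

    length-without : ∀ {x : A} {xs} → Unique xs → length xs ≤ suc (length (without x xs))
    length-without {x} {xs} u = unique-⊆⇒length-≤ u sub
      where
      sub : ∀ {z} → z ∈ xs → z ∈ x ∷ without x xs
      sub {z} z∈ with z ≟′ x
      ... | yes z≡x = here z≡x
      ... | no z≢x  = there (∈-filter⁺ (λ z → ¬? (z ≟′ x)) z∈ z≢x)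

  map-preimage : ∀ {A B : Set} (f : A → B) (xs : List B) → (∀ {x} → x ∈ xs → ∃ λ y → f y ≡ x) →
    ∃ λ ys → map f ys ≡ xs
  map-preimage f []       h = [] , refl
  map-preimage f (x ∷ xs) h with h (here refl) | map-preimage f xs (h ∘ there)
  ... | y , p | ys , q = y ∷ ys , cong₂ _∷_ p q

  minimal : ∀ {A : Set} (f : A → ℕ) (x : A) (xs : List A) →
    ∃ λ y → y ∈ x ∷ xs × (∀ {z} → z ∈ x ∷ xs → f y ≤ f z)
  minimal f x [] = x , here refl , λ { (here refl) → ≤-refl }
  minimal f x (x′ ∷ xs) with minimal f x′ xs
  ... | y , y∈ , y≤ with ≤-total (f x) (f y)
  ...   | inj₁ x≤y = x , here refl , λ { (here refl) → ≤-refl ; (there z∈) → ≤-trans x≤y (y≤ z∈) }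
  ...   | inj₂ y≤x = y , there y∈ , λ { (here refl) → y≤x ; (there z∈) → y≤ z∈ }

  Crossing-irrefl : ∀ {c} → ¬ Crossing c c
  Crossing-irrefl (inj₁ (a<a , _)) = <-irrefl refl a<a
  Crossing-irrefl (inj₂ (a<a , _)) = <-irrefl refl a<a

  AllPairs⇒∈ : ∀ {S} → AllPairs (λ d d′ → ¬ Crossing d d′) S → ∀ {c d} → c ∈ S → d ∈ S → ¬ Crossing c d
  AllPairs⇒∈ (p AllPairs.∷ ps) (here refl) (here refl) = Crossing-irrefl
  AllPairs⇒∈ (p AllPairs.∷ ps) (here refl) (there d∈)  = All.lookup p d∈
  AllPairs⇒∈ (p AllPairs.∷ ps) (there c∈)  (here refl) = All.lookup p c∈ ∘ swap
  AllPairs⇒∈ (p AllPairs.∷ ps) (there c∈)  (there d∈)  = AllPairs⇒∈ ps c∈ d∈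

  ∈⇒AllPairs : ∀ {S} → (∀ {c d} → c ∈ S → d ∈ S → ¬ Crossing c d) → AllPairs (λ d d′ → ¬ Crossing d d′) S
  ∈⇒AllPairs {[]}    h = AllPairs.[]
  ∈⇒AllPairs {c ∷ S} h = All.tabulate (λ d∈ → h (here refl) (there d∈)) AllPairs.∷ ∈⇒AllPairs (λ c∈ d∈ → h (there c∈) (there d∈))

  -- Renumbering vertices when an edge is expanded

  Inside : ℕ → ℕ → Pred Chord _
  Inside l h (a , b) = l ≤ a × b ≤ h

  -- Replacing the edge (t , t + 1) of the polygon by an edge (t , t + 1 + s), with s new
  -- vertices beyond it, renumbers the vertices by expand t s.

  expand : ℕ → ℕ → ℕ → ℕ
  expand t s x = [ (λ _ → x) , (λ _ → x + s) ]′ (≤-<-connex x t)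

  module _ (t s : ℕ) where

    expand-view : ∀ x → (x ≤ t × expand t s x ≡ x) ⊎ (t < x × expand t s x ≡ x + s)
    expand-view x with ≤-<-connex x t
    ... | inj₁ p = inj₁ (p , refl)
    ... | inj₂ p = inj₂ (p , refl)

    expand-mono-≤ : ∀ {x y} → x ≤ y → expand t s x ≤ expand t s y
    expand-mono-≤ {x} {y} x≤y with expand t s x | expand t s y | expand-view x | expand-view y
    ... | _ | _ | inj₁ (_ , refl) | inj₁ (_ , refl) = x≤y
    ... | _ | _ | inj₁ (_ , refl) | inj₂ (_ , refl) = ≤-trans x≤y (m≤m+n y s)
    ... | _ | _ | inj₂ (p , refl) | inj₁ (q , refl) = contradiction (≤-trans x≤y q) (<⇒≱ p)
    ... | _ | _ | inj₂ (_ , refl) | inj₂ (_ , refl) = +-monoˡ-≤ s x≤y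

    expand-mono-< : ∀ {x y} → x < y → expand t s x < expand t s y
    expand-mono-< {x} {y} x<y with expand t s x | expand t s y | expand-view x | expand-view y
    ... | _ | _ | inj₁ (_ , refl) | inj₁ (_ , refl) = x<y
    ... | _ | _ | inj₁ (_ , refl) | inj₂ (_ , refl) = ≤-trans x<y (m≤m+n y s)
    ... | _ | _ | inj₂ (p , refl) | inj₁ (q , refl) = contradiction (≤-trans (<⇒≤ x<y) q) (<⇒≱ p)
    ... | _ | _ | inj₂ (_ , refl) | inj₂ (_ , refl) = +-monoˡ-< s x<y

    expand-cancel-< : ∀ {x y} → expand t s x < expand t s y → x < y
    expand-cancel-< {x} {y} h with x <? y
    ... | yes p = p
    ... | no ¬p = contradiction h (≤⇒≯ (expand-mono-≤ (≮⇒≥ ¬p)))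

    expand-injective : ∀ {x y} → expand t s x ≡ expand t s y → x ≡ y
    expand-injective {x} {y} e with <-cmp x y
      where open import Relation.Binary.Definitions using (tri<; tri≈; tri>)
    ... | c = go c
      where
      open import Relation.Binary.Definitions using (Tri; tri<; tri≈; tri>)
      go : Tri (x < y) (x ≡ y) (x > y) → x ≡ y
      go (tri< p _ _) = contradiction (expand-mono-< p) (<-irrefl e)
      go (tri≈ _ p _) = p
      go (tri> _ _ p) = contradiction (expand-mono-< p) (<-irrefl (sym e))

    expand-surjective : ∀ {z} → z ≤ t ⊎ t + suc s ≤ z → ∃ λ x → expand t s x ≡ z
    expand-surjective {z} h with z ≤? t
    expand-surjective {z} _ | yes p = z , lemma
      where
      lemma : expand t s z ≡ z
      lemma with expand t s z | expand-view z
      ... | _ | inj₁ (_ , q) = q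
      ... | _ | inj₂ (q , _) = contradiction p (<⇒≱ q)
    expand-surjective {z} (inj₁ p) | no ¬p = contradiction p ¬p
    expand-surjective {z} (inj₂ p) | no ¬p = z ∸ s , lemma
      where
      suc-t+s≤z : suc t + s ≤ z
      suc-t+s≤z = ≤-trans (≤-reflexive (sym (+-suc t s))) p
      t<z∸s : t < z ∸ s
      t<z∸s = m+n≤o⇒m≤o∸n (suc t) suc-t+s≤z
      lemma : expand t s (z ∸ s) ≡ z
      lemma with expand t s (z ∸ s) | expand-view (z ∸ s)
      ... | _ | inj₁ (q , _) = contradiction q (<⇒≱ t<z∸s)
      ... | _ | inj₂ (_ , q) = trans q (m∸n+n≡m (m+n≤o⇒n≤o (suc t) suc-t+s≤z))

    expandChord : Chord → Chord
    expandChord (a , b) = expand t s a , expand t s b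

    expandChord-injective : ∀ {c d} → expandChord c ≡ expandChord d → c ≡ d
    expandChord-injective e = cong₂ _,_ (expand-injective (cong proj₁ e)) (expand-injective (cong proj₂ e))

    Crossing-expand⁺ : ∀ {c d} → Crossing c d → Crossing (expandChord c) (expandChord d)
    Crossing-expand⁺ (inj₁ (p , q , r)) = inj₁ (expand-mono-< p , expand-mono-< q , expand-mono-< r)
    Crossing-expand⁺ (inj₂ (p , q , r)) = inj₂ (expand-mono-< p , expand-mono-< q , expand-mono-< r)

    Crossing-expand⁻ : ∀ {c d} → Crossing (expandChord c) (expandChord d) → Crossing c d
    Crossing-expand⁻ (inj₁ (p , q , r)) = inj₁ (expand-cancel-< p , expand-cancel-< q , expand-cancel-< r)
    Crossing-expand⁻ (inj₂ (p , q , r)) = inj₂ (expand-cancel-< p , expand-cancel-< q , expand-cancel-< r)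

  -- An endpoint strictly between x and y would force the chord to cross (x , y) or to lie inside
  -- it. The conclusion is what `expand-surjective` asks for, so the chord survives when (x , y) is
  -- contracted to an edge.
  outside⇒avoids : ∀ {x y a b} → a < b → ¬ Crossing (x , y) (a , b) → ¬ Inside x y (a , b) →
    (a ≤ x ⊎ y ≤ a) × (b ≤ x ⊎ y ≤ b)
  outside⇒avoids {x} {y} {a} {b} a<b ¬cr ¬in = left , right
    where
    left : a ≤ x ⊎ y ≤ a
    left with a ≤? x | y ≤? a | b ≤? y
    ... | yes p | _     | _     = inj₁ p
    ... | no _  | yes q | _     = inj₂ q
    ... | no ¬p | no _  | yes r = contradiction (<⇒≤ (≰⇒> ¬p) , r) ¬in
    ... | no ¬p | no ¬q | no ¬r = contradiction (inj₁ (≰⇒> ¬p , ≰⇒> ¬q , ≰⇒> ¬r)) ¬cr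
    right : b ≤ x ⊎ y ≤ b
    right with b ≤? x | y ≤? b | x ≤? a
    ... | yes p | _     | _     = inj₁ p
    ... | no _  | yes q | _     = inj₂ q
    ... | no ¬p | no ¬q | yes r = contradiction (r , <⇒≤ (≰⇒> ¬q)) ¬in
    ... | no ¬p | no ¬q | no ¬r = contradiction (inj₂ (≰⇒> ¬r , ≰⇒> ¬p , ≰⇒> ¬q)) ¬cr

  private
    shift : ∀ a s x → a + s + suc x ≡ a + suc x + s
    shift a s x = solve (a ∷ s ∷ x ∷ [])

    no-jump : ∀ {t a b s x} → t < a → b ≤ t → b ≡ a + s + suc x → ⊥
    no-jump {t} {a} {b} {s} {x} p q e = lin-⊥ (p ⊕ q ⊕ ≤-reflexive (sym e)) (s + x + 1) (solve (t ∷ a ∷ b ∷ s ∷ x ∷ []))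

    shrink : ∀ a m k o → a + suc (m * suc (k + o)) ≡ a + suc (m * suc o) + m * k
    shrink a m k o = solve (a ∷ m ∷ k ∷ o ∷ [])

    short⇒≥ : ∀ {t a b s x} → t < b → x ≤ s → b + s ≡ a + suc x → t ≤ a
    short⇒≥ {t} {a} {b} {s} {x} q h e = lin (q ⊕ h ⊕ ≤-reflexive e) 0 (solve (t ∷ a ∷ b ∷ s ∷ x ∷ []))

    short⇒≤ : ∀ {t a b s x} → a ≤ t → x ≤ s → b + s ≡ a + suc x → b + s ≤ t + suc s
    short⇒≤ {t} {a} {b} {s} {x} q h e = lin (q ⊕ h ⊕ ≤-reflexive e) 0 (solve (t ∷ a ∷ b ∷ s ∷ x ∷ []))

    inside-long : ∀ {x s a u} → x ≤ a → a + suc u ≤ x + suc s → s ≤ u → a ≡ x × u ≡ s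
    inside-long {x} {s} {a} {u} p q r =
      ≤-antisym (lin (q ⊕ r) 0 (solve (x ∷ s ∷ a ∷ u ∷ []))) p ,
      ≤-antisym (lin (q ⊕ p) 0 (solve (x ∷ s ∷ a ∷ u ∷ []))) r

    grow : ∀ {m l l′ j d} → l ≤ suc l′ → m * l′ ≤ d → m * l ≤ d + m * suc j
    grow {m} {l} {l′} {j} {d} p q = lin (m ⊛ p ⊕ q) (m * j) (solve (m ∷ l ∷ l′ ∷ j ∷ d ∷ []))

    split-bound : ∀ {x s d} → x + suc s ≤ suc d → ∃ λ d′ → d ≡ d′ + s × x < suc d′
    split-bound {x} {s} {d} h with m≤n⇒∃[o]m+o≡n {s} {d} (lin h x (solve (x ∷ s ∷ d ∷ [])))
    ... | o , refl = o , +-comm s o , lin h 0 (solve (x ∷ s ∷ o ∷ []))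

  -- Non-crossing families of m-chords and their size

  module MChords (m : ℕ) (1≤m : 1 ≤ m) where

    -- The part cut off has m (k + 1) + 2 vertices. Edges are excluded, but the closing side (0 , M)
    -- can qualify; admitting it lets the size bound apply to a polygon cut off by a chord, with
    -- that chord as closing side.
    IsMChord : Pred Chord _
    IsMChord (a , b) = ∃ λ k → b ≡ a + suc (m * suc k)

    record Family (M : ℕ) (S : List Chord) : Set where
      field
        mChord      : ∀ {c} → c ∈ S → IsMChord c
        bounded     : ∀ {c} → c ∈ S → proj₂ c ≤ M
        unique      : Unique S
        nonCrossing : ∀ {c d} → c ∈ S → d ∈ S → ¬ Crossing c d

    IsMChord⇒< : ∀ {a b} → IsMChord (a , b) → a < b
    IsMChord⇒< {a} (k , refl) = m<m+n a (s≤s z≤n)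

    Family-filter : ∀ {M S} {P : Pred Chord 0ℓ} (P? : Decidable P) → Family M S → Family M (filter P? S)
    Family-filter {S = S} P? F = record
      { mChord      = mChord ∘ ∈S
      ; bounded     = bounded ∘ ∈S
      ; unique      = Unique.filter⁺ P? unique
      ; nonCrossing = λ c∈ d∈ → nonCrossing (∈S c∈) (∈S d∈)
      }
      where
      open Family F
      ∈S : ∀ {c} → c ∈ filter P? S → c ∈ S
      ∈S = proj₁ ∘ ∈-filter⁻ P?

    Family-∷ : ∀ {M S c} → Family M S → IsMChord c → proj₂ c ≤ M → c ∉ S →
      (∀ {d} → d ∈ S → ¬ Crossing c d) → Family M (c ∷ S)
    Family-∷ {S = S} {c} F mc bc c∉ nc = record
      { mChord      = λ { (here refl) → mc ; (there d∈) → mChord d∈ }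
      ; bounded     = λ { (here refl) → bc ; (there d∈) → bounded d∈ }
      ; unique      = All.tabulate (λ { d∈ refl → c∉ d∈ }) AllPairs.∷ unique
      ; nonCrossing = cr
      }
      where
      open Family F
      cr : ∀ {d e} → d ∈ c ∷ S → e ∈ c ∷ S → ¬ Crossing d e
      cr (here refl) (here refl) = Crossing-irrefl
      cr (here refl) (there e∈)  = nc e∈
      cr (there d∈)  (here refl) = nc d∈ ∘ swap
      cr (there d∈)  (there e∈)  = nonCrossing d∈ e∈

    -- Inverse to expansion: the `m * k` vertices strictly between the ends of the contracted chord
    -- disappear, and every chord of `S` keeps its length or loses exactly `m * k`.
    contract : ∀ {M S} t k → let s = m * k in Family (M + s) S →
      (∀ {c} → c ∈ S → ¬ Crossing (t , t + suc s) c) → (∀ {c} → c ∈ S → ¬ Inside t (t + suc s) c) →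
      t < M → ∃ λ S′ → map (expandChord t s) S′ ≡ S × Family M S′
    contract {M} {S} t k F ¬cr ¬in t<M
      with map-preimage (expandChord t s) S pre
      where
      s = m * k
      open Family F
      pre : ∀ {c} → c ∈ S → ∃ λ c′ → expandChord t s c′ ≡ c
      pre c∈ with outside⇒avoids (IsMChord⇒< (mChord c∈)) (¬cr c∈) (¬in c∈)
      ... | p , q = (proj₁ a′ , proj₁ b′) , cong₂ _,_ (proj₂ a′) (proj₂ b′)
        where
        a′ = expand-surjective t s p
        b′ = expand-surjective t s q
    ... | S′ , refl = S′ , refl , record
      { mChord      = λ c∈ → mc (∈-map⁺ f c∈) (mChord (∈-map⁺ f c∈))
      ; bounded     = λ c∈ → bd (bounded (∈-map⁺ f c∈))
      ; unique      = Unique.map⁻ unique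
      ; nonCrossing = λ c∈ d∈ → nonCrossing (∈-map⁺ f c∈) (∈-map⁺ f d∈) ∘ Crossing-expand⁺ t s
      }
      where
      s = m * k
      f = expandChord t s
      open Family F
      bd : ∀ {b} → expand t s b ≤ M + s → b ≤ M
      bd {b} h with expand t s b | expand-view t s b
      ... | _ | inj₁ (p , refl) = ≤-trans p (<⇒≤ t<M)
      ... | _ | inj₂ (_ , refl) = +-cancelʳ-≤ s b M h
      mc : ∀ {c} → f c ∈ S → IsMChord (f c) → IsMChord c
      mc {a , b} c∈ (j , e) with expand t s a | expand t s b | expand-view t s a | expand-view t s b | ¬in c∈
      ... | _ | _ | inj₁ (_ , refl) | inj₁ (_ , refl) | _ = j , e
      ... | _ | _ | inj₂ (_ , refl) | inj₂ (_ , refl) | _ = j , +-cancelʳ-≡ s b _ (trans e (shift a s (m * suc j)))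
      ... | _ | _ | inj₂ (p , refl) | inj₁ (q , refl) | _ = ⊥-elim (no-jump p q e)
      -- A chord reaching over the contracted stretch must be longer than it: with k > j its ends
      -- would be squeezed into the stretch, contrary to `¬in`.
      ... | _ | _ | inj₁ (p , refl) | inj₂ (q , refl) | ¬i with k ≤? j
      ...   | yes k≤j with m≤n⇒∃[o]m+o≡n k≤j
      ...     | o , refl = o , +-cancelʳ-≡ s b _ (trans e (shrink a m k o))
      mc {a , b} c∈ (j , e) | _ | _ | inj₁ (p , refl) | inj₂ (q , refl) | ¬i | no k≰j =
        contradiction (short⇒≥ q mj≤s e , short⇒≤ p mj≤s e) ¬i
        where
        mj≤s : m * suc j ≤ m * k
        mj≤s = *-monoʳ-≤ m (≰⇒> k≰j)

    -- Nothing else of the family lies inside a shortest chord, so this chord can be contracted, at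
    -- the cost of one chord and at least m vertices. `k` bounds the length of the list and drives
    -- the recursion.
    size-bound′ : ∀ k {d S} → length S ≤ k → Family (suc d) S → m * length S ≤ d
    size-bound′ k       {d} {[]}     _ F = ≤-trans (≤-reflexive (*-zeroʳ m)) z≤n
    size-bound′ (suc k) {d} {c₀ ∷ T} h F with minimal (λ { (a , b) → b ∸ a }) c₀ T
    ... | (x , y) , c∈ , shortest with mChord c∈
      where open Family F
    ...   | j , refl with split-bound {x} {m * suc j} {d} (Family.bounded F c∈)
    ...     | d′ , refl , x<d′
      with contract {suc d′} x (suc j) (Family-filter (λ z → ¬? (z ≟ᶜ (x , x + suc (m * suc j)))) F) ¬cr ¬in x<d′
      where
      open Family F
      ∈⁻ : ∀ {e} → e ∈ without _≟ᶜ_ (x , x + suc (m * suc j)) (c₀ ∷ T) → e ∈ c₀ ∷ T × e ≢ (x , x + suc (m * suc j))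
      ∈⁻ = ∈-filter⁻ (λ z → ¬? (z ≟ᶜ (x , x + suc (m * suc j))))
      ¬cr : ∀ {e} → e ∈ without _≟ᶜ_ (x , x + suc (m * suc j)) (c₀ ∷ T) → ¬ Crossing (x , x + suc (m * suc j)) e
      ¬cr e∈ = nonCrossing c∈ (proj₁ (∈⁻ e∈))
      ¬in : ∀ {e} → e ∈ without _≟ᶜ_ (x , x + suc (m * suc j)) (c₀ ∷ T) → ¬ Inside x (x + suc (m * suc j)) e
      ¬in {a , b} e∈ (p , q) with ∈⁻ e∈
      ... | e∈S , e≢c with mChord e∈S
      ...   | i , refl with inside-long p q (s≤s⁻¹ (subst₂ _≤_ (m+n∸m≡n x _) (m+n∸m≡n a _) (shortest e∈S)))
      ...     | refl , r = e≢c (cong (λ z → x , x + suc z) r)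
    ...       | S′ , refl′ , F′ = grow {m} {l′ = length S′} {j}
      (≤-trans (length-without _≟ᶜ_ {x , x + suc (m * suc j)} (Family.unique F)) (s≤s (≤-reflexive lengths)))
      (size-bound′ k (s≤s⁻¹ (≤-trans (≤-trans (s≤s (≤-reflexive (sym lengths))) shorter) h)) F′)
      where
      lengths : length (without _≟ᶜ_ (x , x + suc (m * suc j)) (c₀ ∷ T)) ≡ length S′
      lengths = trans (cong length (sym refl′)) (length-map (expandChord x (m * suc j)) S′)
      shorter : length (without _≟ᶜ_ (x , x + suc (m * suc j)) (c₀ ∷ T)) < length (c₀ ∷ T)
      shorter = filter-notAll (λ z → ¬? (z ≟ᶜ _)) (c₀ ∷ T) (Any.map (λ { refl ¬r → ¬r refl }) c∈)

    size-bound : ∀ {d S} → Family (suc d) S → m * length S ≤ d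
    size-bound = size-bound′ _ ≤-refl

  -- The vertices 0, …, M of the polygon are removed one by one from the ends of this interval,
  -- the p-th one from the left when fromLeft p is true.  After p removals the vertices from
  -- left p to M − right p remain.

  module Removal (m : ℕ) (1≤m : 1 ≤ m) (fromLeft : ℕ → Bool) where

    open MChords m 1≤m

    left right : ℕ → ℕ
    left zero     = zero
    left (suc p)  = if fromLeft p then suc (left p) else left p
    right zero    = zero
    right (suc p) = if fromLeft p then right p else suc (right p)

    left+right : ∀ p → left p + right p ≡ p
    left+right zero = refl
    left+right (suc p) with fromLeft p
    ... | true  = cong suc (left+right p)
    ... | false = trans (+-suc (left p) (right p)) (cong suc (left+right p))

    Remains : ℕ → ℕ → Pred Chord 0ℓ
    Remains M p (a , b) = left p ≤ a × b + right p ≤ M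

    remains? : ∀ M p → Decidable (Remains M p)
    remains? M p (a , b) = left p ≤? a ×-dec b + right p ≤? M

    remaining : ℕ → ℕ → List Chord → ℕ
    remaining M p S = length (filter (remains? M p) S)

    remains-pred : ∀ {M p c} → Remains M (suc p) c → Remains M p c
    remains-pred {M} {p} {a , b} (l , r) with fromLeft p
    ... | true  = <⇒≤ l , r
    ... | false = l , <⇒≤ (subst (_≤ M) (+-suc b (right p)) r)

    remains-all : ∀ {M S} → Family M S → ∀ {c} → c ∈ S → Remains M 0 c
    remains-all {M} F {a , b} c∈ = z≤n , subst (_≤ M) (sym (+-identityʳ b)) (Family.bounded F c∈)

    remains⇒p<M : ∀ {M p c} → IsMChord c → Remains M p c → p < M
    remains⇒p<M {M} {p} {a , b} mc (l , r) = subst (_< M) (left+right p)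
      (≤-trans (+-monoˡ-< (right p) (≤-trans (s≤s l) (IsMChord⇒< mc))) r)

    len : Chord → ℕ
    len (a , b) = b ∸ a

    -- A chord that remains after p removals but not after p + 1 ends in the vertex removed in between.

    longer-step : ∀ {M p a b a′ b′ x y} → IsMChord (a , b) → IsMChord (a′ , b′) →
      Remains M p (a , b) → ¬ Remains M (suc p) (a , b) →
      Remains M p (a′ , b′) → ¬ Remains M (suc p) (a′ , b′) →
      len (a , b) < len (a′ , b′) → Crossing (a , b) (x , y) →
      Crossing (a′ , b′) (x , y) ⊎ Remains M (suc p) (x , y)
    longer-step {M} {p} {a} {b} {a′} {b′} {x} {y} (j , refl) (j′ , refl) (l , r) ¬at (l′ , r′) ¬at′ lt cr
      -- The two chords share the removed vertex. A chord crossing the shorter one either crosses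
      -- the longer one too, or stays within it away from the shared vertex and hence remains.
      with fromLeft p | subst₂ _<_ (m+n∸m≡n a _) (m+n∸m≡n a′ _) lt
    ... | true | lt′ with ≤-antisym l (≮⇒≥ (λ h → ¬at (h , r))) | ≤-antisym l′ (≮⇒≥ (λ h → ¬at′ (h , r′)))
    longer-step {M} {p} {a} {b} {a′} {b′} {x} {y} (j , refl) (j′ , refl) (l , r) ¬at (l′ , r′) ¬at′ lt (inj₁
        (a<x , x<b , b<y)) | true | lt′ | refl | refl
      with y ≤? b′
    ... | yes y≤b′ = inj₂ (a<x , ≤-trans (+-monoˡ-≤ (right p) y≤b′) r′)
    ... | no  y≰b′ = inj₁ (inj₁ (a<x , <-trans x<b (+-monoʳ-< a lt′) , ≰⇒> y≰b′))
    longer-step {M} {p} {a} {b} {a′} {b′} {x} {y} (j , refl) (j′ , refl) (l , r) ¬at (l′ , r′) ¬at′ lt (inj₂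
        (x<a , a<y , y<b)) | true | lt′ | refl | refl
      = inj₁ (inj₂ (x<a , a<y , <-trans y<b (+-monoʳ-< a lt′)))
    longer-step {M} {p} {a} {b} {a′} {b′} {x} {y} (j , refl) (j′ , refl) (l , r) ¬at (l′ , r′) ¬at′ lt cr | false | lt′
      = go cr
      where
      b≡b′ : b ≡ b′
      b≡b′ = +-cancelʳ-≡ (right p) b b′ (trans
        (≤-antisym r (≮⇒≥ (λ h → ¬at (l , ≤-trans (≤-reflexive (+-suc b (right p))) h))))
        (sym (≤-antisym r′ (≮⇒≥ (λ h → ¬at′ (l′ , ≤-trans (≤-reflexive (+-suc b′ (right p))) h))))))
      a′<a : a′ < a
      a′<a = +-cancelʳ-< _ a′ a (≤-trans (+-monoʳ-< a′ lt′) (≤-reflexive (sym b≡b′)))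
      go : Crossing (a , b) (x , y) → Crossing (a′ , b′) (x , y) ⊎ left p ≤ x × y + suc (right p) ≤ M
      go (inj₁ (a<x , x<b , b<y)) = inj₁ (inj₁ (<-trans a′<a a<x , subst (x <_) b≡b′ x<b , subst (_< y) b≡b′ b<y))
      go (inj₂ (x<a , a<y , y<b)) with x <? a′
      ... | yes x<a′ = inj₁ (inj₂ (x<a′ , <-trans a′<a a<y , subst (y <_) b≡b′ y<b))
      ... | no  x≮a′ = inj₂ (≤-trans l′ (≮⇒≥ x≮a′) ,
        ≤-trans (≤-reflexive (+-suc y (right p))) (≤-trans (+-monoˡ-< (right p) y<b) r))

    -- Both chords end at the vertex removed between p and p + 1, so the length determines the other
    -- end.
    same-step : ∀ {M p c c′} → IsMChord c → IsMChord c′ →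
      Remains M p c → ¬ Remains M (suc p) c → Remains M p c′ → ¬ Remains M (suc p) c′ →
      len c ≡ len c′ → c ≡ c′
    same-step {M} {p} {a , b} {a′ , b′} (j , refl) (j′ , refl) (l , r) ¬at (l′ , r′) ¬at′ eq
      with fromLeft p | trans (sym (m+n∸m≡n a _)) (trans eq (m+n∸m≡n a′ _))
    ... | true | eq′ with ≤-antisym l (≮⇒≥ (λ h → ¬at (h , r))) | ≤-antisym l′ (≮⇒≥ (λ h → ¬at′ (h , r′)))
    ...   | refl | refl = cong (λ z → a , a + z) eq′
    same-step {M} {p} {a , b} {a′ , b′} (j , refl) (j′ , refl) (l , r) ¬at (l′ , r′) ¬at′ eq | false | eq′ =
      cong₂ _,_ (+-cancelʳ-≡ _ a a′ (trans b≡b′ (cong (a′ +_) (sym eq′)))) b≡b′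
      where
      b≡b′ : b ≡ b′
      b≡b′ = +-cancelʳ-≡ (right p) b b′ (trans
        (≤-antisym r (≮⇒≥ (λ h → ¬at (l , ≤-trans (≤-reflexive (+-suc b (right p))) h))))
        (sym (≤-antisym r′ (≮⇒≥ (λ h → ¬at′ (l′ , ≤-trans (≤-reflexive (+-suc b′ (right p))) h))))))

    -- A dissection is determined by its numbers of remaining diagonals

    module Determined {d n : ℕ} (bound : d < m * suc (suc n)) (whole : IsMChord (0 , suc d)) where

      M = suc d

      record Maximal (D : List Chord) : Set where
        field
          family  : Family M D
          size    : length D ≡ n
          proper  : (0 , M) ∉ D
        open Family family public

      -- Otherwise `D`, `c` and the closing side (0 , M) would form a family of n + 2 chords, and m
      -- (n + 2) exceeds the bound d.
      maximal : ∀ {D c} → Maximal D → IsMChord c → proj₂ c ≤ M → c ≢ (0 , M) →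
        (∀ {e} → e ∈ D → ¬ Crossing c e) → c ∈ D
      maximal {D} {c} X mc bc c≢ ¬cr with c ∈? D
      ... | yes c∈ = c∈
      ... | no  c∉ = contradiction (≤-trans bound (≤-trans (≤-reflexive (cong (λ z → m * suc (suc z)) (sym size)))
          (size-bound F₂))) (<-irrefl refl)
        where
        open Maximal X
        F₁ : Family M (c ∷ D)
        F₁ = Family-∷ family mc bc c∉ ¬cr
        F₂ : Family M ((0 , M) ∷ c ∷ D)
        F₂ = Family-∷ F₁ whole ≤-refl
          (λ { (here e) → c≢ (sym e) ; (there e∈) → proper e∈ })
          (λ { e∈ (inj₁ (_ , _ , M<b)) → <⇒≱ M<b (Family.bounded F₁ e∈) })

      module _ {D D′ : List Chord} (X : Maximal D) (X′ : Maximal D′)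
        (same : ∀ p → remaining M p D ≡ remaining M p D′) where

        private
          module X  = Maximal X
          module X′ = Maximal X′

        Agree : Chord → Set
        Agree c = (c ∈ D → c ∈ D′) × (c ∈ D′ → c ∈ D)

        -- Suppose `c` is missing from `D′`. If `D′` loses a longer chord in the same removal, then
        -- by `longer-step` whatever crosses `c` in `D′` would cross that chord or be an inner
        -- chord, hence also lie in `D`; so nothing crosses `c` and maximality puts it into `D′`.
        -- Otherwise all remaining chords of `D′` are already known to lie in `D`, which has `c` in
        -- addition, against the equal counts.
        agree-step : ∀ p → (∀ {c} → Remains M (suc p) c → Agree c) →
          ∀ {c} → Remains M p c → ¬ Remains M (suc p) c →
          (∀ {c′} → len c′ < len c → Remains M p c′ → ¬ Remains M (suc p) c′ → Agree c′) →
          c ∈ D → c ∈ D′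
        agree-step p inner {c} at ¬at shorter c∈D with c ∈? D′
        ... | yes c∈ = c∈
        ... | no  c∉ with Any.any? (λ e → remains? M p e ×-dec ¬? (remains? M (suc p) e) ×-dec len c <? len e) D′
        ...   | yes any with find any
        ...     | c′ , c′∈ , at′ , ¬at′ , lt = maximal X′ (X.mChord c∈D) (X.bounded c∈D) (λ { refl → X.proper c∈D }) ¬cr
          where
          ¬cr : ∀ {e} → e ∈ D′ → ¬ Crossing c e
          ¬cr {e} e∈ cr with longer-step (X.mChord c∈D) (X′.mChord c′∈) at ¬at at′ ¬at′ lt cr
          ... | inj₁ cr′ = X′.nonCrossing c′∈ e∈ cr′
          ... | inj₂ in′ = X.nonCrossing c∈D (proj₂ (inner in′) e∈) cr
        agree-step p inner {c} at ¬at shorter c∈D | no c∉ | no ¬any =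
          contradiction (≤-trans fewer (≤-reflexive (same p))) (<-irrefl refl)
          where
          sub : ∀ {e} → e ∈ c ∷ filter (remains? M p) D′ → e ∈ filter (remains? M p) D
          sub (here refl) = ∈-filter⁺ (remains? M p) c∈D at
          sub {e} (there e∈) with ∈-filter⁻ (remains? M p) e∈
          ... | e∈D′ , atₑ with remains? M (suc p) e
          ...   | yes inₑ = ∈-filter⁺ (remains? M p) (proj₂ (inner inₑ) e∈D′) atₑ
          ...   | no ¬inₑ with <-cmp (len e) (len c)
          ...     | tri< lt _ _ = ∈-filter⁺ (remains? M p) (proj₂ (shorter lt atₑ ¬inₑ) e∈D′) atₑ
          ...     | tri≈ _ eq _ = contradiction (subst (_∈ D′) (same-step (X′.mChord e∈D′)
              (X.mChord c∈D) atₑ ¬inₑ at ¬at eq) e∈D′) c∉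
          ...     | tri> _ _ gt = contradiction (lose e∈D′ (atₑ , ¬inₑ , gt)) ¬any
          fewer : remaining M p D′ < remaining M p D
          fewer = unique-⊆⇒length-≤ _≟ᶜ_
            (All.tabulate (λ e∈ c≡e → c∉ (subst (_∈ D′) (sym c≡e) (proj₁ (∈-filter⁻
                (remains? M p) e∈)))) AllPairs.∷ Unique.filter⁺ (remains? M p) X′.unique)
            sub

      same-remaining⇒⊆ : ∀ {D D′} → Maximal D → Maximal D′ → (∀ p → remaining M p D ≡ remaining M p D′) →
        ∀ {c} → c ∈ D → c ∈ D′
      same-remaining⇒⊆ {D} {D′} X X′ same c∈ = proj₁ (agree M 0 ≤-refl (remains-all (Maximal.family X) c∈)) c∈
        where
        agree : ∀ k p → M ≤ p + k → ∀ {c} → Remains M p c → Agree X X′ same c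
        agree zero p M≤p {c} at = (λ c∈ → absurd (Maximal.mChord X c∈)) , (λ c∈ → absurd (Maximal.mChord X′ c∈))
          where
          absurd : ∀ {A : Set} → IsMChord c → A
          absurd mc = contradiction (≤-trans M≤p (≤-reflexive (+-identityʳ p))) (<⇒≱ (remains⇒p<M mc at))
        -- Chords are compared from the innermost polygon outwards, and among those lost in the same
        -- removal from short to long.
        agree (suc k) p M≤p {c} at = <-rec Shorter step (len c) refl at
          where
          Shorter : ℕ → Set
          Shorter l = ∀ {c} → len c ≡ l → Remains M p c → Agree X X′ same c
          inner : ∀ {c} → Remains M (suc p) c → Agree X X′ same c
          inner = agree k (suc p) (≤-trans M≤p (≤-reflexive (+-suc p k)))
          step : ∀ l → (∀ {l′} → l′ < l → Shorter l′) → Shorter l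
          step l rec {c} refl at with remains? M (suc p) c
          ... | yes in′ = inner in′
          ... | no ¬at =
            agree-step X X′ same p inner at ¬at (λ lt at′ _ → rec lt refl at′) ,
            agree-step X′ X (sym ∘ same) p (λ i → Product.swap (inner i)) at ¬at
              (λ lt at′ _ → Product.swap (rec lt refl at′))

  length-filter-map : ∀ {A B : Set} {P : Pred B 0ℓ} {Q : Pred A 0ℓ} (P? : Decidable P) (Q? : Decidable Q) (f : A → B) →
    (∀ x → (P (f x) → Q x) × (Q x → P (f x))) → ∀ xs → length (filter P? (map f xs)) ≡ length (filter Q? xs)
  length-filter-map P? Q? f h [] = refl
  length-filter-map P? Q? f h (x ∷ xs) with P? (f x) | Q? x
  ... | yes _ | yes _ = cong suc (length-filter-map P? Q? f h xs)
  ... | no _  | no _  = length-filter-map P? Q? f h xs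
  ... | yes p | no ¬q = contradiction (proj₁ (h x) p) ¬q
  ... | no ¬p | yes q = contradiction (proj₂ (h x) q) ¬p

  length-filter-mono : ∀ {A : Set} {P Q : Pred A 0ℓ} (P? : Decidable P) (Q? : Decidable Q) →
    (∀ {x} → P x → Q x) → ∀ xs → length (filter P? xs) ≤ length (filter Q? xs)
  length-filter-mono P? Q? h [] = z≤n
  length-filter-mono P? Q? h (x ∷ xs) with P? x | Q? x
  ... | yes _ | yes _ = s≤s (length-filter-mono P? Q? h xs)
  ... | no _  | no _  = length-filter-mono P? Q? h xs
  ... | yes p | no ¬q = contradiction (h p) ¬q
  ... | no _  | yes _ = m≤n⇒m≤1+n (length-filter-mono P? Q? h xs)

  private
    ear-room : ∀ {m k p M} → m * suc k + suc p ≤ M + m → p < M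
    ear-room {m} {k} {p} {M} h = lin h (m * k) (solve (m ∷ k ∷ p ∷ M ∷ []))

    room : ∀ {m k p M} → m * suc k + suc p ≤ M → m ≤ M
    room {m} {k} {p} {M} h = lin h (m * k + suc p) (solve (m ∷ k ∷ p ∷ M ∷ []))

    lower : ∀ {m k p M} → m * suc k + p ≤ M + m → m * k + p ≤ M
    lower {m} {k} {p} {M} h = lin h 0 (solve (m ∷ k ∷ p ∷ M ∷ []))

    raise : ∀ a m k → a + suc (m * suc k) + m ≡ a + suc (m * suc (suc k))
    raise a m k = solve (a ∷ m ∷ k ∷ [])

    shift′ : ∀ a s x → a + suc x + s ≡ a + s + suc x
    shift′ a s x = solve (a ∷ s ∷ x ∷ [])

    lower′ : ∀ {m k M} → m * suc k + 1 < M + m → m * k + 1 < M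
    lower′ {m} {k} {M} h = lin h 0 (solve (m ∷ k ∷ M ∷ []))

    ear-fits : ∀ {t m r M} → suc t + r ≤ M → t + suc m + r ≤ M + m
    ear-fits {t} {m} {r} {M} h = lin h 0 (solve (t ∷ m ∷ r ∷ M ∷ []))

    too-long : ∀ {t m r M} → t + suc r ≡ M → t + suc m + suc r ≤ M + m → ⊥
    too-long {t} {m} {r} refl h = lin-⊥ h 0 (solve (t ∷ m ∷ r ∷ []))

    ear-short : ∀ {M m k} → suc M ≤ 2 → 1 ≤ M → m * suc k + 1 < M + m → ⊥
    ear-short {M} {m} {k} h h′ h″ = lin-⊥ (h ⊕ h″) (m * k) (solve (M ∷ m ∷ k ∷ []))

  -- Realising a prescribed sequence Λ by attaching ears

  module Existence (m : ℕ) (1≤m : 1 ≤ m) (fromLeft : ℕ → Bool) where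

    open MChords m 1≤m
    open Removal m 1≤m fromLeft

    left-mono : ∀ {p q} → p ≤′ q → left p ≤ left q
    left-mono ≤′-refl = ≤-refl
    left-mono (≤′-step {q} h) with fromLeft q
    ... | true  = m≤n⇒m≤1+n (left-mono h)
    ... | false = left-mono h

    right-mono : ∀ {p q} → p ≤′ q → right p ≤ right q
    right-mono ≤′-refl = ≤-refl
    right-mono (≤′-step {q} h) with fromLeft q
    ... | true  = right-mono h
    ... | false = m≤n⇒m≤1+n (right-mono h)

    -- Removal from the left has come to t + 1 at most, and t has not been removed from the right.
    -- So an endpoint shifted by m stays beyond the left cut, and the right cut is shifted along
    -- with it.
    remains-expand : ∀ {t M q} → left q ≤ suc t → t + right q ≤ M → ∀ c →
      (Remains (M + m) q (expandChord t m c) → Remains M q c) × (Remains M q c → Remains (M + m) q (expandChord t m c))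
    remains-expand {t} {M} {q} l≤ ≤M (a , b) = (λ { (h , h′) → to₁ h , to₂ h′ }) , (λ { (h , h′) → from₁ h , from₂ h′ })
      where
      to₁ : left q ≤ expand t m a → left q ≤ a
      to₁ h with expand t m a | expand-view t m a
      ... | _ | inj₁ (_ , refl) = h
      ... | _ | inj₂ (t<a , _)  = ≤-trans l≤ t<a
      from₁ : left q ≤ a → left q ≤ expand t m a
      from₁ h with expand t m a | expand-view t m a
      ... | _ | inj₁ (_ , refl) = h
      ... | _ | inj₂ (_ , refl) = ≤-trans h (m≤m+n a m)
      swap-m : b + m + right q ≡ b + right q + m
      swap-m = trans (+-assoc b m (right q)) (trans (cong (b +_) (+-comm m (right q))) (sym (+-assoc b (right q) m)))
      to₂ : expand t m b + right q ≤ M + m → b + right q ≤ M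
      to₂ h with expand t m b | expand-view t m b
      ... | _ | inj₁ (b≤t , _)  = ≤-trans (+-monoˡ-≤ (right q) b≤t) ≤M
      ... | _ | inj₂ (_ , refl) = +-cancelʳ-≤ m _ _ (subst (_≤ M + m) swap-m h)
      from₂ : b + right q ≤ M → expand t m b + right q ≤ M + m
      from₂ h with expand t m b | expand-view t m b
      ... | _ | inj₁ (_ , refl) = ≤-trans h (m≤m+n M m)
      ... | _ | inj₂ (_ , refl) = subst (_≤ M + m) (sym swap-m) (+-monoˡ-≤ m h)

    -- The ear is the image of the edge (t , t + 1), which is crossed by no chord and is itself no
    -- m-chord; so the ear is new and crosses nothing.
    expand-family : ∀ {M D} t → t < M → Family M D → Family (M + m) ((t , t + suc m) ∷ map (expandChord t m) D)
    expand-family {M} {D} t t<M F = Family-∷ F′ (0 , cong (λ z → t + suc z) (sym (*-identityʳ m)))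
      (≤-trans (≤-reflexive (+-suc t m)) (+-monoˡ-≤ m t<M)) ear∉ ¬cr
      where
      open Family F
      f = expandChord t m
      mc : ∀ {c} → IsMChord c → IsMChord (f c)
      mc {a , b} (j , refl) with expand t m a | expand t m b | expand-view t m a | expand-view t m b
      ... | _ | _ | inj₁ (_ , refl) | inj₁ (_ , refl) = j , refl
      ... | _ | _ | inj₁ (_ , refl) | inj₂ (_ , refl) = suc j , raise a m j
      ... | _ | _ | inj₂ (_ , refl) | inj₂ (_ , refl) = j , shift′ a m _
      ... | _ | _ | inj₂ (p , refl) | inj₁ (q , refl) = contradiction (≤-trans (m≤m+n a _) q) (<⇒≱ p)
      bd : ∀ {b} → b ≤ M → expand t m b ≤ M + m
      bd {b} h with expand t m b | expand-view t m b
      ... | _ | inj₁ (_ , refl) = ≤-trans h (m≤m+n M m)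
      ... | _ | inj₂ (_ , refl) = +-monoˡ-≤ m h
      F′ : Family (M + m) (map f D)
      F′ = record
        { mChord      = λ c∈ → case ∈-map⁻ f c∈ of λ { (c′ , c′∈ , refl) → mc (mChord c′∈) }
        ; bounded     = λ c∈ → case ∈-map⁻ f c∈ of λ { (c′ , c′∈ , refl) → bd (bounded c′∈) }
        ; unique      = Unique.map⁺ (λ {c} {d} → expandChord-injective t m {c} {d}) unique
        ; nonCrossing = λ c∈ d∈ → case ∈-map⁻ f c∈ of λ { (c′ , c′∈ , refl) → case ∈-map⁻ f d∈ of λ { (d′ , d′∈ , refl) →
            nonCrossing c′∈ d′∈ ∘ Crossing-expand⁻ t m {c′} {d′} } }
        }
      ear : f (t , suc t) ≡ (t , t + suc m)
      ear with expand t m t | expand t m (suc t) | expand-view t m t | expand-view t m (suc t)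
      ... | _ | _ | inj₁ (_ , refl) | inj₂ (_ , refl) = cong (t ,_) (sym (+-suc t m))
      ... | _ | _ | inj₂ (p , _) | _ = contradiction p (<-irrefl refl)
      ... | _ | _ | _ | inj₁ (p , _) = contradiction p (<-irrefl refl)
      ear∉ : (t , t + suc m) ∉ map f D
      ear∉ c∈ with ∈-map⁻ f c∈
      ... | c′ , c′∈ , e with expandChord-injective t m {t , suc t} {c′} (trans ear e)
      ...   | refl with mChord c′∈
      ...     | k , e′ = contradiction (+-cancelˡ-≡ t 1 _ (trans (+-comm t 1) e′))
        (λ { e″ → <⇒≢ (≤-trans 1≤m (m≤m*n m (suc k))) (suc-injective e″) })
      ¬cr : ∀ {e} → e ∈ map f D → ¬ Crossing (t , t + suc m) e
      ¬cr e∈ cr with ∈-map⁻ f e∈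
      ... | e′ , e′∈ , refl with Crossing-expand⁻ t m {t , suc t} {e′} (subst (λ z → Crossing z (f e′)) (sym ear) cr)
      ...   | inj₁ (t<x , x<1+t , _) = <⇒≱ t<x (s≤s⁻¹ x<1+t)
      ...   | inj₂ (_ , t<y , y<1+t) = <⇒≱ t<y (s≤s⁻¹ y<1+t)

    -- The ear is attached at the vertex that the next removal takes: on the left it starts at
    -- `left p`, on the right t is chosen so that it ends at the last remaining vertex of the
    -- enlarged polygon. So it survives p removals but not p + 1.
    earStart : ∀ {p M} → p < M → ∃ λ t → left p ≤ t × suc t + right p ≤ M × left (suc p) ≤ suc t × t + right (suc p) ≤ M ×
      ¬ Remains (M + m) (suc p) (t , t + suc m)
    earStart {p} {M} p<M with fromLeft p
    ... | true  = left p , ≤-refl , l+r<M , ≤-refl , <⇒≤ l+r<M , λ { (h , _) → <-irrefl refl h }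
      where
      l+r<M : suc (left p + right p) ≤ M
      l+r<M = subst (_< M) (sym (left+right p)) p<M
    ... | false = t , m+n≤o⇒m≤o∸n (left p) l+r<M , ≤-reflexive (trans (sym (+-suc t (right p))) t+r≡M) ,
      ≤-trans (m+n≤o⇒m≤o∸n (left p) l+r<M) (n≤1+n t) , ≤-reflexive t+r≡M ,
      λ { (_ , h) → too-long t+r≡M h }
      where
      l+r<M : left p + suc (right p) ≤ M
      l+r<M = subst (_≤ M) (sym (trans (+-suc (left p) (right p)) (cong suc (left+right p)))) p<M
      t = M ∸ suc (right p)
      t+r≡M : t + suc (right p) ≡ M
      t+r≡M = m∸n+n≡m (m+n≤o⇒n≤o (left p) l+r<M)

    antitone : ∀ {p} (Λ : ℕ → ℕ) → (∀ q → q < p → Λ (suc q) ≤ Λ q) → ∀ {q r} → q ≤ r → r ≤ p → Λ r ≤ Λ q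
    antitone {p} Λ mono q≤r = go (≤⇒≤′ q≤r)
      where
      go : ∀ {q r} → q ≤′ r → r ≤ p → Λ r ≤ Λ q
      go ≤′-refl         _   = ≤-refl
      go (≤′-step {r} h) r<p = ≤-trans (mono r r<p) (go h (<⇒≤ r<p))

    -- The closing side is excluded only under an inequality whose two sides both grow by m when an
    -- ear is added, so that the clause passes through the recursion.
    Realised : ℕ → ℕ → (ℕ → ℕ) → Set
    Realised p M Λ = ∃ λ D → Family M D × (∀ q → q ≤ p → remaining M q D ≡ Λ q) × (m * Λ 0 + 1 < M → (0 , M) ∉ D)

    no-ear : ∀ {p M Λ} → Λ p ≡ 0 → Λ (suc p) ≡ 0 → Realised p M Λ → Realised (suc p) M Λ
    no-ear {p} {M} {Λ} k≡ Λp≡0 (D , F , counts , proper) = D , F , counts′ , proper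
      where
      counts′ : ∀ q → q ≤ suc p → remaining M q D ≡ Λ q
      counts′ q q≤ with m≤n⇒m<n∨m≡n q≤
      ... | inj₁ q<  = counts q (s≤s⁻¹ q<)
      ... | inj₂ refl = trans (n≤0⇒n≡0 (≤-trans (length-filter-mono (remains? M (suc p)) (remains? M p) remains-pred D)
        (≤-reflexive (trans (counts p ≤-refl) k≡)))) (sym Λp≡0)

    -- The ear is counted after q ≤ p removals and no longer after p + 1, so it adds one to exactly
    -- the positive values.
    add-ear : ∀ {p M′} (Λ : ℕ → ℕ) → p < M′ → (∀ q → q ≤ p → 0 < Λ q) → Λ (suc p) ≡ 0 →
      Realised (suc p) M′ (pred ∘ Λ) → Realised (suc p) (M′ + m) Λ
    add-ear {p} {M′} Λ p<M′ Λ>0 Λp≡0 (D , F , counts , proper) with earStart p<M′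
    ... | t , l≤t , t+r<M , l≤1+t , t+r≤M , ¬rem =
      (t , t + suc m) ∷ map (expandChord t m) D , expand-family t t<M F , counts′ , proper′
      where
      t<M : t < M′
      t<M = ≤-trans (m≤m+n (suc t) (right p)) t+r<M
      positive : ∀ {q} → q ≤ p → suc (pred (Λ q)) ≡ Λ q
      positive {q} q≤p = suc-pred (Λ q) {{>-nonZero (Λ>0 q q≤p)}}
      counts′ : ∀ q → q ≤ suc p → remaining (M′ + m) q ((t , t + suc m) ∷ map (expandChord t m) D) ≡ Λ q
      counts′ q q≤ with m≤n⇒m<n∨m≡n q≤
      ... | inj₁ (s≤s q≤p) = trans (cong length (filter-accept (remains? (M′ + m) q) {xs = map (expandChord t m) D} earRemains))
        (trans (cong suc (trans (length-filter-map (remains? (M′ + m) q) (remains? M′ q) (expandChord t m)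
            (remains-expand {t} {M′} {q} (≤-trans l≤ (n≤1+n t)) (≤-trans (n≤1+n _) t+r<M′)) D) (counts q q≤)))
          (positive q≤p))
        where
        l≤ : left q ≤ t
        l≤ = ≤-trans (left-mono (≤⇒≤′ q≤p)) l≤t
        t+r<M′ : suc t + right q ≤ M′
        t+r<M′ = ≤-trans (+-monoʳ-≤ (suc t) (right-mono (≤⇒≤′ q≤p))) t+r<M
        earRemains : Remains (M′ + m) q (t , t + suc m)
        earRemains = l≤ , ear-fits {t} t+r<M′
      ... | inj₂ refl = trans (cong length (filter-reject (remains? (M′ + m) q) {xs = map (expandChord t m) D} ¬rem))
        (trans (length-filter-map (remains? (M′ + m) q) (remains? M′ q) (expandChord t m)
            (remains-expand {t} {M′} {suc p} l≤1+t t+r≤M) D)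
          (trans (counts q q≤) (trans (cong pred Λp≡0) (sym Λp≡0))))
      Λ0>0 : suc (pred (Λ 0)) ≡ Λ 0
      Λ0>0 = positive z≤n
      proper′ : m * Λ 0 + 1 < M′ + m → (0 , M′ + m) ∉ (t , t + suc m) ∷ map (expandChord t m) D
      proper′ h (here e) = ear-short {M′} {m} {pred (Λ 0)}
        (+-cancelʳ-≤ m _ _ (≤-reflexive (cong suc (trans (cong proj₂ e) (cong (_+ suc m) (sym (cong proj₁ e)))))))
        (≤-trans (s≤s z≤n) t<M) (subst (λ z → m * z + 1 < M′ + m) (sym Λ0>0) h)
      proper′ h (there c∈) with ∈-map⁻ (expandChord t m) c∈
      ... | c′ , c′∈ , e = proper (lower′ {m} {pred (Λ 0)} (subst (λ z → m * z + 1 < M′ + m) (sym Λ0>0) h))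
        (subst (_∈ D) (sym (expandChord-injective t m {0 , M′} {c′} (trans outer e))) c′∈)
        where
        outer : expandChord t m (0 , M′) ≡ (0 , M′ + m)
        outer with expand t m M′ | expand-view t m M′
        ... | _ | inj₂ (_ , refl) = refl
        ... | _ | inj₁ (p , _) = contradiction t<M (≤⇒≯ p)

    -- Lexicographic recursion on p and `k`, the last value before Λ is known to vanish. If it is 0
    -- the range shrinks; otherwise an ear is split off, which lowers all values by 1 and M by m and
    -- keeps the bound.
    exists : ∀ p k M (Λ : ℕ → ℕ) → k ≡ Λ (pred p) → (∀ q → q < p → Λ (suc q) ≤ Λ q) →
      (∀ q → q < p → m * Λ q + suc q ≤ M) → Λ p ≡ 0 → Realised p M Λ
    exists zero k M Λ _ mono bound Λp≡0 = [] ,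
      record { mChord = λ () ; bounded = λ () ; unique = AllPairs.[] ; nonCrossing = λ () } ,
      (λ { zero _ → sym Λp≡0 }) , λ _ ()
    exists (suc p) zero M Λ k≡ mono bound Λp≡0 = no-ear {Λ = Λ} (sym k≡) Λp≡0
      (exists p (Λ (pred p)) M Λ refl (λ q q<p → mono q (m≤n⇒m≤1+n q<p)) (λ q q<p → bound q (m≤n⇒m≤1+n q<p)) (sym k≡))
    exists (suc p) (suc k) M Λ k≡ mono bound Λp≡0 = subst (λ z → Realised (suc p) z Λ) (m∸n+n≡m m≤M)
      (add-ear Λ (ear-room {m} {k} (subst₂ (λ x y → m * x + suc p ≤ y) (sym k≡) (sym (m∸n+n≡m m≤M)) (bound p ≤-refl))) Λ>0 Λp≡0
        (exists (suc p) k (M ∸ m) (pred ∘ Λ) (cong pred k≡) (λ q q<p → pred-mono-≤ (mono q q<p)) bound′ (cong pred Λp≡0)))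
      where
      m≤M : m ≤ M
      m≤M = room {m} {k} {p} (subst (λ z → m * z + suc p ≤ M) (sym k≡) (bound p ≤-refl))
      Λ>0 : ∀ q → q ≤ p → 0 < Λ q
      Λ>0 q q≤p = ≤-trans (≤-trans (s≤s z≤n) (≤-reflexive k≡)) (antitone Λ mono q≤p (n≤1+n p))
      bound′ : ∀ q → q < suc p → m * pred (Λ q) + suc q ≤ M ∸ m
      bound′ q (s≤s q≤p) = lower {m} {pred (Λ q)} (subst₂ (λ x y → m * x + suc q ≤ y)
        (sym (suc-pred (Λ q) {{>-nonZero (Λ>0 q q≤p)}})) (sym (m∸n+n≡m m≤M)) (bound q (s≤s q≤p)))

  length-filter-complement : ∀ {A : Set} {P : Pred A 0ℓ} (P? : Decidable P) xs →
    length (filter P? xs) + length (filter (¬? ∘ P?) xs) ≡ length xs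
  length-filter-complement P? [] = refl
  length-filter-complement P? (x ∷ xs) with P? x
  ... | yes _ = cong suc (length-filter-complement P? xs)
  ... | no  _ = trans (+-suc _ _) (cong suc (length-filter-complement P? xs))

  private
    window : ∀ {a l r d} → a + l + r ≤ d + (l + r) → a ≤ d
    window {a} {l} {r} {d} h = lin h 0 (solve (a ∷ l ∷ r ∷ d ∷ []))

    slide : ∀ a l x → a + suc x + l ≡ a + l + suc x
    slide a l x = solve (a ∷ l ∷ x ∷ [])

    arith : ∀ m j k → suc (m * suc (j + k)) ≡ m * j + suc (m * suc k)
    arith m j k = solve (m ∷ j ∷ k ∷ [])

    exchange : ∀ a r x → a + r + x ≡ a + x + r
    exchange a r x = solve (a ∷ r ∷ x ∷ [])

    few-outside : ∀ {o r n j} → o + r ≡ n → suc o ≤ j → suc n ≤ j + r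
    few-outside {o} {r} {n} {j} refl h = lin h 0 (solve (o ∷ r ∷ j ∷ []))

  -- Counting the diagonals on either side of a chord

  module Intervals (m : ℕ) (1≤m : 1 ≤ m) where

    open MChords m 1≤m

    translate : ℕ → Chord → Chord
    translate l (a , b) = a + l , b + l

    interval-bound : ∀ {M S} l r d → Family M S → (∀ {c} → c ∈ S → l ≤ proj₁ c × proj₂ c + r ≤ suc d + (l + r)) →
      m * length S ≤ d
    interval-bound {M} {S} l r d F in′ with map-preimage (translate l) S pre
      where
      open Family F
      f = translate l
      pre : ∀ {c} → c ∈ S → ∃ λ c′ → f c′ ≡ c
      pre {a , b} c∈ = (a ∸ l , b ∸ l) , cong₂ _,_ (m∸n+n≡m l≤a) (m∸n+n≡m (≤-trans l≤a (<⇒≤ (IsMChord⇒< (mChord c∈)))))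
        where l≤a = proj₁ (in′ c∈)
    ... | S′ , refl = subst (λ z → m * z ≤ d) (sym (length-map (translate l) S′)) (size-bound record
      { mChord      = λ c∈ → mc (mChord (∈-map⁺ f c∈))
      ; bounded     = λ {c} c∈ → window {proj₂ c} {l} {r} (proj₂ (in′ (∈-map⁺ f c∈)))
      ; unique      = Unique.map⁻ unique
      ; nonCrossing = λ c∈ d∈ → nonCrossing (∈-map⁺ f c∈) (∈-map⁺ f d∈) ∘ cr
      })
      where
      open Family F
      f = translate l
      mc : ∀ {c} → IsMChord (f c) → IsMChord c
      mc {a , b} (j , e) = j , +-cancelʳ-≡ l b _ (trans e (sym (slide a l _)))
      cr : ∀ {c d} → Crossing c d → Crossing (f c) (f d)
      cr (inj₁ (p , q , r)) = inj₁ (+-monoˡ-< l p , +-monoˡ-< l q , +-monoˡ-< l r)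
      cr (inj₂ (p , q , r)) = inj₂ (+-monoˡ-< l p , +-monoˡ-< l q , +-monoˡ-< l r)

  module Statistics (m : ℕ) (1≤m : 1 ≤ m) (fromLeft : ℕ → Bool) (n : ℕ) where

    open MChords m 1≤m public
    open Removal m 1≤m fromLeft public
    open Intervals m 1≤m

    d : ℕ
    d = m * suc n

    open Determined {d} {n} (*-monoʳ-< m {{>-nonZero 1≤m}} ≤-refl) (n , refl) public

    remaining-bound : ∀ {D p} → Maximal D → p < M → m * remaining M p D + suc p ≤ M
    remaining-bound {D} {p} X p<M with m≤n⇒∃[o]m+o≡n p<M
    ... | o , e = ≤-trans (+-monoˡ-≤ (suc p) (interval-bound (left p) (right p) o (Family-filter (remains? M p)
        (Maximal.family X)) in′))
      (≤-reflexive (trans (+-comm o (suc p)) e))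
      where
      in′ : ∀ {c} → c ∈ filter (remains? M p) D → left p ≤ proj₁ c × proj₂ c + right p ≤ suc o + (left p + right p)
      in′ {c} c∈ with ∈-filter⁻ (remains? M p) {xs = D} c∈
      ... | _ , l≤ , ≤r = l≤ , subst (proj₂ c + right p ≤_) (trans (sym e) (trans (cong suc (+-comm p o)) (cong
          (suc o +_) (sym (left+right p))))) ≤r

    remaining-zero : ∀ {D p} → Maximal D → M ≤ p → remaining M p D ≡ 0
    remaining-zero {D} {p} X M≤p with filter (remains? M p) D in eq
    ... | [] = refl
    ... | c ∷ _ with ∈-filter⁻ (remains? M p) {xs = D} (subst (c ∈_) (sym eq) (here refl))
    ...   | c∈ , at = contradiction M≤p (<⇒≱ (remains⇒p<M (Maximal.mChord X c∈) at))

    remaining-antitone : ∀ D p → remaining M (suc p) D ≤ remaining M p D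
    remaining-antitone D p = length-filter-mono (remains? M (suc p)) (remains? M p) remains-pred D

    -- For the removal order of module Dissections, (a , b) is the diagonal −α_j.

    module Boundary {D : List Chord} (X : Maximal D) (j k : ℕ) (j+k≡n : j + k ≡ n) (1≤j : 1 ≤ j)
      (a b : ℕ) (left≡ : left (m * j) ≡ a) (right≡ : b + right (m * j) ≡ M) where

      b≡ : b ≡ a + suc (m * suc k)
      b≡ = +-cancelʳ-≡ (right (m * j)) b _ (trans right≡ (trans (cong (λ z → suc (m * suc z)) (sym j+k≡n))
        (trans (arith m j k) (trans (cong (_+ suc (m * suc k)) (sym (left+right (m * j))))
        (trans (cong (λ z → z + right (m * j) + suc (m * suc k)) left≡) (exchange a (right (m * j)) (suc (m * suc k))))))))

      -- Contracting the inside of (a , b) leaves a polygon with last vertex m j + 1. The diagonals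
      -- outside, together with its closing side, number at most j; so fewer than j lie outside and
      -- at least n + 1 - j remain.
      boundary∈⇒ : (a , b) ∈ D → suc n ≤ j + remaining M (m * j) D
      boundary∈⇒ c∈ = few-outside (trans (+-comm _ (remaining M (m * j) D)) (trans (length-filter-complement (remains? M
          (m * j)) D) size)) |outer|<j
        where
        open Maximal X
        s = m * suc k
        M′ = suc (m * j)
        M≡ : M ≡ M′ + s
        M≡ = trans (cong (λ z → suc (m * suc z)) (sym j+k≡n)) (trans (arith m j k) (+-suc (m * j) s))
        outer = filter (¬? ∘ remains? M (m * j)) D
        outer⁻ : ∀ {e} → e ∈ outer → e ∈ D × ¬ Remains M (m * j) e
        outer⁻ = ∈-filter⁻ (¬? ∘ remains? M (m * j))
        a<M′ : a < M′
        a<M′ = s≤s (subst₂ _≤_ left≡ (left+right (m * j)) (m≤m+n (left (m * j)) (right (m * j))))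
        contracted : ∃ λ S′ → map (expandChord a s) S′ ≡ outer × Family M′ S′
        contracted = contract a (suc k) (subst (λ z → Family z outer) M≡ (Family-filter (¬? ∘ remains? M (m * j)) family))
          (λ e∈ → subst (λ z → ¬ Crossing (a , z) _) b≡ (nonCrossing c∈ (proj₁ (outer⁻ e∈))))
          (λ { {x , y} e∈ (a≤x , y≤) → proj₂ (outer⁻ e∈) (subst (_≤ x) (sym left≡) a≤x ,
            subst (y + right (m * j) ≤_) right≡ (+-monoˡ-≤ (right (m * j)) (subst (y ≤_) (sym b≡) y≤))) }) a<M′
        whole↦ : expandChord a s (0 , M′) ≡ (0 , M′ + s)
        whole↦ with expand a s M′ | expand-view a s M′
        ... | _ | inj₂ (_ , refl) = refl
        ... | _ | inj₁ (p , _) = contradiction a<M′ (≤⇒≯ p)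
        |outer|<j : length outer < j
        |outer|<j with contracted
        ... | S′ , e , F′ = *-cancelˡ-≤ m {{>-nonZero 1≤m}}
          (subst (λ z → m * suc z ≤ m * j) (trans (sym (length-map (expandChord a s) S′)) (cong length e))
              (size-bound {m * j} (Family-∷ {c = 0 , M′} F′ (pred j , cong (λ z → suc (m * z)) (sym
                  (suc-pred j {{>-nonZero 1≤j}}))) ≤-refl
            (λ w∈ → proper (proj₁ (outer⁻ (subst (_∈ outer) (trans whole↦ (cong (0 ,_) (sym M≡))) (subst
                (expandChord a s (0 , M′) ∈_) e (∈-map⁺ (expandChord a s) w∈))))))
            (λ { e∈ (inj₁ (_ , _ , M<b)) → <⇒≱ M<b (Family.bounded F′ e∈) }))))

      -- Were (a , b) missing, it could be added to the diagonals remaining after m j removals,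
      -- which it does not cross because it closes their window. The size bound m (k + 1) then
      -- leaves at most k = n - j of them.
      boundary∈⇐ : suc n ≤ j + remaining M (m * j) D → (a , b) ∈ D
      boundary∈⇐ h with (a , b) ∈? D
      ... | yes c∈ = c∈
      ... | no  c∉ = contradiction (≤-trans h (≤-trans (+-monoʳ-≤ j (s≤s⁻¹
          (*-cancelˡ-≤ m {{>-nonZero 1≤m}} inside-bound))) (≤-reflexive j+k≡n))) (<-irrefl refl)
        where
        open Maximal X
        c-in : Remains M (m * j) (a , b)
        c-in = ≤-reflexive left≡ , ≤-reflexive right≡
        F = Family-filter (remains? M (m * j)) family
        e-in : ∀ {e} → e ∈ filter (remains? M (m * j)) D → Remains M (m * j) e
        e-in e∈ = proj₂ (∈-filter⁻ (remains? M (m * j)) {xs = D} e∈)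
        ¬cr : ∀ {e} → e ∈ filter (remains? M (m * j)) D → ¬ Crossing (a , b) e
        ¬cr {x , y} e∈ (inj₁ (_ , _ , b<y)) = <⇒≱ b<y (+-cancelʳ-≤ (right (m * j)) y b (≤-trans (proj₂ (e-in e∈))
            (≤-reflexive (sym right≡))))
        ¬cr {x , y} e∈ (inj₂ (x<a , _ , _)) = <⇒≱ x<a (subst (_≤ x) left≡ (proj₁ (e-in e∈)))
        F′ : Family M ((a , b) ∷ filter (remains? M (m * j)) D)
        F′ = Family-∷ F (k , b≡) (m+n≤o⇒m≤o b (≤-reflexive right≡)) (λ c∈ → c∉ (proj₁ (∈-filter⁻ (remains? M (m * j)) c∈))) ¬cr
        M≡ : M ≡ suc (m * suc k) + (left (m * j) + right (m * j))
        M≡ = trans (cong (λ z → suc (m * suc z)) (sym j+k≡n)) (trans (arith m j k)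
          (trans (+-comm (m * j) _) (cong (suc (m * suc k) +_) (sym (left+right (m * j))))))
        inside-bound : m * suc (remaining M (m * j) D) ≤ m * suc k
        inside-bound = interval-bound (left (m * j)) (right (m * j)) (m * suc k) F′ λ
          { (here refl) → proj₁ c-in , ≤-trans (proj₂ c-in) (≤-reflexive M≡)
          ; (there e∈) → proj₁ (e-in e∈) , ≤-trans (proj₂ (e-in e∈)) (≤-reflexive M≡) }

  -- Counting functions and conjugation of partitions

  count : {P : Pred ℕ 0ℓ} → Decidable P → ℕ → ℕ
  count P? zero    = 0
  count P? (suc k) = if does (P? k) then suc (count P? k) else count P? k

  count-cong : ∀ {P Q : Pred ℕ 0ℓ} (P? : Decidable P) (Q? : Decidable Q) k →
    (∀ i → i < k → (P i → Q i) × (Q i → P i)) → count P? k ≡ count Q? k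
  count-cong P? Q? zero    h = refl
  count-cong P? Q? (suc k) h with P? k | Q? k | h k ≤-refl
  ... | yes _ | yes _ | _ = cong suc (count-cong P? Q? k (λ i → h i ∘ m≤n⇒m≤1+n))
  ... | no _  | no _  | _ = count-cong P? Q? k (λ i → h i ∘ m≤n⇒m≤1+n)
  ... | yes p | no ¬q | t , _ = contradiction (t p) ¬q
  ... | no ¬p | yes q | _ , f = contradiction (f q) ¬p

  count-⊆ : ∀ {P Q : Pred ℕ 0ℓ} (P? : Decidable P) (Q? : Decidable Q) k →
    (∀ i → i < k → P i → Q i) → count P? k ≤ count Q? k
  count-⊆ P? Q? zero    h = z≤n
  count-⊆ P? Q? (suc k) h with P? k | Q? k | h k ≤-refl
  ... | yes _ | yes _ | _ = s≤s (count-⊆ P? Q? k (λ i → h i ∘ m≤n⇒m≤1+n))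
  ... | no _  | no _  | _ = count-⊆ P? Q? k (λ i → h i ∘ m≤n⇒m≤1+n)
  ... | no _  | yes _ | _ = m≤n⇒m≤1+n (count-⊆ P? Q? k (λ i → h i ∘ m≤n⇒m≤1+n))
  ... | yes p | no ¬q | t = contradiction (t p) ¬q

  module _ {P : Pred ℕ 0ℓ} (P? : Decidable P) where

    count-≤ : ∀ k → count P? k ≤ k
    count-≤ zero = z≤n
    count-≤ (suc k) with P? k
    ... | yes _ = s≤s (count-≤ k)
    ... | no _  = m≤n⇒m≤1+n (count-≤ k)

    count-all : ∀ j o → (∀ i → j ≤ i → i < o + j → P i) → count P? (o + j) ≡ o + count P? j
    count-all j zero    h = refl
    count-all j (suc o) h with P? (o + j)
    ... | yes _ = cong suc (count-all j o (λ i j≤i → h i j≤i ∘ m≤n⇒m≤1+n))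
    ... | no ¬p = contradiction (h (o + j) (m≤n+m j o) ≤-refl) ¬p

    count-none : ∀ j o → (∀ i → j ≤ i → i < o + j → ¬ P i) → count P? (o + j) ≡ count P? j
    count-none j zero    h = refl
    count-none j (suc o) h with P? (o + j)
    ... | no _  = count-none j o (λ i j≤i → h i j≤i ∘ m≤n⇒m≤1+n)
    ... | yes p = contradiction p (h (o + j) (m≤n+m j o) ≤-refl)

    count-step-≤ : ∀ j o → count P? (o + j) ≤ o + count P? j
    count-step-≤ j zero = ≤-refl
    count-step-≤ j (suc o) with P? (o + j)
    ... | yes _ = s≤s (count-step-≤ j o)
    ... | no _  = m≤n⇒m≤1+n (count-step-≤ j o)

    count-mono : ∀ j o → count P? j ≤ count P? (o + j)
    count-mono j zero = ≤-refl
    count-mono j (suc o) with P? (o + j)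
    ... | yes _ = m≤n⇒m≤1+n (count-mono j o)
    ... | no _  = count-mono j o

    -- For a downward closed P the indices satisfying it are 0, ..., count - 1; for an upward closed
    -- one they are the last ones. Applied to the two variables of one relation, these describe a
    -- partition and its conjugate.
    module Downward {k} (down : ∀ {i j} → i ≤ j → j < k → P j → P i) where

      count⁺ : ∀ {p} → p < k → P p → p < count P? k
      count⁺ {p} p<k Pp with m≤n⇒∃[o]m+o≡n p<k
      ... | o , refl = subst (λ z → p < count P? z) (+-comm o (suc p)) (≤-trans (≤-reflexive (sym all)) (count-mono (suc p) o))
        where
        all : count P? (suc p) ≡ suc p
        all = trans (cong (count P?) (sym (+-identityʳ (suc p)))) (trans (count-all 0 (suc p)
          (λ i _ i< → down (s≤s⁻¹ (subst (i <_) (+-identityʳ (suc p)) i<)) p<k Pp)) (+-identityʳ (suc p)))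

      count⁻ : ∀ {p} → p < count P? k → P p
      count⁻ {p} p<c with P? p
      ... | yes Pp = Pp
      ... | no ¬Pp with m≤n⇒∃[o]m+o≡n (≤-trans (<⇒≤ p<c) (count-≤ k))
      ...   | o , refl = contradiction p<c (≤⇒≯ (≤-trans (≤-reflexive (trans (cong (count P?) (+-comm p o))
        (count-none p o (λ i p≤i i< Pi → ¬Pp (down p≤i (subst (i <_) (+-comm o p) i<) Pi))))) (count-≤ p)))

    module Upward {k} (up : ∀ {i j} → i ≤ j → j < k → P i → P j) where

      count⁺ : ∀ {j} → j < k → P j → k ≤ j + count P? k
      count⁺ {j} j<k Pj with m≤n⇒∃[o]m+o≡n (<⇒≤ j<k)
      ... | o , refl = +-monoʳ-≤ j (≤-trans (m≤m+n o _) (≤-reflexive (sym (trans (cong (count P?) (+-comm j o))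
        (count-all j o (λ i j≤i i< → up j≤i (subst (i <_) (+-comm o j) i<) Pj))))))

      count⁻ : ∀ {j} → j < k → k ≤ j + count P? k → P j
      count⁻ {j} j<k k≤ with P? j
      ... | yes Pj = Pj
      ... | no ¬Pj with m≤n⇒∃[o]m+o≡n j<k
      ...   | o , refl = contradiction (≤-trans k≤ (+-monoʳ-≤ j few)) (<-irrefl refl)
        where
        none : count P? (suc j) ≡ 0
        none = trans (cong (count P?) (sym (+-identityʳ (suc j)))) (count-none 0 (suc j)
          (λ i _ i< Pi → ¬Pj (up (s≤s⁻¹ (subst (i <_) (+-identityʳ (suc j)) i<)) j<k Pi)))
        few : count P? (suc j + o) ≤ o
        few = ≤-trans (≤-reflexive (cong (count P?) (+-comm (suc j) o))) (≤-trans (count-step-≤ (suc j) o)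
          (≤-reflexive (trans (cong (o +_) none) (+-identityʳ o))))

  odd : ℕ → Bool
  odd zero    = false
  odd (suc j) = not (odd j)

  ⌊1+n/2⌋ : ∀ j → ⌊ suc j /2⌋ ≡ (if odd j then suc ⌊ j /2⌋ else ⌊ j /2⌋)
  ⌊1+n/2⌋ zero          = refl
  ⌊1+n/2⌋ (suc zero)    = refl
  ⌊1+n/2⌋ (suc (suc j)) with odd j | ⌊1+n/2⌋ j
  ... | true  | e = cong suc e
  ... | false | e = cong suc e

  private
    %≡%⇒∣ : ∀ {m o x} .{{_ : NonZero m}} → (x + o) % m ≡ x % m → m ∣ o
    %≡%⇒∣ {m} {o} {x} e = ∣m+n∣m⇒∣n (divides ((x + o) / m) eq) (n∣m*n (x / m))
      where
      eq : x / m * m + o ≡ (x + o) / m * m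
      eq = +-cancelˡ-≡ (x % m) _ _ (trans (sym (+-assoc (x % m) _ o)) (trans (cong (_+ o) (sym (m≡m%n+[m/n]*n x m)))
        (trans (m≡m%n+[m/n]*n (x + o) m) (cong (_+ (x + o) / m * m) e))))

    polygon : ∀ {m n} → suc (m * suc n) ≡ m * (n + 1) + 1
    polygon {m} {n} = solve (m ∷ n ∷ [])

    polygon-size : ∀ {m n} → suc (suc (m * suc n)) ≡ m * (n + 1) + 2
    polygon-size {m} {n} = solve (m ∷ n ∷ [])

    one-side : ∀ k m → suc (m * suc k) + 1 ≡ 2 + suc k * m
    one-side k m = solve (k ∷ m ∷ [])

    other-side : ∀ k m o n → suc (m * suc k) + o ≡ m * (n + 1) + 2 → o + 1 + suc k * m ≡ 2 + (n + 1) * m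
    other-side k m o n e = trans (lhs k m o) (trans e (rhs m n))
      where
      lhs : ∀ k m o → o + 1 + suc k * m ≡ suc (m * suc k) + o
      lhs k m o = solve (k ∷ m ∷ o ∷ [])
      rhs : ∀ m n → m * (n + 1) + 2 ≡ 2 + (n + 1) * m
      rhs m n = solve (m ∷ n ∷ [])

    bound-clash : ∀ {m n j l} → suc n ≤ j + l → m * l + suc (suc (m * j)) ≤ suc (m * suc n) → ⊥
    bound-clash {m} {n} {j} {l} h h′ = lin-⊥ (m ⊛ h ⊕ h′) 0 (solve (m ∷ n ∷ j ∷ l ∷ []))

    few-chords : ∀ {m n p l} → m * n ≤ p → m * suc l + suc (suc p) ≤ suc (m * suc n) → ⊥
    few-chords {m} {n} {p} {l} h h′ = lin-⊥ (h ⊕ h′) (m * l) (solve (m ∷ n ∷ p ∷ l ∷ []))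

    chord-room : ∀ {m n p c j x} → suc n ≡ j + c → suc p ≤ x → x ≤ m * j → m * c + suc (suc p) ≤ suc (m * suc n)
    chord-room {m} {n} {p} {c} {j} {x} e h h′ = lin (h ⊕ h′ ⊕ m ⊛ ≤-reflexive (sym e)) 0 (solve (m ∷ n ∷ p ∷ c ∷ j ∷ x ∷ []))

    start-room : ∀ {m n} → m * n + 1 ≤ suc (m * suc n)
    start-room {m} {n} = lin {0} {0} z≤n m (solve (m ∷ n ∷ []))

    proper-room : ∀ {m n} → 1 ≤ m → m * n + 1 < suc (m * suc n)
    proper-room {m} {n} h = lin h 0 (solve (m ∷ n ∷ []))

    end-vertices : ∀ x c m → x * m + 1 + c * m ≡ suc (m * (x + c))
    end-vertices x c m = solve (x ∷ c ∷ m ∷ [])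

  -- Coding dissections by partitions

  module Dissections (n m : ℕ) .{{nonZero : NonZero m}} where

    -- m vertices are removed from the right, the next m from the left, and so on; what remains
    -- after m j removals is the polygon cut off by −α_j.

    fromLeft : ℕ → Bool
    fromLeft p = odd (p / m)

    1≤m : 1 ≤ m
    1≤m = >-nonZero⁻¹ m

    open Statistics m 1≤m fromLeft n public
    open Existence m 1≤m fromLeft using (exists)

    -- Within one block of m removals the quotient by m is constant, so all of them are made on the
    -- same side.
    left-block : ∀ j s → s ≤ m → left (s + j * m) ≡ (if odd j then s + left (j * m) else left (j * m))
    left-block j zero    _ with odd j
    ... | true  = refl
    ... | false = refl
    left-block j (suc s) s<m with odd ((s + j * m) / m) | cong odd quotient | left-block j s (<⇒≤ s<m)
      where
      quotient : (s + j * m) / m ≡ j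
      quotient = trans (+-distrib-/-∣ʳ s (n∣m*n j)) (cong₂ _+_ (m<n⇒m/n≡0 s<m) (m*n/n≡m j m))
    ... | _ | refl | e with odd j
    ...   | true  = cong suc e
    ...   | false = e

    left-multiple : ∀ j → left (j * m) ≡ ⌊ j /2⌋ * m
    left-multiple zero    = refl
    left-multiple (suc j) with odd j | left-block j m ≤-refl | ⌊1+n/2⌋ j
    ... | true  | e | e′ = trans e (trans (cong (m +_) (left-multiple j)) (cong (_* m) (sym e′)))
    ... | false | e | e′ = trans e (trans (left-multiple j) (cong (_* m) (sym e′)))

    right-multiple : ∀ j → right (j * m) ≡ ⌈ j /2⌉ * m
    right-multiple j = +-cancelˡ-≡ (⌊ j /2⌋ * m) _ _ (trans (cong (_+ right (j * m)) (sym (left-multiple j)))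
      (trans (left+right (j * m)) (trans (cong (_* m) (sym (⌊n/2⌋+⌈n/2⌉≡n j))) (*-distribʳ-+ m ⌊ j /2⌋ ⌈ j /2⌉))))

    maximal-of : (D : Dissection n m) → Maximal (Dissection.diagonals D)
    maximal-of D = record
      { family = record
        { mChord      = λ c∈ → mc (All.lookup mDiagonal c∈)
        ; bounded     = λ c∈ → bd (All.lookup mDiagonal c∈)
        ; unique      = unique
        ; nonCrossing = AllPairs⇒∈ nonCrossing
        }
      ; size   = size
      ; proper = λ c∈ → case All.lookup mDiagonal c∈ of λ { ((_ , _ , ¬whole) , _) → ¬whole (refl , polygon-size {m} {n}) }
      }
      where
      open Dissection D
      mc : ∀ {c} → IsMDiagonal (m * (n + 1) + 2) m c → IsMChord c
      mc {a , b} ((2+a≤b , _) , e , _) with m≤n⇒∃[o]m+o≡n 2+a≤b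
      -- With b = a + 2 + o the congruence says that m divides b - a - 1 = o + 1; as this number is
      -- positive, the quotient is a successor.
      ... | o , refl with %≡%⇒∣ {m} {suc o} {2} (trans (cong (_% m) eq) e)
        where
        eq : 2 + suc o ≡ suc (suc (a + o)) ∸ a + 1
        eq = sym (trans (cong (_+ 1) (trans (cong (_∸ a) (sym (trans (+-suc a (suc o)) (cong suc (+-suc a o)))))
            (m+n∸m≡n a (suc (suc o))))) (+-comm _ 1))
      ...   | divides (suc k) e′ = k , trans (sym (+-suc (suc a) o)) (trans (sym (+-suc a (suc o))) (cong
          (λ z → a + suc z) (trans e′ (*-comm (suc k) m))))
      bd : ∀ {c} → IsMDiagonal (m * (n + 1) + 2) m c → proj₂ c ≤ M
      bd ((_ , b< , _) , _) = s≤s⁻¹ (≤-trans b< (≤-reflexive (sym (polygon-size {m} {n}))))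

    -- The two parts share two of the m (n + 1) + 2 vertices, so the residue of the part cut off
    -- forces that of the other part.
    mDiagonal-of : ∀ {c} → IsMChord c → proj₂ c ≤ M → c ≢ (0 , M) → IsMDiagonal (m * (n + 1) + 2) m c
    mDiagonal-of {a , b} (k , refl) b≤M c≢ = (2+a≤b , b< , λ { (refl , e) → c≢ (cong (0 ,_) (suc-injective (trans e (sym
        (polygon-size {m} {n}))))) })
      , trans (cong (λ z → (z + 1) % m) (m+n∸m≡n a _)) (trans (cong (_% m) (one-side k m)) ([m+kn]%n≡m%n 2 (suc k) m))
      , other
      where
      2+a≤b : 2 + a ≤ a + suc (m * suc k)
      2+a≤b = ≤-trans (≤-reflexive (+-comm 2 a)) (+-monoʳ-≤ a (s≤s (≤-trans 1≤m (m≤m*n m (suc k)))))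
      b< : a + suc (m * suc k) < m * (n + 1) + 2
      b< = ≤-trans (s≤s b≤M) (≤-reflexive (polygon-size {m} {n}))
      other : (m * (n + 1) + 2 ∸ (a + suc (m * suc k) ∸ a) + 1) % m ≡ 2 % m
      other rewrite m+n∸m≡n a (suc (m * suc k)) with m≤n⇒∃[o]m+o≡n (≤-trans (m≤n+m (suc (m * suc k)) a) (<⇒≤ b<))
      ... | o , e = trans (sym ([m+kn]%n≡m%n _ (suc k) m)) (trans (cong (_% m)
          (trans (cong (λ z → z + 1 + suc k * m) (trans (cong (_∸ suc (m * suc k)) (sym e)) (m+n∸m≡n (suc
              (m * suc k)) o))) (other-side k m o n e))) ([m+kn]%n≡m%n 2 (n + 1) m))

    dissection-of : ∀ {D} → Maximal D → Dissection n m
    dissection-of {D} X = record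
      { diagonals   = D
      ; unique      = unique
      ; size        = size
      ; mDiagonal   = All.tabulate (λ c∈ → mDiagonal-of (mChord c∈) (bounded c∈) (λ { refl → proper c∈ }))
      ; nonCrossing = ∈⇒AllPairs nonCrossing
      }
      where open Maximal X

    Λ : Dissection n m → ℕ → ℕ
    Λ D p = remaining M p (Dissection.diagonals D)

    Enough : Dissection n m → ℕ → Pred ℕ 0ℓ
    Enough D j p = suc n ≤ j + Λ D (suc p)

    enough? : ∀ D j → Decidable (Enough D j)
    enough? D j p = suc n ≤? j + Λ D (suc p)

    -- Encodes D by a lattice path: λ_0 ≤ … ≤ λ_n is the partition whose conjugate is given by Λ.

    code : Dissection n m → ℕ → ℕ
    code D j = count (enough? D j) (m * n)

    Λ-antitone : ∀ D {p q} → p ≤ q → Λ D q ≤ Λ D p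
    Λ-antitone D p≤q = go (≤⇒≤′ p≤q)
      where
      go : ∀ {p q} → p ≤′ q → Λ D q ≤ Λ D p
      go ≤′-refl         = ≤-refl
      go (≤′-step {q} h) = ≤-trans (remaining-antitone (Dissection.diagonals D) q) (go h)

    module _ (D : Dissection n m) (j : ℕ) where

      open Downward (enough? D j) {m * n} (λ {p} {q} p≤q _ h → ≤-trans h (+-monoʳ-≤ j (Λ-antitone D (s≤s p≤q)))) public
        renaming (count⁺ to code⁺; count⁻ to code⁻)

    code-mono : ∀ D {j k} → j ≤ k → code D j ≤ code D k
    code-mono D {j} {k} j≤k = count-⊆ (enough? D j) (enough? D k) (m * n) (λ _ _ h → ≤-trans h (+-monoˡ-≤ _ j≤k))

    -- A larger value would make m j satisfy `Enough`: then n + 1 - j diagonals would remain on m (n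
    -- + 1 - j) edges, one edge too few.
    code-bound : ∀ D {j} → code D j ≤ m * j
    code-bound D {j} = ≮⇒≥ λ h → bound-clash {m} {n} {j} (code⁻ D j h) (remaining-bound (maximal-of D)
      (s≤s (≤-trans h (≤-trans (count-≤ (enough? D j) (m * n)) (*-monoʳ-≤ m (n≤1+n n))))))

    Λ-≤ : ∀ {D D′} → (∀ {c} → c ∈ Dissection.diagonals D → c ∈ Dissection.diagonals D′) → ∀ p → Λ D p ≤ Λ D′ p
    Λ-≤ {D} {D′} D⊆D′ p = unique-⊆⇒length-≤ _≟ᶜ_ (Unique.filter⁺ (remains? M p) (Dissection.unique D)) λ c∈ →
      case ∈-filter⁻ (remains? M p) {xs = Dissection.diagonals D} c∈ of λ { (c∈D , at) → ∈-filter⁺ (remains? M p) (D⊆D′ c∈D) at }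

    infix 4 _≈_
    _≈_ : Dissection n m → Dissection n m → Set
    _≈_ = Setoid._≈_ (dissections n m)

    code-cong : ∀ {D D′} → D ≈ D′ → ∀ j → code D j ≡ code D′ j
    code-cong {D} {D′} eq j = count-cong (enough? D j) (enough? D′ j) (m * n) λ p _ →
      (λ h → subst (λ z → suc n ≤ j + z) (Λ-≡ (suc p)) h) , (λ h → subst (λ z → suc n ≤ j + z) (sym (Λ-≡ (suc p))) h)
      where
      Λ-≡ : ∀ p → Λ D p ≡ Λ D′ p
      Λ-≡ p = ≤-antisym (Λ-≤ {D} {D′} (Equivalence.to eq) p) (Λ-≤ {D′} {D} (Equivalence.from eq) p)

    Λ-zero : ∀ D → Λ D 0 ≡ n
    Λ-zero D = trans (cong length (filter-all (remains? M 0) (All.tabulate (remains-all (Maximal.family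
        (maximal-of D)))))) (Dissection.size D)

    -- At most m edges are left after p + 1 removals, too few for an m-chord. Hence counting p below
    -- m n, as `code` does, misses nothing.
    Λ-late : ∀ D {p} → m * n ≤ p → Λ D (suc p) ≡ 0
    Λ-late D {p} mn≤p with M ≤? suc p
    ... | yes M≤ = remaining-zero (maximal-of D) M≤
    ... | no M≰ with Λ D (suc p) | remaining-bound (maximal-of D) (≰⇒> M≰)
    ...   | zero  | _ = refl
    ...   | suc l | h = ⊥-elim (few-chords {m} {n} {p} {l} mn≤p h)

    same-code⇒Λ-≤ : ∀ D D′ → (∀ j → j ≤ n → code D j ≡ code D′ j) → ∀ {p} → p < m * n → Λ D (suc p) ≤ Λ D′ (suc p)
    same-code⇒Λ-≤ D D′ same {p} p<mn with Λ D (suc p) in eq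
    ... | zero  = z≤n
    -- Row n - l is the one in which the threshold n + 1 is met with equality, so p belonging to
    -- this row says that Λ_{p+1} ≥ l + 1.
    ... | suc l = +-cancelˡ-≤ (n ∸ l) _ _ (≤-trans (≤-reflexive (trans (+-suc (n ∸ l) l) (cong suc (m∸n+n≡m l≤n))))
      (code⁻ D′ (n ∸ l) (subst (p <_) (same (n ∸ l) (m∸n≤m n l)) (code⁺ D (n ∸ l) p<mn enough))))
      where
      l≤n : l ≤ n
      l≤n = ≤-trans (n≤1+n l) (≤-trans (≤-reflexive (sym eq)) (≤-trans (Λ-antitone D z≤n) (≤-reflexive (Λ-zero D))))
      enough : suc n ≤ n ∸ l + Λ D (suc p)
      enough = ≤-reflexive (sym (trans (cong (n ∸ l +_) eq) (trans (+-suc (n ∸ l) l) (cong suc (m∸n+n≡m l≤n)))))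

    code-injective : ∀ {D D′} → (∀ j → j ≤ n → code D j ≡ code D′ j) → D ≈ D′
    code-injective {D} {D′} same = mk⇔ (same-remaining⇒⊆ (maximal-of D) (maximal-of D′) same-Λ)
      (same-remaining⇒⊆ (maximal-of D′) (maximal-of D) (sym ∘ same-Λ))
      where
      same-Λ : ∀ p → Λ D p ≡ Λ D′ p
      same-Λ zero    = trans (Λ-zero D) (sym (Λ-zero D′))
      same-Λ (suc p) with p <? m * n
      ... | yes p<mn = ≤-antisym (same-code⇒Λ-≤ D D′ same p<mn) (same-code⇒Λ-≤ D′ D (λ j j≤n → sym (same j j≤n)) p<mn)
      ... | no  p≮mn = trans (Λ-late D (≮⇒≥ p≮mn)) (sym (Λ-late D′ (≮⇒≥ p≮mn)))

    module Decode (l : ℕ → ℕ) (l-mono : ∀ {j k} → j ≤ k → k ≤ n → l j ≤ l k) (l-bound : ∀ j → j ≤ n → l j ≤ m * j) where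

      -- The conjugate partition of `l`, shifted by one place: the value at 0 is the total number n
      -- of diagonals.
      Λ′ : ℕ → ℕ
      Λ′ zero    = n
      Λ′ (suc p) = count (λ j → suc p ≤? l j) (suc n)

      open module Up p = Upward (λ j → suc p ≤? l j) {suc n} (λ i≤j j< h → ≤-trans h (l-mono i≤j (s≤s⁻¹ j<)))
        renaming (count⁺ to Λ′⁺; count⁻ to Λ′⁻)

      ¬l0 : ∀ p → ¬ suc p ≤ l 0
      ¬l0 p h = contradiction (≤-trans h (≤-trans (l-bound 0 z≤n) (≤-reflexive (*-zeroʳ m)))) λ ()

      Λ′-≤ : ∀ p → Λ′ (suc p) ≤ n
      Λ′-≤ p = subst (λ z → count (λ j → suc p ≤? l j) z ≤ n) (+-comm n 1) (≤-trans (count-step-≤ (λ j → suc p ≤? l j) 1 n)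
        (≤-reflexive (trans (cong (n +_) (count-none (λ j → suc p ≤? l j) 0 1 (λ { zero _ _ → ¬l0 p ; (suc _) _ (s≤s
            ()) }))) (+-identityʳ n))))

      Λ′-antitone : ∀ q → q < M → Λ′ (suc q) ≤ Λ′ q
      Λ′-antitone zero    _ = Λ′-≤ 0
      Λ′-antitone (suc q) _ = count-⊆ (λ j → suc (suc q) ≤? l j) (λ j → suc q ≤? l j) (suc n) (λ _ _ → <⇒≤)

      -- If the value at p + 1 is c + 1, then `l` at n - c is at least p + 1, and `l-bound` gives p
      -- + 1 ≤ m (n - c), which is the required inequality rearranged.
      Λ′-bound : ∀ q → q < M → m * Λ′ q + suc q ≤ M
      Λ′-bound zero    _ = start-room {m} {n}
      Λ′-bound (suc p) p<M with Λ′ (suc p) in eq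
      ... | zero  = ≤-trans (≤-reflexive (cong (_+ suc (suc p)) (*-zeroʳ m))) p<M
      ... | suc c = chord-room {m} {n} {p} {suc c} {n ∸ c} e (Λ′⁻ p (s≤s (m∸n≤m n c)) (≤-reflexive (trans e (cong
          (n ∸ c +_) (sym eq)))))
        (l-bound (n ∸ c) (m∸n≤m n c))
        where
        c≤n : c ≤ n
        c≤n = ≤-trans (n≤1+n c) (≤-trans (≤-reflexive (sym eq)) (Λ′-≤ p))
        e : suc n ≡ n ∸ c + suc c
        e = sym (trans (+-suc (n ∸ c) c) (cong suc (m∸n+n≡m c≤n)))

      Λ′-end : Λ′ M ≡ 0
      Λ′-end = trans (cong (count (λ j → M ≤? l j)) (sym (+-identityʳ (suc n))))
        (count-none (λ j → M ≤? l j) 0 (suc n) (λ j _ j< M≤ → <⇒≱ (s≤s (≤-trans (l-bound j (s≤s⁻¹ (subst (j <_)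
            (+-identityʳ (suc n)) j<)))
          (*-monoʳ-≤ m (<⇒≤ (subst (j <_) (+-identityʳ (suc n)) j<))))) M≤))

      decoded : ∃ λ D → ∀ q → q ≤ M → Λ D q ≡ Λ′ q
      decoded with exists M (Λ′ (pred M)) M Λ′ refl Λ′-antitone Λ′-bound Λ′-end
      ... | D , F , counts , proper = dissection-of {D} record
        { family = F
        ; size   = trans (cong length (sym (filter-all (remains? M 0) (All.tabulate (remains-all F))))) (counts 0 z≤n)
        ; proper = proper (proper-room {m} {n} 1≤m)
        } , counts

      code-surjective : ∃ λ D → ∀ j → j ≤ n → code D j ≡ l j
      code-surjective with decoded
      ... | D , counts = D , λ j j≤n → trans (count-cong (enough? D j) (λ p → suc p ≤? l j) (m * n) (λ p p<mn →
          (λ h → Λ′⁻ p (s≤s j≤n) (subst (λ z → suc n ≤ j + z) (counts (suc p) (small p<mn)) h)) ,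
          (λ h → subst (λ z → suc n ≤ j + z) (sym (counts (suc p) (small p<mn))) (Λ′⁺ p (s≤s j≤n) h))))
          (initial (l j) (≤-trans (l-bound j j≤n) (*-monoʳ-≤ m j≤n)))
        where
        small : ∀ {p} → p < m * n → suc p ≤ M
        small h = ≤-trans h (≤-trans (*-monoʳ-≤ m (n≤1+n n)) (n≤1+n _))
        initial : ∀ x {k} → x ≤ k → count (λ p → suc p ≤? x) k ≡ x
        initial x x≤k with m≤n⇒∃[o]m+o≡n x≤k
        ... | o , refl = trans (cong (count (λ p → suc p ≤? x)) (+-comm x o)) (trans (count-none (λ p → suc p ≤? x) x o
            (λ i x≤i _ → ≤⇒≯ x≤i))
          (trans (cong (count (λ p → suc p ≤? x)) (sym (+-identityʳ x))) (trans (count-all (λ p → suc p ≤? x) 0 x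
              (λ i _ i< → subst (i <_) (+-identityʳ x) i<)) (+-identityʳ x))))

    -- `Boundary` turns membership into Λ_{mj} ≥ n + 1 - j, which is `Enough` at p = m j - 1 because
    -- `Enough` looks at Λ_{p+1}. This means λ_j ≥ m j, and `code-bound` makes it an equality.
    containsNegativeSimple : ∀ (D : Dissection n m) (i : Fin n) →
      ContainsNegativeSimple D i ⇔ code D (suc (toℕ i)) ≡ m * suc (toℕ i)
    containsNegativeSimple D i = mk⇔
      (λ c∈ → ≤-antisym (code-bound D) (subst (_≤ code D j) mj (code⁺ D j p<mn (subst (λ z → suc n ≤ j + Λ D z) (sym mj)
          (boundary∈⇒ c∈)))))
      (λ e → boundary∈⇐ (subst (λ z → suc n ≤ j + Λ D z) mj (code⁻ D j (subst (_≤ code D j) (sym mj) (≤-reflexive (sym e))))))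
      where
      j = suc (toℕ i)
      c≤1+n : ⌈ j /2⌉ ≤ n + 1
      c≤1+n = ≤-trans (⌈n/2⌉≤n j) (≤-trans (toℕ<n i) (m≤m+n n 1))
      mj : suc (pred (m * j)) ≡ m * j
      mj = suc-pred (m * j) {{>-nonZero (≤-trans 1≤m (m≤m*n m j))}}
      p<mn : pred (m * j) < m * n
      p<mn = ≤-trans (≤-reflexive mj) (*-monoʳ-≤ m (toℕ<n i))
      right≡ : (n + 1 ∸ ⌈ j /2⌉) * m + 1 + right (m * j) ≡ M
      right≡ = trans (cong ((n + 1 ∸ ⌈ j /2⌉) * m + 1 +_) (trans (cong right (*-comm m j)) (right-multiple j)))
        (trans (end-vertices (n + 1 ∸ ⌈ j /2⌉) ⌈ j /2⌉ m) (cong (λ z → suc (m * z)) (trans (m∸n+n≡m c≤1+n) (+-comm n 1))))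
      open Boundary (maximal-of D) j (n ∸ j) (m+[n∸m]≡n (toℕ<n i)) (s≤s z≤n) (⌊ j /2⌋ * m) ((n + 1 ∸ ⌈ j /2⌉) * m + 1)
        (trans (cong left (*-comm m j)) (left-multiple j)) right≡

  count-< : ∀ {P Q : Pred ℕ 0ℓ} (P? : Decidable P) (Q? : Decidable Q) k →
    (∀ i → i < k → P i → Q i) → ∀ {i} → i < k → ¬ P i → Q i → count P? k < count Q? k
  count-< P? Q? (suc k) h {i} i< ¬Pi Qi with P? k | Q? k | h k ≤-refl | m≤n⇒m<n∨m≡n (s≤s⁻¹ i<)
  ... | yes _ | yes _ | _ | inj₁ i<k = s≤s (count-< P? Q? k (λ i → h i ∘ m≤n⇒m≤1+n) i<k ¬Pi Qi)
  ... | no _  | no _  | _ | inj₁ i<k = count-< P? Q? k (λ i → h i ∘ m≤n⇒m≤1+n) i<k ¬Pi Qi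
  ... | no _  | yes _ | _ | _ = s≤s (count-⊆ P? Q? k (λ i → h i ∘ m≤n⇒m≤1+n))
  ... | yes p | no ¬q | t | _ = contradiction (t p) ¬q
  ... | yes p | yes _ | _ | inj₂ refl = contradiction p ¬Pi
  ... | no _  | no ¬q | _ | inj₂ refl = contradiction Qi ¬q

  -- The hypothesis says that no two indices satisfy Q without P. It is applied to distinct
  -- thresholds, of which a unit step can pass only one.
  count-suc : ∀ {P Q : Pred ℕ 0ℓ} (P? : Decidable P) (Q? : Decidable Q) k →
    (∀ i j → i < j → j < k → Q i → Q j → ¬ P j → P i) → count Q? k ≤ suc (count P? k)
  count-suc P? Q? zero    h = z≤n
  count-suc P? Q? (suc k) h with P? k | Q? k | h
  ... | yes _ | yes _ | _ = s≤s (count-suc P? Q? k (λ i j i<j → h i j i<j ∘ m≤n⇒m≤1+n))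
  ... | no _  | no _  | _ = count-suc P? Q? k (λ i j i<j → h i j i<j ∘ m≤n⇒m≤1+n)
  ... | yes _ | no _  | _ = m≤n⇒m≤1+n (count-suc P? Q? k (λ i j i<j → h i j i<j ∘ m≤n⇒m≤1+n))
  ... | no ¬p | yes q | _ = s≤s (count-⊆ Q? P? k (λ i i<k Qi → h i k i<k ≤-refl Qi q ¬p))

  count-full : ∀ {P : Pred ℕ 0ℓ} (P? : Decidable P) k → count P? k ≡ k → ∀ {i} → i < k → P i
  count-full P? (suc k) e {i} i< with P? k | m≤n⇒m<n∨m≡n (s≤s⁻¹ i<)
  ... | yes _ | inj₁ i<k = count-full P? k (suc-injective e) i<k
  ... | yes p | inj₂ refl = p
  ... | no _  | _ = contradiction (≤-trans (≤-reflexive (sym e)) (count-≤ P? k)) (<-irrefl refl)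

  intermediate-value : ∀ (g : ℕ → ℕ) → (∀ z → g (suc z) ≤ suc (g z)) → ∀ z₀ w {y} → g z₀ ≤ y → y ≤ g (w + z₀) →
    ∃ λ z → z₀ ≤ z × g z ≡ y
  intermediate-value g step z₀ zero    lo hi = z₀ , ≤-refl , ≤-antisym lo hi
  intermediate-value g step z₀ (suc w) {y} lo hi with y ≤? g (w + z₀)
  ... | yes h = intermediate-value g step z₀ w lo h
  ... | no ¬h = suc (w + z₀) , m≤n⇒m≤1+n (m≤n+m z₀ w) , ≤-antisym (≤-trans (step (w + z₀)) (≰⇒> ¬h)) hi

  -- Sign patterns of dominant points and their shapes

  module Patterns (n m : ℕ) .{{nonZero : NonZero m}} where

    -- σ i j k tells whether x_i − x_j > k.

    record IsPattern (σ : ℕ → ℕ → ℕ → Bool) : Set where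
      field
        σ-zero  : ∀ {i j} → i < j → j ≤ n → σ i j 0 ≡ true
        σ-down  : ∀ {i j a b} → i < j → j ≤ n → a ≤ b → b ≤ m → σ i j b ≡ true → σ i j a ≡ true
        σ-true  : ∀ {i j l a b} → i < j → j < l → l ≤ n → a + b ≤ m → σ i j a ≡ true → σ j l b ≡ true → σ i l (a + b) ≡ true
        σ-false : ∀ {i j l a b} → i < j → j < l → l ≤ n → a + b ≤ m → σ i j a ≡ false → σ j l b ≡ false → σ i l (a + b) ≡ false

    -- The pair (i , k) with 1 ≤ k ≤ m is coded as t = i m + k - 1, so the pairs with i < j are the
    -- t below m j.
    Sep : (ℕ → ℕ → ℕ → Bool) → ℕ → Pred ℕ 0ℓ
    Sep σ j t = σ (t / m) j (suc (t % m)) ≡ true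

    sep? : ∀ σ j → Decidable (Sep σ j)
    sep? σ j t = σ (t / m) j (suc (t % m)) Bool.≟ true

    shape : (ℕ → ℕ → ℕ → Bool) → ℕ → ℕ
    shape σ j = count (sep? σ j) (m * j)

    row : ∀ {t j} → t < m * j → t / m < j
    row {t} {j} t< = m<n*o⇒m/o<n (subst (t <_) (*-comm m j) t<)

    column : ∀ t → suc (t % m) ≤ m
    column t = m%n<n t m

    index : ℕ → ℕ → ℕ
    index i k = k + i * m

    index-/ : ∀ i {k} → k < m → index i k / m ≡ i
    index-/ i {k} k<m = trans (+-distrib-/-∣ʳ k (n∣m*n i)) (cong₂ _+_ (m<n⇒m/n≡0 k<m) (m*n/n≡m i m))

    index-% : ∀ i {k} → k < m → index i k % m ≡ k
    index-% i {k} k<m = trans ([m+kn]%n≡m%n k i m) (m<n⇒m%n≡m k<m)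

    index-< : ∀ {i j k} → i < j → k < m → index i k < m * j
    index-< {i} {j} {k} i<j k<m = ≤-trans (+-monoˡ-< (i * m) k<m) (≤-trans (*-monoˡ-≤ m i<j) (≤-reflexive (*-comm j m)))

    shape-bound : ∀ σ j → shape σ j ≤ m * j
    shape-bound σ j = count-≤ (sep? σ j) (m * j)

    module _ {σ} (S : IsPattern σ) where

      open IsPattern S

      shape-suc : ∀ {j} → j < n → shape σ j ≤ shape σ (suc j)
      shape-suc {j} j<n = ≤-trans (count-⊆ (sep? σ j) (sep? σ (suc j)) (m * j) λ t t< h →
          subst (λ z → σ (t / m) (suc j) z ≡ true) (+-identityʳ _)
            (σ-true (row t<) ≤-refl j<n (≤-trans (≤-reflexive (+-identityʳ _)) (column t)) h (σ-zero ≤-refl j<n)))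
        (subst (λ z → count (sep? σ (suc j)) (m * j) ≤ count (sep? σ (suc j)) z) (sym (*-suc m j)) (count-mono (sep? σ
            (suc j)) (m * j) m))

      shape-mono : ∀ {j k} → j ≤ k → k ≤ n → shape σ j ≤ shape σ k
      shape-mono j≤k = go (≤⇒≤′ j≤k)
        where
        go : ∀ {j k} → j ≤′ k → k ≤ n → shape σ j ≤ shape σ k
        go ≤′-refl     _   = ≤-refl
        go (≤′-step h) k<n = ≤-trans (go h (<⇒≤ k<n)) (shape-suc k<n)

      -- If x_i - x_{i+1} > m, then all earlier coordinates exceed x_{i+1} by more than m too, so
      -- every pair is counted; conversely a full count includes the pair (i , m).
      shape-full : ∀ {i} → i < n → σ i (suc i) m ≡ true ⇔ shape σ (suc i) ≡ m * suc i
      shape-full {i} i<n = mk⇔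
        (λ h → trans (cong (count (sep? σ (suc i))) (sym (+-identityʳ (m * suc i))))
          (trans (count-all (sep? σ (suc i)) 0 (m * suc i) (λ t _ t< → all h t (subst (t <_) (+-identityʳ
              (m * suc i)) t<))) (+-identityʳ (m * suc i))))
        (λ e → subst₂ (λ x y → σ x (suc i) y ≡ true) (index-/ i last<m) (trans (cong suc (index-% i last<m)) (suc-pred m))
          (count-full (sep? σ (suc i)) (m * suc i) e (index-< ≤-refl last<m)))
        where
        last<m : pred m < m
        last<m = ≤-reflexive (suc-pred m)
        all : σ i (suc i) m ≡ true → ∀ t → t < m * suc i → Sep σ (suc i) t
        all h t t< with m≤n⇒m<n∨m≡n (s≤s⁻¹ (row t<))
        ... | inj₂ e = subst (λ z → σ z (suc i) (suc (t % m)) ≡ true) (sym e) (σ-down ≤-refl i<n (column t) ≤-refl h)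
        ... | inj₁ <i = σ-down (m≤n⇒m≤1+n <i) i<n (column t) ≤-refl
          (σ-true <i ≤-refl i<n ≤-refl (σ-zero <i (<⇒≤ i<n)) h)

    module _ {σ τ} (S : IsPattern σ) (T : IsPattern τ) where

      private
        module S = IsPattern S
        module T = IsPattern T

      AgreeBefore : ℕ → Set
      AgreeBefore j = ∀ {i i′ k} → i < i′ → i′ < j → k ≤ m → σ i i′ k ≡ τ i i′ k

      -- The thresholds x_i − k with i < j are ordered in the same way for σ and τ.

      threshold-order : ∀ {i i′ j k k′} → i < j → i′ < j → j ≤ n → k ≤ m → k′ ≤ m → AgreeBefore j →
        σ i′ j k′ ≡ true → σ i j k ≡ false → τ i j k ≡ true → τ i′ j k′ ≡ true
      threshold-order {i} {i′} {j} {k} {k′} i<j i′<j j≤n k≤m k′≤m same h h′ g with <-cmp i i′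
      ... | tri< i<i′ _ _ with k ≤? k′
      ...   | yes k≤k′ = contradiction (trans (sym (S.σ-down i<j j≤n k≤k′ k′≤m (S.σ-true i<i′ i′<j j≤n k′≤m
          (S.σ-zero i<i′ (≤-trans (<⇒≤ i′<j) j≤n)) h))) h′) λ ()
      ...   | no k≰k′ with m≤n⇒∃[o]m+o≡n (<⇒≤ (≰⇒> k≰k′))
      ...     | e , refl with τ i′ j k′ in g′ | σ i i′ e in f
      ...       | true  | _     = refl
      ...       | false | true  = contradiction (trans (sym (S.σ-true i<i′ i′<j j≤n (≤-trans (≤-reflexive
          (+-comm e k′)) k≤m) f h)) (trans (cong (σ i j) (+-comm e k′)) h′)) λ ()
      ...       | false | false = contradiction (trans (sym (trans (cong (τ i j) (+-comm e k′)) g))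
          (T.σ-false i<i′ i′<j j≤n (≤-trans (≤-reflexive (+-comm e k′)) k≤m)
        (trans (sym (same i<i′ i′<j (≤-trans (m≤n+m e k′) k≤m))) f) g′)) λ ()
      threshold-order {i} {i′} {j} {k} {k′} i<j i′<j j≤n k≤m k′≤m same h h′ g | tri≈ _ refl _ with k′ ≤? k
      ... | yes k′≤k = T.σ-down i<j j≤n k′≤k k≤m g
      ... | no k′≰k  = contradiction (trans (sym (S.σ-down i<j j≤n (<⇒≤ (≰⇒> k′≰k)) k′≤m h)) h′) λ ()
      threshold-order {i} {i′} {j} {k} {k′} i<j i′<j j≤n k≤m k′≤m same h h′ g | tri> _ _ i′<i with k′ ≤? k
      ... | yes k′≤k = T.σ-down i′<j j≤n k′≤k k≤m (T.σ-true i′<i i<j j≤n k≤m (T.σ-zero i′<i (≤-trans (<⇒≤ i<j) j≤n)) g)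
      ... | no k′≰k with m≤n⇒∃[o]m+o≡n (<⇒≤ (≰⇒> k′≰k))
      ...   | e , refl with σ i′ i e in f
      ...     | true  = trans (cong (τ i′ j) (+-comm k e)) (T.σ-true i′<i i<j j≤n (≤-trans (≤-reflexive (+-comm e k)) k′≤m)
        (trans (sym (same i′<i i<j (≤-trans (m≤n+m e k) k′≤m))) f) g)
      ...     | false = contradiction (trans (sym h) (trans (cong (σ i′ j) (+-comm k e)) (S.σ-false i′<i i<j j≤n
          (≤-trans (≤-reflexive (+-comm e k)) k′≤m) f h′))) λ ()

      -- A threshold above x_j in τ only would, by `threshold-order`, make all those above x_j in σ
      -- be above it in τ as well, and τ would count strictly more.
      no-excess : ∀ {j} → j ≤ n → AgreeBefore j → shape τ j ≤ shape σ j → ∀ {t} → t < m * j → Sep τ j t → Sep σ j t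
      no-excess {j} j≤n same ≤ {t} t< g with σ (t / m) j (suc (t % m)) in h
      ... | true  = refl
      ... | false = contradiction (count-< (sep? σ j) (sep? τ j) (m * j) (λ t′ t′< g′ →
        threshold-order (row t<) (row t′<) j≤n (column t) (column t′) same g′ h g) t< (λ h′ → contradiction (trans
            (sym h) h′) λ ()) g) (≤⇒≯ ≤)

    same-shape : ∀ {σ τ} → IsPattern σ → IsPattern τ → (∀ j → j ≤ n → shape σ j ≡ shape τ j) →
      ∀ {i j k} → i < j → j ≤ n → k ≤ m → σ i j k ≡ τ i j k
    same-shape {σ} {τ} S T eq {i} {j} i<j = <-rec Same step j i<j
      where
      Same : ℕ → Set
      Same j = ∀ {i k} → i < j → j ≤ n → k ≤ m → σ i j k ≡ τ i j k
      step : ∀ j → (∀ {j′} → j′ < j → Same j′) → Same j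
      step j rec {i} {zero} i<j j≤n _ = trans (IsPattern.σ-zero S i<j j≤n) (sym (IsPattern.σ-zero T i<j j≤n))
      step j rec {i} {suc k} i<j j≤n k<m = subst₂ (λ x y → σ x j (suc y) ≡ τ x j (suc y)) (index-/ i k<m) (index-% i k<m) at
        where
        t = index i k
        t< : t < m * j
        t< = index-< i<j k<m
        below : AgreeBefore S T j
        below i<i′ i′<j k≤m = rec i′<j i<i′ (≤-trans (<⇒≤ i′<j) j≤n) k≤m
        to : Sep σ j t → Sep τ j t
        to = no-excess T S j≤n (λ p q r → sym (below p q r)) (≤-reflexive (eq j j≤n)) t<
        from : Sep τ j t → Sep σ j t
        from = no-excess S T j≤n below (≤-reflexive (sym (eq j j≤n))) t<
        at : σ (t / m) j (suc (t % m)) ≡ τ (t / m) j (suc (t % m))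
        at with σ (t / m) j (suc (t % m)) in h | τ (t / m) j (suc (t % m)) in g
        ... | true  | true  = refl
        ... | false | false = refl
        ... | true  | false = contradiction (trans (sym (to h)) g) λ ()
        ... | false | true  = contradiction (trans (sym (from g)) h) λ ()

  -- Integer points with a prescribed shape

  private
    regroup : ∀ y d k U → y + suc (d + k) * U ≡ y + d * U + suc k * U
    regroup y d k U = solve (y ∷ d ∷ k ∷ U ∷ [])

    double : ∀ y k U → 2 * y + k * (2 * U) ≡ 2 * (y + k * U)
    double y k U = solve (y ∷ k ∷ U ∷ [])

  -- Points are placed on an integer line on which U plays the role of 1.  Before a new point is
  -- added all coordinates are doubled, so that it fits between any two of the old thresholds.

  module IntegerPoints (n m : ℕ) .{{nonZero : NonZero m}} (l : ℕ → ℕ)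
    (l-mono : ∀ {j k} → j ≤ k → k ≤ n → l j ≤ l k) (l-bound : ∀ j → j ≤ n → l j ≤ m * j) where

    open Patterns n m using (row; column; index; index-/; index-%; index-<)

    -- Up to translation Y_j stands for -U x_j: reversing the order keeps the coordinates in ℕ, and
    -- x_i - x_j > k becomes Y_i + k U < Y_j.
    threshold : ℕ → (ℕ → ℕ) → ℕ → ℕ
    threshold U Y t = Y (t / m) + suc (t % m) * U

    record Points (s U : ℕ) (Y : ℕ → ℕ) : Set where
      field
        unit       : 1 ≤ U
        increasing : ∀ {i j} → i < j → j ≤ s → Y i < Y j
        generic    : ∀ {i j} → i < j → j ≤ s → ∀ k → Y j ≢ Y i + k * U
        shape≡     : ∀ j → j ≤ s → count (λ t → threshold U Y t <? Y j) (m * j) ≡ l j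

    thresholds-apart : ∀ {s U Y} → Points s U Y → ∀ {i j} → i < j → j ≤ s → ∀ k k′ → Y i + suc k * U ≢ Y j + suc k′ * U
    thresholds-apart {s} {U} {Y} P {i} {j} i<j j≤s k k′ e with k′ ≤? k
    ... | yes k′≤k = Points.generic P i<j j≤s (k ∸ k′) (+-cancelʳ-≡ (suc k′ * U) (Y j) _ (trans (sym e)
      (trans (cong (λ z → Y i + suc z * U) (sym (m∸n+n≡m k′≤k))) (regroup (Y i) (k ∸ k′) k′ U))))
    ... | no k′≰k = <-irrefl e (+-mono-<-≤ (Points.increasing P i<j j≤s) (*-monoˡ-≤ U (s≤s (<⇒≤ (≰⇒> k′≰k)))))

    threshold-injective : ∀ {s U Y} → Points s U Y → ∀ {t t′} → t / m ≤ s → t′ / m ≤ s →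
      threshold U Y t ≡ threshold U Y t′ → t ≡ t′
    threshold-injective {s} {U} {Y} P {t} {t′} t≤ t′≤ e with <-cmp (t / m) (t′ / m)
    ... | tri≈ _ q _ = trans (m≡m%n+[m/n]*n t m) (trans (cong₂ (λ x y → x + y * m) r q) (sym (m≡m%n+[m/n]*n t′ m)))
      where
      r : t % m ≡ t′ % m
      r = suc-injective (*-cancelʳ-≡ _ _ U {{>-nonZero (Points.unit P)}} (+-cancelˡ-≡ (Y (t / m)) _ _ (trans e (cong
          (λ z → Y z + suc (t′ % m) * U) (sym q)))))
    ... | tri< p _ _ = ⊥-elim (thresholds-apart P p t′≤ (t % m) (t′ % m) e)
    ... | tri> _ _ p = ⊥-elim (thresholds-apart P p t≤ (t′ % m) (t % m) (sym e))

    module Extend {s U Y} (s<n : suc s ≤ n) (P : Points s U Y) where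

      open Points P

      below? : ∀ z → Decidable (λ t → threshold U Y t ≤ z)
      below? z t = threshold U Y t ≤? z

      g : ℕ → ℕ
      g z = count (below? z) (m * suc s)

      Y-≤ : ∀ {i} → i ≤ s → Y i ≤ Y s
      Y-≤ i≤s with m≤n⇒m<n∨m≡n i≤s
      ... | inj₁ i<s  = <⇒≤ (increasing i<s ≤-refl)
      ... | inj₂ refl = ≤-refl

      g-step : ∀ z → g (suc z) ≤ suc (g z)
      g-step z = count-suc (below? z) (below? (suc z)) (m * suc s) λ t t′ t<t′ t′< t≤ t′≤ t′≰ → s≤s⁻¹ (≤∧≢⇒< t≤ λ e →
        <⇒≢ t<t′ (threshold-injective P (s≤s⁻¹ (row (<-trans t<t′ t′<))) (s≤s⁻¹ (row t′<)) (trans e (≤-antisym (≰⇒> t′≰) t′≤))))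

      -- At Y_s the thresholds of the point s itself are still ahead, so exactly λ_s ≤ λ_{s+1} have
      -- been passed. At the other end, m U + Y_s, all have been passed.
      g-start : g (Y s) ≤ l (suc s)
      g-start = ≤-trans (≤-reflexive (trans (cong (count (below? (Y s))) (*-suc m s)) (count-none (below? (Y s)) (m * s) m late)))
        (≤-trans (count-⊆ (below? (Y s)) (λ t → threshold U Y t <? Y s) (m * s) λ t t< h →
          ≤∧≢⇒< h (λ e → generic (row t<) ≤-refl (suc (t % m)) (sym e)))
        (≤-trans (≤-reflexive (shape≡ s ≤-refl)) (l-mono (n≤1+n s) s<n)))
        where
        late : ∀ t → m * s ≤ t → t < m + m * s → ¬ threshold U Y t ≤ Y s
        late t ms≤t t< h = <⇒≱ (m<m+n (Y s) (≤-trans unit (m≤n*m U (suc (t % m))))) (subst (λ z → Y z + suc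
            (t % m) * U ≤ Y s) t/m≡s h)
          where
          t/m≡s : t / m ≡ s
          t/m≡s = ≤-antisym (s≤s⁻¹ (row (subst (t <_) (sym (*-suc m s)) t<)))
            (subst (_≤ t / m) (trans (cong (_/ m) (*-comm m s)) (m*n/n≡m s m)) (/-monoˡ-≤ m ms≤t))

      g-end : l (suc s) ≤ g (m * U + Y s)
      g-end = ≤-trans (l-bound (suc s) s<n) (≤-reflexive (sym (trans (cong (count (below? (m * U + Y s))) (sym
          (+-identityʳ (m * suc s))))
        (trans (count-all (below? (m * U + Y s)) 0 (m * suc s) λ t _ t< → subst (threshold U Y t ≤_) (+-comm (Y s) (m * U))
          (+-mono-≤ (Y-≤ (s≤s⁻¹ (row (subst (t <_) (+-identityʳ (m * suc s)) t<)))) (*-monoˡ-≤ U (column t))))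
              (+-identityʳ (m * suc s))))))

      found : ∃ λ z → Y s ≤ z × g z ≡ l (suc s)
      found = intermediate-value g g-step (Y s) (m * U) g-start g-end

      z : ℕ
      z = proj₁ found

      -- The odd value 2 z + 1 lies above a doubled threshold exactly when the old threshold is at
      -- most z, and parity keeps it off all even translates of the older points.
      Y′ : ℕ → ℕ
      Y′ i = [ (λ _ → 2 * Y i) , (λ _ → suc (2 * z)) ]′ (≤-<-connex i s)

      Y′-old : ∀ {i} → i ≤ s → Y′ i ≡ 2 * Y i
      Y′-old {i} i≤s with ≤-<-connex i s
      ... | inj₁ _ = refl
      ... | inj₂ h = contradiction i≤s (<⇒≱ h)

      Y′-new : Y′ (suc s) ≡ suc (2 * z)
      Y′-new with ≤-<-connex (suc s) s
      ... | inj₁ h = contradiction h (<-irrefl refl)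
      ... | inj₂ _ = refl

      scale : ∀ {i} → i ≤ s → ∀ k → Y′ i + k * (2 * U) ≡ 2 * (Y i + k * U)
      scale {i} i≤s k = trans (cong (_+ k * (2 * U)) (Y′-old i≤s)) (double (Y i) k U)

      extended : Points (suc s) (2 * U) Y′
      extended = record { unit = ≤-trans unit (m≤m+n U _) ; increasing = inc ; generic = gen ; shape≡ = shp }
        where
        inc : ∀ {i j} → i < j → j ≤ suc s → Y′ i < Y′ j
        inc {i} {j} i<j j≤ with m≤n⇒m<n∨m≡n j≤
        ... | inj₁ (s≤s j≤s) = subst₂ _<_ (sym (Y′-old (≤-trans (<⇒≤ i<j) j≤s))) (sym (Y′-old j≤s)) (*-monoʳ-< 2
            (increasing i<j j≤s))
        ... | inj₂ refl = subst₂ _<_ (sym (Y′-old (s≤s⁻¹ i<j))) (sym Y′-new) (s≤s (*-monoʳ-≤ 2 (≤-trans (Y-≤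
            (s≤s⁻¹ i<j)) (proj₁ (proj₂ found)))))
        gen : ∀ {i j} → i < j → j ≤ suc s → ∀ k → Y′ j ≢ Y′ i + k * (2 * U)
        gen {i} {j} i<j j≤ k e with m≤n⇒m<n∨m≡n j≤
        ... | inj₁ (s≤s j≤s) = generic i<j j≤s k (*-cancelˡ-≡ _ _ 2 (trans (sym (Y′-old j≤s)) (trans e (scale (≤-trans
            (<⇒≤ i<j) j≤s) k))))
        ... | inj₂ refl = even≢odd (Y i + k * U) z (trans (sym (scale (s≤s⁻¹ i<j) k)) (trans (sym e) Y′-new))
        shp : ∀ j → j ≤ suc s → count (λ t → threshold (2 * U) Y′ t <? Y′ j) (m * j) ≡ l j
        shp j j≤ with m≤n⇒m<n∨m≡n j≤
        ... | inj₁ (s≤s j≤s) = trans (count-cong (λ t → threshold (2 * U) Y′ t <? Y′ j) (λ t → threshold U Y t <? Y j) (m * j)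
          (λ t t< → let t≤ = ≤-trans (<⇒≤ (row t<)) j≤s in
            (λ h → *-cancelˡ-< 2 _ _ (subst₂ _<_ (scale t≤ (suc (t % m))) (Y′-old j≤s) h)) ,
            (λ h → subst₂ _<_ (sym (scale t≤ (suc (t % m)))) (sym (Y′-old j≤s)) (*-monoʳ-< 2 h)))) (shape≡ j j≤s)
        ... | inj₂ refl = trans (count-cong (λ t → threshold (2 * U) Y′ t <? Y′ j) (below? z) (m * j)
          (λ t t< → let t≤ = s≤s⁻¹ (row t<) in
            (λ h → *-cancelˡ-≤ 2 (s≤s⁻¹ (subst₂ _<_ (scale t≤ (suc (t % m))) Y′-new h))) ,
            (λ h → subst₂ _<_ (sym (scale t≤ (suc (t % m)))) (sym Y′-new) (s≤s (*-monoʳ-≤ 2 h))))) (proj₂ (proj₂ found))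

    points : ∀ s → s ≤ n → ∃ λ U → ∃ λ Y → Points s U Y
    points zero    _   = 1 , (λ _ → 0) , record
      { unit = ≤-refl ; increasing = λ { {_} {suc _} _ () ; {_} {zero} () _ } ; generic = λ { {_} {suc _} _ () ; {_} {zero} () _ }
      ; shape≡ = λ { zero _ → trans (cong (count _) (*-zeroʳ m)) (sym (n≤0⇒n≡0 (≤-trans (l-bound 0 z≤n) (≤-reflexive
          (*-zeroʳ m))))) } }
    points (suc s) s<n with points s (<⇒≤ s<n)
    ... | U , Y , P = 2 * U , Extend.Y′ s<n P , Extend.extended s<n P

open import Algebra.Apartness.Bundles using (HeytingCommutativeRing)
import Algebra.Apartness.Properties.HeytingCommutativeRing as HeytingProperties
open import Algebra.Bundles using (CommutativeRing; RawRing)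
import Algebra.Properties.Ring as RingProperties
import Algebra.Properties.Semiring.Mult as Mult
import Algebra.Solver.Ring as RingSolver
open import Algebra.Solver.Ring.AlmostCommutativeRing using (fromCommutativeRing; _-Raw-AlmostCommutative⟶_)
import Algebra.Solver.Ring.NaturalCoefficients.Default as NaturalSolver
open import Data.Bool.Base using (Bool; true; false; if_then_else_)
open import Data.Empty using (⊥; ⊥-elim)
open import Data.Fin.Base as Fin using (zero; suc; toℕ; inject₁; fromℕ<)
import Data.Fin.Properties as Fin
open import Data.Maybe.Base using (Maybe; just; nothing)
open import Data.Nat.Base as ℕ using (zero; suc)
open import Data.Nat.DivMod using (_/_; _%_)
import Data.Nat.Properties as ℕ
open import Data.Product.Base using (_×_; _,_; proj₂)
open import Data.Sum.Base using (_⊎_; inj₁; inj₂; [_,_]′)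
open import Data.Vec.Functional using (Vector)
open import Function.Base using (_∘_)
open import Function.Bundles using (mk⇔; Equivalence)
open import Level using (0ℓ)
open import Relation.Binary.Bundles using (Setoid)
open import Relation.Binary.Definitions using (tri<; tri≈; tri>)
open import Relation.Binary.PropositionalEquality.Core as ≡ using (_≡_)
open import Relation.Binary.Structures using (IsStrictPartialOrder)
open import Relation.Nullary.Decidable using (Dec; yes; no; does; _×-dec_)
open import Relation.Nullary.Negation using (¬_; contradiction)
open import Relation.Unary using (Pred; _⊆_; _∩_; Satisfiable)
open Combinatorics using (count-cong; module Dissections; module Patterns; module IntegerPoints)

-- Coefficients are formal differences of natural numbers.

module CommutativeRingSolver {c ℓ} (R : CommutativeRing c ℓ) where

  open CommutativeRing R
  open Mult semiring using () renaming (_×_ to _⋅_; ×-homo-+ to ⋅-homo-+; ×1-homo-* to ⋅1-homo-*)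
  open RingProperties ring using (-0#≈0#; -‿+-comm; -‿involutive)
  open import Relation.Binary.Reasoning.Setoid setoid
  private
    module N = NaturalSolver commutativeSemiring

  Coefficient : Set
  Coefficient = ℕ × ℕ

  -- Cancels until one entry is 0, so that equal integers get equal representatives and `equal?` may
  -- compare entries.
  reduce : Coefficient → Coefficient
  reduce (suc a , suc b) = reduce (a , b)
  reduce p               = p

  ⟦_⟧ᶜ : Coefficient → Carrier
  ⟦ a , b ⟧ᶜ = a ⋅ 1# - b ⋅ 1#

  move : ∀ {x y z} → z + y ≈ x → z ≈ x - y
  move {x} {y} {z} e = begin
    z             ≈⟨ +-identityʳ z ⟨
    z + 0#        ≈⟨ +-congˡ (-‿inverseʳ y) ⟨
    z + (y - y)   ≈⟨ +-assoc z y (- y) ⟨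
    z + y - y     ≈⟨ +-congʳ e ⟩
    x - y         ∎

  unmove : ∀ x y → (x - y) + y ≈ x
  unmove x y = begin
    x - y + y      ≈⟨ +-assoc x (- y) y ⟩
    x + (- y + y)  ≈⟨ +-congˡ (-‿inverseˡ y) ⟩
    x + 0#         ≈⟨ +-identityʳ x ⟩
    x              ∎

  cancel-1 : ∀ x y → (1# + x) - (1# + y) ≈ x - y
  cancel-1 x y = sym (move (begin
    (x - y) + (1# + y)  ≈⟨ N.solve 3 (λ p o y → p N.:+ (o N.:+ y) N.:= o N.:+ (p N.:+ y)) refl (x - y) 1# y ⟩
    1# + ((x - y) + y)  ≈⟨ +-congˡ (unmove x y) ⟩
    1# + x              ∎))

  reduce-≈ : ∀ p → ⟦ reduce p ⟧ᶜ ≈ ⟦ p ⟧ᶜ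
  reduce-≈ (zero  , b)     = refl
  reduce-≈ (suc a , zero)  = refl
  reduce-≈ (suc a , suc b) = trans (reduce-≈ (a , b)) (sym (cancel-1 (a ⋅ 1#) (b ⋅ 1#)))

  coefficients : RawRing _ _
  coefficients = record
    { Carrier = Coefficient
    ; _≈_     = _≡_
    ; _+_     = λ { (a , b) (c , d) → reduce (a ℕ.+ c , b ℕ.+ d) }
    ; _*_     = λ { (a , b) (c , d) → reduce (a ℕ.* c ℕ.+ b ℕ.* d , a ℕ.* d ℕ.+ b ℕ.* c) }
    ; -_      = λ { (a , b) → b , a }
    ; 0#      = 0 , 0
    ; 1#      = 1 , 0
    }

  ⟦⟧ᶜ-+ : ∀ a b c d → ⟦ a ℕ.+ c , b ℕ.+ d ⟧ᶜ ≈ ⟦ a , b ⟧ᶜ + ⟦ c , d ⟧ᶜ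
  ⟦⟧ᶜ-+ a b c d = sym (move (begin
    p + q + (b ℕ.+ d) ⋅ 1#           ≈⟨ +-congˡ (⋅-homo-+ 1# b d) ⟩
    p + q + (B + D)                  ≈⟨ N.solve 4 (λ p q B D → p N.:+ q N.:+ (B N.:+ D) N.:= (p N.:+ B) N.:+
        (q N.:+ D)) refl p q B D ⟩
    (p + B) + (q + D)                ≈⟨ +-cong (unmove _ B) (unmove _ D) ⟩
    a ⋅ 1# + c ⋅ 1#                  ≈⟨ ⋅-homo-+ 1# a c ⟨
    (a ℕ.+ c) ⋅ 1#                   ∎))
    where
    p = ⟦ a , b ⟧ᶜ
    q = ⟦ c , d ⟧ᶜ
    B = b ⋅ 1#
    D = d ⋅ 1#

  ⟦⟧ᶜ-* : ∀ a b c d → ⟦ a ℕ.* c ℕ.+ b ℕ.* d , a ℕ.* d ℕ.+ b ℕ.* c ⟧ᶜ ≈ ⟦ a , b ⟧ᶜ * ⟦ c , d ⟧ᶜ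
  ⟦⟧ᶜ-* a b c d = sym (move (begin
    p * q + (a ℕ.* d ℕ.+ b ℕ.* c) ⋅ 1#       ≈⟨ +-congˡ (products a d b c) ⟩
    p * q + (A * D + B * C)                  ≈⟨ +-congˡ (+-cong (*-congʳ (sym A≈)) (*-congˡ (sym C≈))) ⟩
    p * q + ((p + B) * D + B * (q + D))      ≈⟨ N.solve 4 (λ p q B D → p N.:* q N.:+ ((p N.:+ B) N.:* D N.:+ B N.:*
        (q N.:+ D)) N.:= (p N.:+ B) N.:* (q N.:+ D) N.:+ B N.:* D) refl p q B D ⟩
    (p + B) * (q + D) + B * D                ≈⟨ +-congʳ (*-cong A≈ C≈) ⟩
    A * C + B * D                            ≈⟨ products a c b d ⟨
    (a ℕ.* c ℕ.+ b ℕ.* d) ⋅ 1#               ∎))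
    where
    p = ⟦ a , b ⟧ᶜ
    q = ⟦ c , d ⟧ᶜ
    A = a ⋅ 1#
    B = b ⋅ 1#
    C = c ⋅ 1#
    D = d ⋅ 1#
    A≈ = unmove A B
    C≈ = unmove C D
    products : ∀ a b c d → (a ℕ.* b ℕ.+ c ℕ.* d) ⋅ 1# ≈ (a ⋅ 1#) * (b ⋅ 1#) + (c ⋅ 1#) * (d ⋅ 1#)
    products a b c d = trans (⋅-homo-+ 1# (a ℕ.* b) (c ℕ.* d)) (+-cong (⋅1-homo-* a b) (⋅1-homo-* c d))

  ⟦⟧ᶜ-neg : ∀ a b → ⟦ b , a ⟧ᶜ ≈ - ⟦ a , b ⟧ᶜ
  ⟦⟧ᶜ-neg a b = begin
    B - A          ≈⟨ +-comm B (- A) ⟩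
    - A + B        ≈⟨ +-congˡ (-‿involutive B) ⟨
    - A - - B      ≈⟨ -‿+-comm A (- B) ⟩
    - (A - B)      ∎
    where
    A = a ⋅ 1#
    B = b ⋅ 1#

  -- Special cases make the literals 0 and 1 evaluate to 0# and 1# by definition.

  ⟦_⟧ : Coefficient → Carrier
  ⟦ 0 , 0 ⟧ = 0#
  ⟦ 1 , 0 ⟧ = 1#
  ⟦ p ⟧     = ⟦ p ⟧ᶜ

  ⟦⟧≈⟦⟧ᶜ : ∀ p → ⟦ p ⟧ ≈ ⟦ p ⟧ᶜ
  ⟦⟧≈⟦⟧ᶜ (0 , 0)           = sym (trans (+-congˡ -0#≈0#) (+-identityʳ 0#))
  ⟦⟧≈⟦⟧ᶜ (1 , 0)           = sym (trans (+-congˡ -0#≈0#) (trans (+-identityʳ _) (+-identityʳ 1#)))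
  ⟦⟧≈⟦⟧ᶜ (suc (suc a) , 0) = refl
  ⟦⟧≈⟦⟧ᶜ (0 , suc b)       = refl
  ⟦⟧≈⟦⟧ᶜ (1 , suc b)       = refl
  ⟦⟧≈⟦⟧ᶜ (suc (suc a) , suc b) = refl

  homomorphism : coefficients -Raw-AlmostCommutative⟶ fromCommutativeRing R
  homomorphism = record
    { ⟦_⟧    = ⟦_⟧
    ; +-homo = λ { p@(a , b) q@(c , d) → trans (⟦⟧≈⟦⟧ᶜ (reduce (a ℕ.+ c , b ℕ.+ d))) (trans (reduce-≈ (a ℕ.+ c , b ℕ.+ d))
        (trans (⟦⟧ᶜ-+ a b c d) (sym (+-cong (⟦⟧≈⟦⟧ᶜ p) (⟦⟧≈⟦⟧ᶜ q))))) }
    ; *-homo = λ { p@(a , b) q@(c , d) → trans (⟦⟧≈⟦⟧ᶜ (reduce (a ℕ.* c ℕ.+ b ℕ.* d , a ℕ.* d ℕ.+ b ℕ.* c))) (trans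
        (reduce-≈ (a ℕ.* c ℕ.+ b ℕ.* d , a ℕ.* d ℕ.+ b ℕ.* c))
        (trans (⟦⟧ᶜ-* a b c d) (sym (*-cong (⟦⟧≈⟦⟧ᶜ p) (⟦⟧≈⟦⟧ᶜ q))))) }
    ; -‿homo = λ { p@(a , b) → trans (⟦⟧≈⟦⟧ᶜ (b , a)) (trans (⟦⟧ᶜ-neg a b) (-‿cong (sym (⟦⟧≈⟦⟧ᶜ p)))) }
    ; 0-homo = refl
    ; 1-homo = refl
    }

  equal? : (p q : Coefficient) → Maybe (⟦ p ⟧ ≈ ⟦ q ⟧)
  equal? (a , b) (c , d) with a ℕ.≟ c | b ℕ.≟ d
  ... | yes ≡.refl | yes ≡.refl = just refl
  ... | _          | _          = nothing

  open RingSolver coefficients (fromCommutativeRing R) homomorphism equal? public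
    using (Polynomial; con; _:+_; _:*_; _:-_; :-_; _:=_) renaming (solve to ring-solve)

  :0 :1 : ∀ {k} → Polynomial k
  :0 = con (0 , 0)
  :1 = con (1 , 0)

-- Inequalities and bisection without a decidable order

module OrderedField (ℝ : RealNumbers) where

  open RealNumbers ℝ public
  open CommutativeRing commutativeRing public
    using (refl; sym; trans; +-cong; +-congˡ; +-congʳ; *-cong; *-congˡ; *-congʳ; -‿cong; -‿inverseʳ; +-identityʳ; +-identityˡ
          ; *-identityʳ; *-identityˡ; *-comm; *-assoc; zeroʳ; +-assoc; +-comm; setoid; reflexive)
  open HeytingProperties heytingCommutativeRing using (1#0)
  open CommutativeRingSolver commutativeRing public
  open IsStrictPartialOrder isStrictPartialOrder public
    using () renaming (trans to <-trans; irrefl to <-irrefl; <-respˡ-≈ to <-respˡ; <-respʳ-≈ to <-respʳ; asym to <-asym)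

  open RingProperties (CommutativeRing.ring commutativeRing) public using (-‿distribʳ-*)

  infix 4 _>0
  _>0 : Carrier → Set
  x >0 = 0# < x

  >0-cong : ∀ {x y} → x ≈ y → x >0 → y >0
  >0-cong = <-respʳ

  <⇒>0 : ∀ {x y} → x < y → y - x >0
  <⇒>0 {x} {y} x<y = <-respˡ (-‿inverseʳ x) (+-monoˡ-< (- x) x<y)

  -- The form in which strict inequalities are proved: a positive expression built from positive
  -- ones, and a ring identity equating it with the difference.
  >0⇒< : ∀ {x y p} → p >0 → y - x ≈ p → x < y
  >0⇒< {x} {y} {p} p>0 e = <-respˡ (+-identityˡ x) (<-respʳ
    (trans (+-congʳ (sym e)) (ring-solve 2 (λ x y → y :- x :+ x := y) refl x y)) (+-monoˡ-< x p>0))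

  +-pos : ∀ {x y} → x >0 → y >0 → x + y >0
  +-pos {x} {y} x>0 y>0 = <-trans y>0 (<-respˡ (+-identityˡ y) (+-monoˡ-< y x>0))

  infixl 6 _+ₚ_
  infixl 7 _*ₚ_
  _+ₚ_ : ∀ {x y} → x >0 → y >0 → x + y >0
  _+ₚ_ = +-pos
  _*ₚ_ : ∀ {x y} → x >0 → y >0 → x * y >0
  _*ₚ_ = *-positive

  #-cases : ∀ {x y} → x # y → x < y ⊎ y < x
  #-cases = Equivalence.to #⇔<⊎>

  <⇒# : ∀ {x y} → x < y → x # y
  <⇒# = Equivalence.from #⇔<⊎> ∘ inj₁

  >⇒# : ∀ {x y} → y < x → x # y
  >⇒# = Equivalence.from #⇔<⊎> ∘ inj₂

  neg-pos : ∀ {x} → x < 0# → - x >0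
  neg-pos {x} x<0 = >0-cong (+-identityˡ (- x)) (<⇒>0 x<0)

  opaque
    1>0 : 1# >0
    1>0 with #-cases 1#0
    ... | inj₂ p = p
    ... | inj₁ n = ⊥-elim (<-asym n (>0-cong (ring-solve 0 ((:- :1) :* (:- :1) := :1) refl) (neg-pos n *ₚ neg-pos n)))

  opaque
    inverse : ∀ {x} → x >0 → ∃ λ y → y >0 × x * y ≈ 1#
    inverse {x} x>0 with HeytingCommutativeRing.#⇒invertible heytingCommutativeRing (>⇒# x>0)
    ... | y , _ , xy≈1 = y , y>0 , e
      where
      e : x * y ≈ 1#
      e = trans (ring-solve 2 (λ x y → x :* y := (x :- :0) :* y) refl x y) xy≈1
      y#0 : y # 0#
      y#0 = HeytingCommutativeRing.invertible⇒# heytingCommutativeRing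
        (x , trans (ring-solve 2 (λ x y → x :* (y :- :0) := x :* y) refl x y) e , trans (ring-solve 2 (λ x y →
            (y :- :0) :* x := x :* y) refl x y) e)
      y>0 : y >0
      y>0 = [ negative , (λ p → p) ]′ (#-cases y#0)
        where
        negative : y < 0# → y >0
        negative n = ⊥-elim (<-asym 1>0 (>0⇒< (x>0 *ₚ neg-pos n)
          (trans (+-identityˡ (- 1#)) (trans (-‿cong (sym e)) (-‿distribʳ-* x y)))))

  pos-cancelʳ : ∀ {x c} → c >0 → x * c >0 → x >0
  pos-cancelʳ {x} {c} c>0 xc>0 with inverse c>0
  ... | d , d>0 , cd≈1 = >0-cong (trans (*-assoc x c d) (trans (*-congˡ cd≈1) (*-identityʳ x))) (xc>0 *ₚ d>0)

  2# : Carrier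
  2# = 1# + 1#

  2>0 : 2# >0
  2>0 = 1>0 +ₚ 1>0

  pos-half : ∀ {x} → x + x >0 → x >0
  pos-half {x} h = pos-cancelʳ 2>0 (>0-cong (ring-solve 1 (λ x → x :+ x := x :* (:1 :+ :1)) refl x) h)

  ½ : Carrier
  ½ = proj₁ (inverse 2>0)

  ½>0 : ½ >0
  ½>0 = proj₁ (proj₂ (inverse 2>0))

  halves : ∀ x → ½ * x + ½ * x ≈ x
  halves x = trans (ring-solve 2 (λ h x → h :* x :+ h :* x := (:1 :+ :1) :* h :* x) refl ½ x)
    (trans (*-congʳ (proj₂ (proj₂ (inverse 2>0)))) (*-identityˡ x))

  opaque
    -- The smaller of p and q cannot be selected, so the witness is p q / (p + q); it falls short of
    -- p by p² / (p + q), and likewise for q.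
    common-lower-bound : ∀ {p q} → p >0 → q >0 → ∃ λ μ → μ >0 × μ < p × μ < q
    common-lower-bound {p} {q} p>0 q>0 with inverse (p>0 +ₚ q>0)
    ... | r , r>0 , e = p * q * r , p>0 *ₚ q>0 *ₚ r>0 , >0⇒< (p>0 *ₚ p>0 *ₚ r>0) gap-p , >0⇒< (q>0 *ₚ q>0 *ₚ r>0) gap-q
      where
      expanded : ∀ x → x ≈ x * ((p + q) * r)
      expanded x = trans (sym (*-identityʳ x)) (*-congˡ (sym e))
      gap-p : p - p * q * r ≈ p * p * r
      gap-p = trans (+-congʳ (expanded p)) (ring-solve 3 (λ p q r → p :*
          ((p :+ q) :* r) :- p :* q :* r := p :* p :* r) refl p q r)
      gap-q : q - p * q * r ≈ q * q * r
      gap-q = trans (+-congʳ (expanded q)) (ring-solve 3 (λ p q r → q :*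
          ((p :+ q) :* r) :- p :* q :* r := q :* q :* r) refl p q r)

  ·-pos : ∀ k → suc k · 1# >0
  ·-pos zero    = >0-cong (sym (+-identityʳ 1#)) 1>0
  ·-pos (suc k) = 1>0 +ₚ ·-pos k

  ·-mono-< : ∀ {k l} → k ℕ.< l → k · 1# < l · 1#
  ·-mono-< {zero}  {suc l} _         = ·-pos l
  ·-mono-< {suc k} {suc l} (ℕ.s≤s h) = >0⇒< (<⇒>0 (·-mono-< h)) (ring-solve 3 (λ o k l → (o :+ l) :-
      (o :+ k) := l :- k) refl 1# (k · 1#) (l · 1#))

  bounded-by-ℕ : ∀ x → ∃ λ k → x < suc k · 1#
  bounded-by-ℕ x with archimedean x
  ... | k , x<k = k , <-trans x<k (·-mono-< (ℕ.n<1+n k))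

  absolute-bound : ∀ x → ∃ λ c → c >0 × x < c × - x < c
  absolute-bound x with bounded-by-ℕ x | bounded-by-ℕ (- x)
  ... | k , x< | l , -x< = suc k · 1# + suc l · 1# , ·-pos k +ₚ ·-pos l
    , >0⇒< (<⇒>0 x< +ₚ ·-pos l) (ring-solve 3 (λ x k l → (k :+ l) :- x := (k :- x) :+ l) refl x _ _)
    , >0⇒< (<⇒>0 -x< +ₚ ·-pos k) (ring-solve 3 (λ x k l → (k :+ l) :- (:- x) := (l :- (:- x)) :+ k) refl x _ _)

  -- Twice the expression is (e - x)(c - y) + (e + x)(c + y).
  product-bound : ∀ {x y e c} → x < e → - x < e → y < c → - y < c → e * c + x * y >0
  product-bound {x} {y} {e} {c} x<e -x<e y<c -y<c = pos-half (>0-cong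
    (ring-solve 4 (λ x y e c → (e :- x) :* (c :- y) :+ (e :- (:- x)) :* (c :- (:- y)) := (e :* c :+ x :* y) :+
        (e :* c :+ x :* y)) refl x y e c)
    (<⇒>0 x<e *ₚ <⇒>0 y<c +ₚ <⇒>0 -x<e *ₚ <⇒>0 -y<c))

  -- A family of affine functions A i + t B i that is positive at t = 0 and t = 1 stays above
  -- a margin μ i at every point of a bisection, hence is positive at the limit.

  module Bisection {I : Set} (A B : I → Carrier) (A>0 : ∀ i → A i >0) (A+B>0 : ∀ i → A i + B i >0)
    (U W : Carrier → Set)
    (U-open : ∀ t → U t → ∃ λ ρ → ρ >0 × (∀ s → Within ρ t s → U s))
    (W-open : ∀ t → W t → ∃ λ ρ → ρ >0 × (∀ s → Within ρ t s → W s))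
    (cover : ∀ t → (∀ i → A i + t * B i >0) → U t ⊎ W t) (U0 : U 0#) (W1 : W 1#) where

    L : I → Carrier → Carrier
    L i t = A i + t * B i

    margin : ∀ i → ∃ λ μ → μ >0 × μ < A i × μ < A i + B i
    margin i = common-lower-bound (A>0 i) (A+B>0 i)

    μ : I → Carrier
    μ i = proj₁ (margin i)

    within-≈ : ∀ {t s ρ} → ρ >0 → t ≈ s → Within ρ t s
    within-≈ {t} {s} {ρ} ρ>0 e = >0⇒< ρ>0 (trans (+-congˡ (-‿cong e)) (ring-solve 2 (λ s ρ → (s :+ ρ) :- s := ρ) refl s ρ))
      , >0⇒< ρ>0 (trans (+-congʳ (+-congʳ e)) (ring-solve 2 (λ s ρ → (s :+ ρ) :- s := ρ) refl s ρ))

    W-resp : ∀ {t s} → t ≈ s → W t → W s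
    W-resp {t} e Wt with W-open t Wt
    ... | ρ , ρ>0 , near = near _ (within-≈ ρ>0 e)

    h : ℕ → Carrier
    h zero    = 1#
    h (suc k) = ½ * h k

    h-halves : ∀ k → h (suc k) + h (suc k) ≈ h k
    h-halves k = halves (h k)

    h>0 : ∀ k → h k >0
    h>0 zero    = 1>0
    h>0 (suc k) = ½>0 *ₚ h>0 k

    h<2 : ∀ k → h k < 2#
    h<2 zero    = >0⇒< 1>0 (ring-solve 0 (:1 :+ :1 :- :1 := :1) refl)
    h<2 (suc k) = <-trans (>0⇒< (h>0 (suc k)) (trans (+-congʳ (sym (h-halves k))) (ring-solve 1
        (λ x → x :+ x :- x := x) refl (h (suc k))))) (h<2 k)

    -- The decay 2 / (k + 1) is slow enough to induct on, since 2 (k + 2) h_{k+1} = (k + 1) h_k +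
    -- h_k < 4, and fast enough for the Archimedean property.
    h-small : ∀ k → suc k · 1# * h k < 2#
    h-small zero    = >0⇒< 1>0 (ring-solve 0 (:1 :+ :1 :- (:1 :+ :0) :* :1 := :1) refl)
    h-small (suc k) = >0⇒< (pos-half (>0-cong (trans (+-cong (+-congˡ (-‿cong (*-congˡ (sym (h-halves k))))) (+-congˡ
        (-‿cong (sym (h-halves k)))))
        (ring-solve 2 (λ n x → ((:1 :+ :1) :- n :* (x :+ x)) :+ ((:1 :+ :1) :- (x :+ x)) :=
          ((:1 :+ :1) :- (:1 :+ n) :* x) :+ ((:1 :+ :1) :- (:1 :+ n) :* x)) refl (suc k · 1#) (h (suc k))))
        (<⇒>0 (h-small k) +ₚ <⇒>0 (h<2 k)))) refl

    opaque
      h-vanishes : ∀ {ε} → ε >0 → ∃ λ K → ∀ k → K ℕ.≤ k → h k < ε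
      h-vanishes {ε} ε>0 with inverse ε>0
      ... | ε⁻¹ , _ , e with archimedean (2# * ε⁻¹)
      ...   | K , 2/ε<K = K , λ k K≤k → >0⇒< (pos-cancelʳ (·-pos k) (>0-cong
          (trans (+-congʳ (+-congʳ {x = 2#} (trans (ring-solve 3 (λ n ε r → ε :* (n :- (:1 :+ :1) :* r) := ε :* n :-
              (:1 :+ :1) :* (ε :* r)) refl (suc k · 1#) ε ε⁻¹)
              (+-congˡ (-‿cong (trans (*-congˡ e) (*-identityʳ 2#)))))))
            (ring-solve 3 (λ n ε x → (ε :* n :- (:1 :+ :1)) :+ (:1 :+ :1) :- n :* x := (ε :- x) :* n) refl (suc k · 1#) ε (h k)))
          (>0-cong (ring-solve 3 (λ a b c → a :+ (b :- c) := (a :+ b) :- c) refl _ 2# _)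
            (ε>0 *ₚ <⇒>0 (<-trans 2/ε<K (·-mono-< (ℕ.s≤s K≤k))) +ₚ <⇒>0 (h-small k))))) refl

    record State (k : ℕ) : Set where
      field
        a     : Carrier
        inU   : U a
        inW   : W (a + h k)
        above : ∀ i → μ i < L i a
        above′ : ∀ i → μ i < L i (a + h k)

    open State

    -- A bisection interval may keep one of its ends. Widened by its length on both sides it shrinks
    -- strictly at both ends, so nesting can be stated with `_<_`.
    lower upper : ∀ {k} → State k → Carrier
    lower {k} s = a s - h k
    upper {k} s = a s + h k + h k

    initial : State 0
    initial = record
      { a = 0# ; inU = U0 ; inW = W-resp (sym (+-identityˡ 1#)) W1
      ; above  = λ i → <-respʳ (ring-solve 2 (λ a b → a := a :+ :0 :* b) refl (A i) (B i)) (proj₁ (proj₂ (proj₂ (margin i))))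
      ; above′ = λ i → <-respʳ (ring-solve 2 (λ a b → a :+ b := a :+ (:0 :+ :1) :* b) refl (A i) (B i)) (proj₂ (proj₂
          (proj₂ (margin i))))
      }

    L-cong : ∀ i {s t} → s ≈ t → L i s ≈ L i t
    L-cong i e = +-congˡ (*-congʳ e)

    module _ {k} (s : State k) where

      mid : Carrier
      mid = a s + h (suc k)

      opaque
        mid+h : mid + h (suc k) ≈ a s + h k
        mid+h = trans (+-assoc _ _ _) (+-congˡ (h-halves k))

        above-mid : ∀ i → μ i < L i mid
        above-mid i = >0⇒< (pos-half (>0-cong
          (trans (+-congˡ (+-congʳ (L-cong i (sym mid+h)))) (ring-solve 5 (λ A B a x m → (A :+ a :* B :- m) :+ (A :+
              (a :+ x :+ x) :* B :- m) :=
            (A :+ (a :+ x) :* B :- m) :+ (A :+ (a :+ x) :* B :- m)) refl (A i) (B i) (a s) (h (suc k)) (μ i)))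
          (<⇒>0 (above s i) +ₚ <⇒>0 (above′ s i)))) refl

        L-mid>0 : ∀ i → L i mid >0
        L-mid>0 i = <-trans (proj₁ (proj₂ (margin i))) (above-mid i)

      Successor : Set
      Successor = ∃ λ (s′ : State (suc k)) → lower s < lower s′ × upper s′ < upper s

      go-right : U mid → Successor
      go-right inUm = record { a = mid ; inU = inUm ; inW = W-resp (sym mid+h) (inW s) ; above = above-mid
                               ; above′ = λ i → <-respʳ (L-cong i (sym mid+h)) (above′ s i) }
        , >0⇒< (h>0 k) (ring-solve 3 (λ a x y → (a :+ x :- x) :- (a :- y) := y) refl (a s) (h (suc k)) (h k))
        , >0⇒< (h>0 (suc k)) (trans (+-congʳ (+-cong (+-congˡ (sym (h-halves k))) (sym (h-halves k))))
            (ring-solve 2 (λ a x → (a :+ (x :+ x) :+ (x :+ x)) :- (a :+ x :+ x :+ x) := x) refl (a s) (h (suc k))))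

      go-left : W mid → Successor
      go-left inWm = record { a = a s ; inU = inU s ; inW = inWm ; above = above s ; above′ = above-mid }
        , >0⇒< (h>0 (suc k)) (trans (+-congˡ (-‿cong (+-congˡ (-‿cong (sym (h-halves k))))))
            (ring-solve 2 (λ a x → (a :- x) :- (a :- (x :+ x)) := x) refl (a s) (h (suc k))))
        , >0⇒< (h>0 k) (trans (+-congˡ (-‿cong (trans (+-assoc _ _ _) (+-congˡ (h-halves k)))))
            (ring-solve 2 (λ a y → (a :+ y :+ y) :- (a :+ y) := y) refl (a s) (h k)))

      next : Successor
      next = [ go-right , go-left ]′ (cover mid L-mid>0)

    state : ∀ k → State k
    state zero    = initial
    state (suc k) = proj₁ (next (state k))

    α : ℕ → Carrier
    α k = a (state k)

    nested : ∀ {k j} → k ℕ.≤′ j → α k - (h k + h k) < lower (state j) × upper (state j) < α k + (h k + h k + h k)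
    nested {k} ℕ.≤′-refl = >0⇒< (h>0 k) (ring-solve 2 (λ a y → (a :- y) :- (a :- (y :+ y)) := y) refl (α k) (h k))
      , >0⇒< (h>0 k) (ring-solve 2 (λ a y → (a :+ (y :+ y :+ y)) :- (a :+ y :+ y) := y) refl (α k) (h k))
    nested {k} (ℕ.≤′-step {j} k≤j) =
      <-trans (proj₁ (nested k≤j)) (proj₁ (proj₂ (next (state j)))) , <-trans (proj₂ (proj₂ (next (state j)))) (proj₂
          (nested k≤j))

    opaque
      -- By `nested`, two left ends from step K on differ by less than 5 h_K; 8 is the next power of
      -- two, reached by repeated halving.
      eighth : ∀ {ε} → ε >0 → ∃ λ δ → δ >0 × δ + δ + (δ + δ) + (δ + δ + (δ + δ)) ≈ ε
      eighth {ε} ε>0 = ½ * (½ * (½ * ε)) , ½>0 *ₚ (½>0 *ₚ (½>0 *ₚ ε>0)) ,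
        trans (+-cong (+-cong (halves _) (halves _)) (+-cong (halves _) (halves _))) (trans (+-cong (halves _)
            (halves _)) (halves ε))

    opaque
      close : ∀ {ε δ K p q} → δ >0 → δ + δ + (δ + δ) + (δ + δ + (δ + δ)) ≈ ε → h K < δ → K ℕ.≤ p → K ℕ.≤ q → α p < α q + ε
      close {ε} {δ} {K} {p} {q} δ>0 8δ≈ε hK<δ K≤p K≤q = >0⇒< (>0-cong
        (ring-solve 6 (λ P Q A d x y → ((Q :- x) :- (A :- (y :+ y))) :+ x :+ ((A :+ (y :+ y :+ y)) :- P) :+
          ((d :- y) :+ (d :- y) :+ ((d :- y) :+ (d :- y)) :+ (d :- y) :+ (d :+ d :+ d)) :=
          Q :+ (d :+ d :+ (d :+ d) :+ (d :+ d :+ (d :+ d))) :- P) refl (α p) (α q) (α K) δ (h q) (h K))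
        (<⇒>0 (proj₁ (nested (ℕ.≤⇒≤′ K≤q))) +ₚ h>0 q +ₚ <⇒>0 (<-trans below-upper (proj₂ (nested (ℕ.≤⇒≤′ K≤p)))) +ₚ
          (d +ₚ d +ₚ (d +ₚ d) +ₚ d +ₚ (δ>0 +ₚ δ>0 +ₚ δ>0))))
        (+-congʳ (+-congˡ (sym 8δ≈ε)))
        where
        d : δ - h K >0
        d = <⇒>0 hK<δ
        below-upper : α p < upper (state p)
        below-upper = >0⇒< (h>0 p +ₚ h>0 p) (ring-solve 2 (λ a x → (a :+ x :+ x) :- a := x :+ x) refl (α p) (h p))

    opaque
      cauchy : IsCauchy α
      cauchy ε ε>0 with eighth ε>0
      ... | δ , δ>0 , 8δ≈ε with h-vanishes δ>0
      ...   | K , h<δ = K , λ p q K≤p K≤q → close δ>0 8δ≈ε (h<δ K ℕ.≤-refl) K≤p K≤q , close δ>0 8δ≈ε (h<δ K ℕ.≤-refl) K≤q K≤p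

    opaque
      limit : ∃ (ConvergesTo α)
      limit = complete α cauchy

    c : Carrier
    c = proj₁ limit

    -- Moving from x to y changes the affine function by (y - x) B, which is smaller in size than ε
    -- C = μ, so the margin absorbs it.
    L-near>0 : ∀ i {x y C ε} → μ i < L i x → ε * C ≈ μ i → Within ε x y → B i < C → - B i < C → L i y >0
    L-near>0 i {x} {y} {C} {ε} above εC≈μ near B<C -B<C = >0-cong e (<⇒>0 above +ₚ product-bound d<ε -d<ε B<C -B<C)
      where
      d<ε : y - x < ε
      d<ε = >0⇒< (<⇒>0 (proj₂ near)) (ring-solve 3 (λ y x e → e :- (y :- x) := x :+ e :- y) refl y x ε)
      -d<ε : - (y - x) < ε
      -d<ε = >0⇒< (<⇒>0 (proj₁ near)) (ring-solve 3 (λ y x e → e :- (:- (y :- x)) := y :+ e :- x) refl y x ε)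
      e : (L i x - μ i) + (ε * C + (y - x) * B i) ≈ L i y
      e = trans (+-congˡ (+-congʳ εC≈μ)) (ring-solve 5 (λ A B x y m → ((A :+ x :* B) :- m) :+ (m :+
          (y :- x) :* B) := A :+ y :* B) refl
        (A i) (B i) x y (μ i))

    Tolerance : I → Set
    Tolerance i = ∃ λ ε → ε >0 × (∀ {x y} → μ i < L i x → Within ε x y → L i y >0)

    μ>0 : ∀ i → μ i >0
    μ>0 i = proj₁ (proj₂ (margin i))

    tolerance-from : ∀ i {C C⁻¹} → C⁻¹ >0 → C * C⁻¹ ≈ 1# → B i < C → - B i < C → Tolerance i
    tolerance-from i {C} {C⁻¹} C⁻¹>0 CC⁻¹≈1 B<C -B<C = μ i * C⁻¹ , (μ>0 i *ₚ C⁻¹>0) ,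
      λ above near → L-near>0 i {C = C} {μ i * C⁻¹} above εC≈μ near B<C -B<C
      where
      εC≈μ : μ i * C⁻¹ * C ≈ μ i
      εC≈μ = trans (*-assoc (μ i) C⁻¹ C) (trans (*-congˡ (trans (*-comm C⁻¹ C) CC⁻¹≈1)) (*-identityʳ (μ i)))

    opaque
      tolerance : ∀ i → Tolerance i
      tolerance i = let (_ , C>0 , B<C , -B<C) = absolute-bound (B i) ; (_ , C⁻¹>0 , e) = inverse C>0 in
        tolerance-from i C⁻¹>0 e B<C -B<C

    opaque
      L-c>0 : ∀ i → L i c >0
      L-c>0 i = proj₂ (proj₂ (tolerance i)) (above (state (proj₁ near)) i) (proj₂ near (proj₁ near) ℕ.≤-refl)
        where
        near : ∃ λ N → ∀ p → N ℕ.≤ p → Within (proj₁ (tolerance i)) (α p) c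
        near = proj₂ limit (proj₁ (tolerance i)) (proj₁ (proj₂ (tolerance i)))

    Meeting : Set
    Meeting = ∃ λ t → (∀ i → L i t >0) × U t × W t

    meet-right : ∀ {ρ k} → ρ >0 → (∀ s → Within ρ c s → U s) → Within (½ * ρ) (α k) c → h k < ½ * ρ → Meeting
    meet-right {ρ} {k} ρ>0 inside near h<ρ = α k + h k , (λ i → <-trans (μ>0 i) (above′ (state k) i)) , inside (α k + h k)
      ( >0⇒< (<⇒>0 (proj₂ near) +ₚ h>0 k +ₚ ½>0 *ₚ ρ>0) (trans (+-congʳ (+-congˡ (sym (halves ρ))))
          (ring-solve 4 (λ c a x r → (a :+ x) :+ (r :+ r) :- c := (a :+ r :- c) :+ x :+ r) refl c (α k) (h k) (½ * ρ)))
      , >0⇒< (<⇒>0 (proj₁ near) +ₚ <⇒>0 h<ρ) (trans (+-congʳ (+-congˡ (sym (halves ρ))))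
          (ring-solve 4 (λ c a x r → c :+ (r :+ r) :- (a :+ x) := (c :+ r :- a) :+ (r :- x)) refl c (α k) (h k) (½ * ρ)))
      ) , inW (state k)

    meet-left : ∀ {ρ k} → (∀ s → Within ρ c s → W s) → Within ρ (α k) c → Meeting
    meet-left {ρ} {k} inside near = α k , (λ i → <-trans (μ>0 i) (above (state k) i)) , inU (state k) ,
      inside (α k) (proj₂ near , proj₁ near)

    opaque
      -- The limit lies in U or in W. Whichever it is, bisection ends belonging to the other set
      -- converge to it and enter the open set containing it.
      meet : Meeting
      meet = [ (λ Uc → let (ρ , ρ>0 , inside) = U-open c Uc
                           (N , conv) = proj₂ limit (½ * ρ) (½>0 *ₚ ρ>0)
                           (K , h<ρ) = h-vanishes (½>0 *ₚ ρ>0)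
                       in meet-right {k = N ℕ.+ K} ρ>0 inside (conv (N ℕ.+ K) (ℕ.m≤m+n N K)) (h<ρ (N ℕ.+ K) (ℕ.m≤n+m K N)))
             , (λ Wc → let (ρ , ρ>0 , inside) = W-open c Wc
                           (N , conv) = proj₂ limit ρ ρ>0
                       in meet-left {k = N} inside (conv N ℕ.≤-refl)) ]′ (cover c L-c>0)

-- Sides of hyperplanes and connected components

module Geometry (ℝ : RealNumbers) (n m : ℕ) where

  open OrderedField ℝ hiding (setoid)
  open Arrangement ℝ n m

  sum-linear : ∀ {d} (x y : Vector Carrier d) t → sum (λ l → x l + t * y l) ≈ sum x + t * sum y
  sum-linear {zero}  x y t = ring-solve 1 (λ t → :0 := :0 :+ t :* :0) refl t
  sum-linear {suc d} x y t = trans (+-congˡ (sum-linear (x ∘ suc) (y ∘ suc) t))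
    (ring-solve 5 (λ x y t X Y → x :+ t :* y :+ (X :+ t :* Y) := x :+ X :+ t :* (y :+ Y)) refl (x zero) (y zero) t _ _)

  sum-zero : ∀ {d} (x : Vector Carrier d) → sum (λ l → x l * 0#) ≈ 0#
  sum-zero {zero}  x = refl
  sum-zero {suc d} x = trans (+-cong (zeroʳ (x zero)) (sum-zero (x ∘ suc))) (+-identityˡ 0#)

  sum-ε : ∀ {d} (x : Vector Carrier d) i → sum (λ l → x l * ε i l) ≈ x i
  sum-ε {suc d} x zero    = trans (+-cong (*-identityʳ (x zero)) (sum-zero (x ∘ suc))) (+-identityʳ (x zero))
  sum-ε {suc d} x (suc i) = trans (+-cong (zeroʳ (x zero)) (sum-ε (x ∘ suc) i)) (+-identityˡ (x (suc i)))

  sum-diff : ∀ {d} (x y z : Vector Carrier d) → sum (λ l → x l * (y l - z l)) ≈ sum (λ l → x l * y l) - sum (λ l → x l * z l)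
  sum-diff {zero}  x y z = ring-solve 0 (:0 := :0 :- :0) refl
  sum-diff {suc d} x y z = trans (+-congˡ (sum-diff (x ∘ suc) (y ∘ suc) (z ∘ suc)))
    (ring-solve 5 (λ x y z Y Z → x :* (y :- z) :+ (Y :- Z) := x :* y :+ Y :- (x :* z :+ Z)) refl (x zero) (y zero) (z zero) _ _)

  diff : V → PositiveRoot n → Carrier
  diff v (root i j _) = coord v (inject₁ i) - coord v (suc j)

  opaque
    inner≈diff : ∀ v α → ⟨ coord v , rootVector α ⟩ ≈ diff v α
    inner≈diff v (root i j _) = trans (sum-diff (coord v) (ε (inject₁ i)) (ε (suc j)))
      (+-cong (sum-ε (coord v) (inject₁ i)) (-‿cong (sum-ε (coord v) (suc j))))

  gap : CatHyperplane n m → V → Carrier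
  gap (H α k _) v = diff v α - k · 1#

  above⇒ : ∀ h v → Above h v → gap h v >0
  above⇒ (H α k _) v a = <⇒>0 (<-respʳ (inner≈diff v α) a)

  above⇐ : ∀ h v → gap h v >0 → Above h v
  above⇐ (H α k _) v g = <-respʳ (sym (inner≈diff v α)) (>0⇒< g refl)

  below⇒ : ∀ h v → Below h v → - gap h v >0
  below⇒ (H α k _) v b = >0-cong (ring-solve 2 (λ d k → k :- d := :- (d :- k)) refl (diff v α) (k · 1#)) (<⇒>0 (<-respˡ
      (inner≈diff v α) b))

  below⇐ : ∀ h v → - gap h v >0 → Below h v
  below⇐ (H α k _) v g = <-respˡ (sym (inner≈diff v α)) (>0⇒< g (ring-solve 2 (λ d k → k :- d := :- (d :- k)) refl
      (diff v α) (k · 1#)))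

  ¬above∧below : ∀ h v → Above h v → Below h v → ⊥
  ¬above∧below (H α k _) v = <-asym

  Side : CatHyperplane n m → V → Set
  Side h v = Above h v ⊎ Below h v

  side : ∀ v → Complement v → ∀ h → Side h v
  side v c h@(H α k _) = [ inj₂ , inj₁ ]′ (#-cases (c h))

  side⇒complement : ∀ v → (∀ h → Side h v) → Complement v
  side⇒complement v s h@(H α k _) = [ >⇒# , <⇒# ]′ (s h)

  shift : V → Carrier → V → V
  shift v t b = vec (λ l → coord v l + t * coord b l) (trans (sum-linear (coord v) (coord b) t)
    (trans (+-cong (sum≈0 v) (*-congˡ (sum≈0 b))) (ring-solve 1 (λ t → :0 :+ t :* :0 := :0) refl t)))

  diff-shift : ∀ v t b α → diff (shift v t b) α ≈ diff v α + t * diff b α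
  diff-shift v t b (root i j _) = ring-solve 5 (λ x y t u w → (x :+ t :* u) :- (y :+ t :* w) := (x :- y) :+ t :* (u :- w)) refl
    (coord v (inject₁ i)) (coord v (suc j)) t (coord b (inject₁ i)) (coord b (suc j))

  _⊖_ : V → V → V
  w ⊖ v = shift w (- 1#) v

  line : V → V → Carrier → V
  line v w t = shift v t (w ⊖ v)

  gap-line : ∀ h v w t → gap h (line v w t) ≈ gap h v + t * (gap h w - gap h v)
  gap-line (H α k _) v w t = trans (+-congʳ (trans (diff-shift v t (w ⊖ v) α) (+-congˡ (*-congˡ (diff-shift w (- 1#) v α)))))
    (ring-solve 4 (λ v w t k → v :+ t :* (w :+ (:- :1) :* v) :- k := v :- k :+ t :* ((w :- k) :- (v :- k))) refl
        (diff v α) (diff w α) t (k · 1#))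

  opaque
    inverse-n : ∃ λ r → r >0 × suc n · 1# * r ≈ 1#
    inverse-n = inverse (·-pos n)

  mean : Vector Carrier (suc n) → Carrier
  mean y = sum y * proj₁ inverse-n

  sum-1 : ∀ d → sum {d} (λ _ → 1#) ≈ d · 1#
  sum-1 zero    = refl
  sum-1 (suc d) = +-congˡ (sum-1 d)

  centre : Vector Carrier (suc n) → V
  centre y = vec (λ l → y l + (- mean y) * 1#) (trans (sum-linear y (λ _ → 1#) (- mean y))
    (trans (+-congˡ (*-congˡ (sum-1 (suc n)))) (trans (ring-solve 3 (λ s r k → s :+ (:- (s :* r)) :* k := s :- s :*
        (k :* r)) refl (sum y) (proj₁ inverse-n) (suc n · 1#))
      (trans (+-congˡ (-‿cong (trans (*-congˡ (proj₂ (proj₂ inverse-n))) (*-identityʳ (sum y))))) (-‿inverseʳ (sum y))))))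

  centre-difference : ∀ y a b → coord (centre y) a - coord (centre y) b ≈ y a - y b
  centre-difference y a b = ring-solve 3 (λ x y r → (x :+ (:- r) :* :1) :- (y :+ (:- r) :* :1) := x :- y) refl (y a)
      (y b) (mean y)

  uniform-bound : ∀ {d} (x : Vector Carrier d) → ∃ λ c → c >0 × (∀ l → x l < c × - x l < c)
  uniform-bound {zero}  x = 1# , 1>0 , λ ()
  uniform-bound {suc d} x = let (c , c>0 , x<c , -x<c) = absolute-bound (x zero) ; (c′ , c′>0 , tail<) = uniform-bound (x ∘ suc) in
    c + c′ , (c>0 +ₚ c′>0) , λ { zero    → <-+ʳ x<c c′>0 , <-+ʳ -x<c c′>0
                             ; (suc l) → <-+ˡ c>0 (proj₁ (tail< l)) , <-+ˡ c>0 (proj₂ (tail< l)) }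
    where
    <-+ʳ : ∀ {x y z} → x < y → z >0 → x < y + z
    <-+ʳ {x} {y} {z} p q = >0⇒< (<⇒>0 p +ₚ q) (ring-solve 3 (λ x y z → y :+ z :- x := (y :- x) :+ z) refl x y z)
    <-+ˡ : ∀ {x y z} → z >0 → x < y → x < z + y
    <-+ˡ {x} {y} {z} q p = >0⇒< (<⇒>0 p +ₚ q) (ring-solve 3 (λ x y z → z :+ y :- x := (y :- x) :+ z) refl x y z)

  opaque
    near-shift : ∀ {r} (b : V) → r >0 → ∃ λ ρ → ρ >0 × (∀ v {t s} → Within ρ t s → Near r (shift v t b) (shift v s b))
    near-shift {r} b r>0 = let (c , c>0 , b<c) = uniform-bound (coord b) ; (c⁻¹ , c⁻¹>0 , e) = inverse c>0 in
      r * c⁻¹ , r>0 *ₚ c⁻¹>0 , near c c⁻¹ b<c e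
      where
      near : ∀ c c⁻¹ → (∀ l → coord b l < c × - coord b l < c) → c * c⁻¹ ≈ 1# → ∀ v {t s} → Within
          (r * c⁻¹) t s → Near r (shift v t b) (shift v s b)
      near c c⁻¹ b<c e v {t} {s} (t<s , s<t) l =
        >0⇒< (product-bound d<ρ -d<ρ (proj₁ (b<c l)) (proj₂ (b<c l))) (trans (ring-solve 5
            (λ x t s y r → x :+ s :* y :+ r :- (x :+ t :* y) := r :+ (s :- t) :* y) refl (coord v l) t s (coord b l) r)
                (+-congʳ (sym ρc≈r))) ,
        >0⇒< (product-bound -d<ρ d<ρ′ (proj₁ (b<c l)) (proj₂ (b<c l))) (trans (ring-solve 5
            (λ x t s y r → x :+ t :* y :+ r :- (x :+ s :* y) := r :+ (:- (s :- t)) :* y) refl (coord v l) t s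
                (coord b l) r) (+-congʳ (sym ρc≈r)))
        where
        ρ : Carrier
        ρ = r * c⁻¹
        ρc≈r : ρ * c ≈ r
        ρc≈r = trans (*-assoc r c⁻¹ c) (trans (*-congˡ (trans (*-comm c⁻¹ c) e)) (*-identityʳ r))
        d<ρ : s - t < ρ
        d<ρ = >0⇒< (<⇒>0 s<t) (ring-solve 3 (λ s t r → r :- (s :- t) := t :+ r :- s) refl s t ρ)
        -d<ρ : - (s - t) < ρ
        -d<ρ = >0⇒< (<⇒>0 t<s) (ring-solve 3 (λ s t r → r :- (:- (s :- t)) := s :+ r :- t) refl s t ρ)
        d<ρ′ : - - (s - t) < ρ
        d<ρ′ = >0⇒< (<⇒>0 s<t) (ring-solve 3 (λ s t r → r :- (:- (:- (s :- t))) := t :+ r :- s) refl s t ρ)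

  above-open : ∀ h → IsOpen (Above h)
  above-open h@(H (root i j _) k _) v a = ½ * gap h v , ½>0 *ₚ above⇒ h v a , λ w near → above⇐ h w (>0-cong
    (trans (ring-solve 5 (λ x y x′ y′ r → (x′ :+ r :- x) :+ (y :+ r :- y′) := x′ :- y′ :- (x :- y) :+ (r :+ r)) refl
        (coord v (inject₁ i)) (coord v (suc j)) (coord w (inject₁ i)) (coord w (suc j)) (½ * gap h v))
      (trans (+-congˡ (halves (gap h v))) (ring-solve 5 (λ x y x′ y′ k → x′ :- y′ :- (x :- y) :+
          (x :- y :- k) := x′ :- y′ :- k) refl
        (coord v (inject₁ i)) (coord v (suc j)) (coord w (inject₁ i)) (coord w (suc j)) (k · 1#))))
    (<⇒>0 (proj₁ (near (inject₁ i))) +ₚ <⇒>0 (proj₂ (near (suc j)))))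

  below-open : ∀ h → IsOpen (Below h)
  below-open h@(H (root i j _) k _) v b = ½ * (- gap h v) , ½>0 *ₚ below⇒ h v b , λ w near → below⇐ h w (>0-cong
    (trans (ring-solve 5 (λ x y x′ y′ r → (x :+ r :- x′) :+ (y′ :+ r :- y) := (x :- y) :- (x′ :- y′) :+ (r :+ r)) refl
        (coord v (inject₁ i)) (coord v (suc j)) (coord w (inject₁ i)) (coord w (suc j)) (½ * (- gap h v)))
      (trans (+-congˡ (halves (- gap h v))) (ring-solve 5 (λ x y x′ y′ k → (x :- y) :- (x′ :- y′) :+ (:-
          (x :- y :- k)) := :- (x′ :- y′ :- k)) refl
        (coord v (inject₁ i)) (coord v (suc j)) (coord w (inject₁ i)) (coord w (suc j)) (k · 1#))))
    (<⇒>0 (proj₂ (near (inject₁ i))) +ₚ <⇒>0 (proj₁ (near (suc j)))))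

  -- Coordinatewise equal points are within every distance of each other, so an open set respects
  -- this equality. The ends of `line` agree with the given points only in this sense.
  open-resp : ∀ {U : Pred V 0ℓ} → IsOpen U → ∀ {v w} → (∀ l → coord v l ≈ coord w l) → U v → U w
  open-resp U-open {v} {w} eq Uv = let (r , r>0 , near) = U-open v Uv in near w λ l →
    >0⇒< r>0 (trans (+-congˡ (-‿cong (eq l))) (ring-solve 2 (λ x r → x :+ r :- x := r) refl (coord w l) r)) ,
    >0⇒< r>0 (trans (+-congʳ (+-congʳ (eq l))) (ring-solve 2 (λ x r → x :+ r :- x := r) refl (coord w l) r))

  SameSide : V → Pred V 0ℓ
  SameSide v w = ∀ h → (Above h v → Above h w) × (Below h v → Below h w)

  -- `Above h` and `Below h` are disjoint open sets covering the complement, so a connected subset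
  -- of it cannot meet both.
  component⇒same-side : ∀ v w → SameComponent v w → SameSide v w
  component⇒same-side v w (S , S⊆ , connected , Sv , Sw) h = from-above , from-below
    where
    clash : Satisfiable (S ∩ Above h) → Satisfiable (S ∩ Below h) → ⊥
    clash a b = let (z , _ , a , b) = connected (Above h) (Below h) (above-open h) (below-open h) (λ {z} s → side z (S⊆ s) h) a b in
      ¬above∧below h z a b
    from-above : Above h v → Above h w
    from-above a = [ (λ a → a) , (λ b → ⊥-elim (clash (v , Sv , a) (w , Sw , b))) ]′ (side w (S⊆ Sw) h)
    from-below : Below h v → Below h w
    from-below b = [ (λ a → ⊥-elim (clash (w , Sw , a) (v , Sv , b))) , (λ b → b) ]′ (side w (S⊆ Sw) h)

  side-transport : ∀ v w → SameSide v w → ∀ h → Side h v → Side h w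
  side-transport v w same h (inj₁ a) = inj₁ (proj₁ (same h) a)
  side-transport v w same h (inj₂ b) = inj₂ (proj₂ (same h) b)

  -- The sign is chosen so that `v` itself is positive. The cell of `v` is then given by positivity
  -- of functions affine along segments, the form that `Bisection` takes.
  signed : ∀ h v → Side h v → Carrier → Carrier
  signed h v (inj₁ _) g = g
  signed h v (inj₂ _) g = - g

  signed⇒ : ∀ h v w (s : Side h v) → SameSide v w → signed h v s (gap h w) >0
  signed⇒ h v w (inj₁ a) same = above⇒ h w (proj₁ (same h) a)
  signed⇒ h v w (inj₂ b) same = below⇒ h w (proj₂ (same h) b)

  signed⇐ : ∀ h v w (s : Side h v) → signed h v s (gap h w) >0 → (Above h v → Above h w) × (Below h v → Below h w)
  signed⇐ h v w (inj₁ a) g = (λ _ → above⇐ h w g) , λ b → ⊥-elim (¬above∧below h v a b)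
  signed⇐ h v w (inj₂ b) g = (λ a → ⊥-elim (¬above∧below h v a b)) , λ _ → below⇐ h w g

  signed-affine : ∀ h v (s : Side h v) a b t {c} → c ≈ a + t * (b - a) →
    signed h v s c ≈ signed h v s a + t * (signed h v s b - signed h v s a)
  signed-affine h v (inj₁ _) a b t e = e
  signed-affine h v (inj₂ _) a b t e = trans (-‿cong e) (ring-solve 3 (λ a b t → :- (a :+ t :* (b :- a)) := :- a :+ t :*
      (:- b :- :- a)) refl a b t)

  telescope : ∀ a b → b >0 → a + (b - a) >0
  telescope a b = >0-cong (ring-solve 2 (λ a b → b := a :+ (b :- a)) refl a b)

  line-0 : ∀ x y → x ≈ x + 0# * (y + (- 1#) * x)
  line-0 = ring-solve 2 (λ x y → x := x :+ :0 :* (y :+ (:- :1) :* x)) refl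

  line-1 : ∀ x y → y ≈ x + 1# * (y + (- 1#) * x)
  line-1 = ring-solve 2 (λ x y → y := x :+ :1 :* (y :+ (:- :1) :* x)) refl

  line-open : ∀ p q {X : Pred V 0ℓ} → IsOpen X → ∀ t → X (line p q t) → ∃ λ ρ → ρ >0 × (∀ s → Within ρ t s → X (line p q s))
  line-open p q X-open t Xt = let (r , r>0 , near) = X-open (line p q t) Xt ; (ρ , ρ>0 , near′) = near-shift (q ⊖ p) r>0 in
    ρ , ρ>0 , λ s within → near (line p q s) (near′ p within)

  module _ {v : V} (c : Complement v) where

    module Segment (p q : V) (Sp : SameSide v p) (Sq : SameSide v q) where

      A B : CatHyperplane n m → Carrier
      A h = signed h v (side v c h) (gap h p)
      B h = signed h v (side v c h) (gap h q) - A h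

      A>0 : ∀ h → A h >0
      A>0 h = signed⇒ h v p (side v c h) Sp

      A+B>0 : ∀ h → A h + B h >0
      A+B>0 h = telescope (A h) (signed h v (side v c h) (gap h q)) (signed⇒ h v q (side v c h) Sq)

      on-side : ∀ t → (∀ h → A h + t * B h >0) → SameSide v (line p q t)
      on-side t L>0 h = signed⇐ h v (line p q t) (side v c h)
        (>0-cong (sym (signed-affine h v (side v c h) (gap h p) (gap h q) t (gap-line h p q t))) (L>0 h))

    -- The cell is convex: on the segment from a point of U to a point of W the two sets pull back
    -- to open sets of parameters, and bisection finds a common one without leaving the cell.
    sameSide-connected : IsConnected (SameSide v)
    sameSide-connected U W U-open W-open cover (p , Sp , Up) (q , Sq , Wq) = finish
      (Bisection.meet A B A>0 A+B>0 (U ∘ line p q) (W ∘ line p q) (line-open p q U-open) (line-open p q W-open)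
        (λ t L>0 → cover {line p q t} (on-side t L>0))
        (open-resp U-open (λ l → line-0 (coord p l) (coord q l)) Up) (open-resp W-open (λ l → line-1 (coord p l) (coord q l)) Wq))
      where
      open Segment p q Sp Sq
      finish : (∃ λ t → (∀ h → A h + t * B h >0) × U (line p q t) × W (line p q t)) → Satisfiable (SameSide v ∩ (U ∩ W))
      finish (t , L>0 , Ut , Wt) = line p q t , on-side t L>0 , Ut , Wt

    same-side⇒component : ∀ w → SameSide v w → SameComponent v w
    same-side⇒component w same = SameSide v , (λ {z} → inComplement {z}) , sameSide-connected , (λ h → (λ a → a) , λ b → b) , same
      where
      inComplement : SameSide v ⊆ Complement
      inComplement {z} same = side⇒complement z (λ h → side-transport v z same h (side v c h))

-- H_{α_i,m} is a wall of every dominant region above it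

module Walls (ℝ : RealNumbers) (n m : ℕ) where

  open OrderedField ℝ hiding (setoid)
  open Arrangement ℝ n m
  open Geometry ℝ n m

  Decreasing : V → Set
  Decreasing x = ∀ p q → toℕ p ℕ.< toℕ q → coord x p - coord x q >0

  ·-mono-≤ : ∀ {k l} → k ℕ.≤ l → k ≡ l ⊎ k · 1# < l · 1#
  ·-mono-≤ h = [ inj₂ ∘ ·-mono-< , inj₁ ]′ (ℕ.m≤n⇒m<n∨m≡n h)

  Down : (Carrier → Set) → Set
  Down Q = ∀ {s t} → s < t → Q t → Q s

  -- Together with `Down` this expresses "for all sufficiently small τ", so finitely many such
  -- properties can be met by one τ.
  Small : (Carrier → Set) → Set
  Small Q = ∃ λ τ → τ >0 × Q τ

  small-∧ : ∀ {P Q : Carrier → Set} → Down P → Down Q → Small P → Small Q → Small (λ τ → P τ × Q τ)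
  small-∧ dP dQ (s , s>0 , Ps) (t , t>0 , Qt) = let (μ , μ>0 , μ<s , μ<t) = common-lower-bound s>0 t>0 in μ , μ>0 , dP μ<s Ps , dQ μ<t Qt

  small-Fin : ∀ {d} (Q : Fin d → Carrier → Set) → (∀ i → Down (Q i)) → (∀ i → Small (Q i)) → Small (λ τ → ∀ i → Q i τ)
  small-Fin {zero}  Q down small = 1# , 1>0 , λ ()
  small-Fin {suc d} Q down small =
    let (τ , τ>0 , Q0 , Qs) = small-∧ (down zero) (λ s<t Q i → down (suc i) s<t (Q i)) (small zero) (small-Fin (Q ∘ suc) (down ∘ suc) (small ∘ suc))
    in τ , τ>0 , λ { zero → Q0 ; (suc i) → Qs i }

  small-≤ : ∀ k (Q : ∀ j → j ℕ.≤ k → Carrier → Set) → (∀ j h → Down (Q j h)) → (∀ j h → Small (Q j h)) → Small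
      (λ τ → ∀ j h → Q j h τ)
  small-≤ k Q down small = let (τ , τ>0 , all) = small-Fin {suc k} (λ j → Q (toℕ j) (Fin.toℕ≤pred[n] j)) (λ j → down _ _) (λ j → small _ _) in
    τ , τ>0 , λ j h → at (Fin.toℕ-fromℕ< (ℕ.s≤s h)) (all (fromℕ< (ℕ.s≤s h)))
    where
    at : ∀ {j j′ τ} {h : j ℕ.≤ k} {h′ : j′ ℕ.≤ k} → j′ ≡ j → Q j′ h′ τ → Q j h τ
    at {h = h} {h′} ≡.refl q rewrite ℕ.≤-irrelevant h h′ = q

  small-hyperplanes : (Q : CatHyperplane n m → Carrier → Set) → (∀ h → Down (Q h)) → (∀ h → Small (Q h)) → Small
      (λ τ → ∀ h → Q h τ)
  small-hyperplanes Q down small =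
    let (τ , τ>0 , all) = small-Fin Q₁ down₁ (λ i → small-Fin (Q₂ i) (down₂ i) (small₂ i))
    in τ , τ>0 , λ { (H (root i j i≤j) k k≤m) → all i j i≤j k k≤m }
    where
    Q₃ : ∀ i j → i Fin.≤ j → Carrier → Set
    Q₃ i j i≤j τ = ∀ k k≤m → Q (H (root i j i≤j) k k≤m) τ
    down₃ : ∀ i j i≤j → Down (Q₃ i j i≤j)
    down₃ i j i≤j s<t q k k≤m = down _ s<t (q k k≤m)
    Q₂ : ∀ i j → Carrier → Set
    Q₂ i j τ = ∀ i≤j → Q₃ i j i≤j τ
    down₂ : ∀ i j → Down (Q₂ i j)
    down₂ i j s<t q i≤j = down₃ i j i≤j s<t (q i≤j)
    Q₁ : ∀ i → Carrier → Set
    Q₁ i τ = ∀ j → Q₂ i j τ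
    down₁ : ∀ i → Down (Q₁ i)
    down₁ i s<t q j = down₂ i j s<t (q j)
    small₂ : ∀ i j → Small (Q₂ i j)
    small₂ i j with i Fin.≤? j
    ... | no i≰j = 1# , 1>0 , λ i≤j → contradiction i≤j i≰j
    ... | yes i≤j = let (τ , τ>0 , q) = small-≤ m (λ k k≤m → Q (H (root i j i≤j) k k≤m)) (λ k h → down _) (λ k h → small _) in
      τ , τ>0 , λ i≤j′ → ≡.subst (λ p → Q₃ i j p τ) (Fin.≤-irrelevant i≤j i≤j′) q

  module Wall (i : Fin n) {x : V} (c : Complement x) (decreasing : Decreasing x) (above : gap (H (simple i) m ℕ.≤-refl) x >0) where

    h₀ : CatHyperplane n m
    h₀ = H (simple i) m ℕ.≤-refl

    indicator : Vector Carrier (suc n)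
    indicator l = if does (toℕ l ℕ.≤? toℕ i) then 1# else 0#

    indicator-≤ : ∀ l → toℕ l ℕ.≤ toℕ i → indicator l ≡ 1#
    indicator-≤ l h with toℕ l ℕ.≤ᵇ toℕ i | ℕ.≤⇒≤ᵇ h
    ... | true | _ = ≡.refl

    indicator-> : ∀ l → toℕ i ℕ.< toℕ l → indicator l ≡ 0#
    indicator-> l h with toℕ l ℕ.≤ᵇ toℕ i | ℕ.≤ᵇ⇒≤ (toℕ l) (toℕ i)
    ... | false | _ = ≡.refl
    ... | true  | f = contradiction (f _) (ℕ.<⇒≱ h)

    -- The fundamental coweight of α_i: it pairs to 1 with the roots in which α_i occurs and to 0
    -- with the others.
    e : V
    e = centre indicator

    Straddles : PositiveRoot n → Set
    Straddles (root a b _) = a Fin.≤ i × i Fin.≤ b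

    diff-e-1 : ∀ α → Straddles α → diff e α ≈ 1#
    diff-e-1 (root a b _) (a≤i , i≤b) = trans (centre-difference indicator (inject₁ a) (suc b)) (trans
      (+-cong (reflexive (indicator-≤ (inject₁ a) (≡.subst (ℕ._≤ toℕ i) (≡.sym (Fin.toℕ-inject₁ a)) a≤i)))
              (-‿cong (reflexive (indicator-> (suc b) (ℕ.s≤s i≤b)))))
      (ring-solve 0 (:1 :- :0 := :1) refl))

    diff-e-0 : ∀ α → ¬ Straddles α → diff e α ≈ 0#
    diff-e-0 (root a b a≤b) ¬s with a Fin.≤? i | i Fin.≤? b
    ... | yes p | yes q = contradiction (p , q) ¬s
    ... | no ¬p | _     = trans (centre-difference indicator (inject₁ a) (suc b)) (trans
      (+-cong (reflexive (indicator-> (inject₁ a) (≡.subst (toℕ i ℕ.<_) (≡.sym (Fin.toℕ-inject₁ a)) (ℕ.≰⇒> ¬p))))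
              (-‿cong (reflexive (indicator-> (suc b) (ℕ.m≤n⇒m≤1+n (ℕ.≤-trans (ℕ.≰⇒> ¬p) a≤b))))))
      (-‿inverseʳ 0#))
    ... | yes _ | no ¬q = trans (centre-difference indicator (inject₁ a) (suc b)) (trans
      (+-cong (reflexive (indicator-≤ (inject₁ a) (≡.subst (ℕ._≤ toℕ i) (≡.sym (Fin.toℕ-inject₁ a)) (ℕ.≤-trans a≤b
          (ℕ.<⇒≤ (ℕ.≰⇒> ¬q))))))
              (-‿cong (reflexive (indicator-≤ (suc b) (ℕ.≰⇒> ¬q)))))
      (-‿inverseʳ 1#))

    straddles? : ∀ α → Straddles α ⊎ ¬ Straddles α
    straddles? (root a b _) with a Fin.≤? i | i Fin.≤? b
    ... | yes p | yes q = inj₁ (p , q)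
    ... | no ¬p | _     = inj₂ (¬p ∘ proj₁)
    ... | _     | no ¬q = inj₂ (¬q ∘ proj₂)

    Central : PositiveRoot n → Set
    Central (root a b _) = a ≡ i × b ≡ i

    excess : ∀ α → Straddles α → Central α ⊎ diff x α - diff x (simple i) >0
    excess (root a b _) (a≤i , i≤b) with ℕ.m≤n⇒m<n∨m≡n a≤i | ℕ.m≤n⇒m<n∨m≡n i≤b
    ... | inj₂ a≡i | inj₂ i≡b = inj₁ (Fin.toℕ-injective a≡i , ≡.sym (Fin.toℕ-injective i≡b))
    ... | inj₁ a<i | inj₂ i≡b with Fin.toℕ-injective i≡b
    ...   | ≡.refl = inj₂ (>0-cong (ring-solve 3 (λ A B C → A :- B := (A :- C) :- (B :- C)) refl _ _ _)
      (decreasing (inject₁ a) (inject₁ i) (≡.subst₂ ℕ._<_ (≡.sym (Fin.toℕ-inject₁ a)) (≡.sym (Fin.toℕ-inject₁ i)) a<i)))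
    excess (root a b _) (a≤i , i≤b) | inj₂ a≡i | inj₁ i<b with Fin.toℕ-injective a≡i
    ...   | ≡.refl = inj₂ (>0-cong (ring-solve 3 (λ A B C → B :- C := (A :- C) :- (A :- B)) refl _ _ _) (decreasing
        (suc i) (suc b) (ℕ.s≤s i<b)))
    excess (root a b _) (a≤i , i≤b) | inj₁ a<i | inj₁ i<b = inj₂ (>0-cong
      (ring-solve 4 (λ A B C D → (A :- B) :+ (C :- D) := (A :- D) :- (B :- C)) refl _ _ _ _)
      (decreasing (inject₁ a) (inject₁ i) (≡.subst₂ ℕ._<_ (≡.sym (Fin.toℕ-inject₁ a)) (≡.sym (Fin.toℕ-inject₁ i)) a<i)
        +ₚ decreasing (suc i) (suc b) (ℕ.s≤s i<b)))

    IsH₀ : CatHyperplane n m → Set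
    IsH₀ (H α k _) = Central α × k ≡ m

    isH₀? : ∀ h → IsH₀ h ⊎ ¬ IsH₀ h
    isH₀? (H (root a b _) k _) with a Fin.≟ i | b Fin.≟ i | k ℕ.≟ m
    ... | yes p | yes q | yes r = inj₁ ((p , q) , r)
    ... | no ¬p | _     | _     = inj₂ (¬p ∘ proj₁ ∘ proj₁)
    ... | _     | no ¬q | _     = inj₂ (¬q ∘ proj₂ ∘ proj₁)
    ... | _     | _     | no ¬r = inj₂ (¬r ∘ proj₂)

    -- Among the hyperplanes approached when moving along -e, h₀ is met first: ⟨x , α⟩ is at least
    -- ⟨x , α_i⟩ by dominance and k is at most m, with at least one of the two strict.
    straddle-gap : ∀ h → Straddles (CatHyperplane.α h) → ¬ IsH₀ h → gap h x - gap h₀ x >0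
    straddle-gap (H α@(root a b a≤b) k k≤m) s ¬h₀ = [ central , exceeding ]′ (excess α s)
      where
      central : Central α → gap (H α k k≤m) x - gap h₀ x >0
      central (≡.refl , ≡.refl) = [ (λ k≡m → contradiction ((≡.refl , ≡.refl) , k≡m) ¬h₀)
        , (λ k<m → >0-cong (ring-solve 3 (λ d k m → m :- k := (d :- k) :- (d :- m)) refl (diff x α) (k · 1#) (m · 1#))
            (<⇒>0 k<m)) ]′ (·-mono-≤ k≤m)
      exceeding : diff x α - diff x (simple i) >0 → gap (H α k k≤m) x - gap h₀ x >0
      exceeding d>0 = [ (λ { ≡.refl → >0-cong (ring-solve 3 (λ d s m → d :- s := (d :- m) :- (s :- m)) refl (diff x α)
          (diff x (simple i)) (m · 1#)) d>0 })
        , (λ k<m → >0-cong (ring-solve 4 (λ d s k m → (d :- s) :+ (m :- k) := (d :- k) :- (s :- m)) refl (diff x α)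
            (diff x (simple i)) (k · 1#) (m · 1#))
            (d>0 +ₚ <⇒>0 k<m)) ]′ (·-mono-≤ k≤m)

    straddle-above : ∀ h → Straddles (CatHyperplane.α h) → ¬ IsH₀ h → gap h x >0
    straddle-above h s ¬h₀ = >0-cong (ring-solve 2 (λ g g₀ → (g :- g₀) :+ g₀ := g) refl (gap h x) (gap h₀ x))
        (straddle-gap h s ¬h₀ +ₚ above)

    Good : CatHyperplane n m → V → Set
    Good h v = signed h x (side x c h) (gap h v) >0

    good-above : ∀ h v → gap h x >0 → gap h v >0 → Good h v
    good-above h v gx gv = go (side x c h)
      where
      go : (s : Side h x) → signed h x s (gap h v) >0
      go (inj₁ _) = gv
      go (inj₂ b) = ⊥-elim (¬above∧below h x (above⇐ h x gx) b)

    good-≈ : ∀ h v w → gap h w ≈ gap h v → Good h v → Good h w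
    good-≈ h v w e = go (side x c h)
      where
      go : (s : Side h x) → signed h x s (gap h v) >0 → signed h x s (gap h w) >0
      go (inj₁ _) = >0-cong (sym e)
      go (inj₂ _) = >0-cong (-‿cong (sym e))

    gap-shift-0 : ∀ h v τ → ¬ Straddles (CatHyperplane.α h) → gap h (shift v τ e) ≈ gap h v
    gap-shift-0 (H α k _) v τ ¬s = trans (+-congʳ (trans (diff-shift v τ e α) (+-congˡ (*-congˡ (diff-e-0 α ¬s)))))
      (ring-solve 3 (λ d t k → d :+ t :* :0 :- k := d :- k) refl (diff v α) τ (k · 1#))

    gap-shift-1 : ∀ h v τ → Straddles (CatHyperplane.α h) → gap h (shift v τ e) ≈ gap h v + τ
    gap-shift-1 (H α k _) v τ s = trans (+-congʳ (trans (diff-shift v τ e α) (+-congˡ (*-congˡ (diff-e-1 α s)))))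
      (ring-solve 3 (λ d t k → d :+ t :* :1 :- k := d :- k :+ t) refl (diff v α) τ (k · 1#))

    -- The relative interior of the facet of the region of `x` on h₀.
    record Face (v : V) : Set where
      field
        on-h₀ : gap h₀ v ≈ 0#
        good  : ∀ h → ¬ IsH₀ h → Good h v

    simple-straddles : Straddles (simple i)
    simple-straddles = ℕ.≤-refl , ℕ.≤-refl

    face-shift : ∀ v τ → Face v → τ >0 → SameSide x (shift v τ e)
    face-shift v τ F τ>0 h = signed⇐ h x (shift v τ e) (side x c h) ([ at-h₀ h , off-h₀ h ]′ (isH₀? h))
      where
      at-h₀ : ∀ h → IsH₀ h → Good h (shift v τ e)
      at-h₀ h@(H (root _ _ _) _ _) ((≡.refl , ≡.refl) , ≡.refl) = good-above h (shift v τ e) above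
        (>0-cong (sym (trans (gap-shift-1 h v τ simple-straddles) (trans (+-congʳ (Face.on-h₀ F)) (+-identityˡ τ)))) τ>0)
      off-h₀ : ∀ h → ¬ IsH₀ h → Good h (shift v τ e)
      off-h₀ h ¬h₀ = [ (λ s → straddling s (straddle-above h s ¬h₀)) , (λ ¬s → good-≈ h v (shift v τ e)
          (gap-shift-0 h v τ ¬s) (Face.good F h ¬h₀)) ]′ (straddles? (CatHyperplane.α h))
        where
        straddling : Straddles (CatHyperplane.α h) → gap h x >0 → Good h (shift v τ e)
        straddling s gx = good-above h (shift v τ e) gx (>0-cong (sym (gap-shift-1 h v τ s)) (gap-v (side x c h)
            (Face.good F h ¬h₀) +ₚ τ>0))
          where
          gap-v : (s : Side h x) → signed h x s (gap h v) >0 → gap h v >0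
          gap-v (inj₁ _) g = g
          gap-v (inj₂ b) _ = ⊥-elim (¬above∧below h x (above⇐ h x gx) b)

    foot : V
    foot = shift x (- gap h₀ x) e

    foot-face : Face foot
    foot-face = record
      { on-h₀ = trans (gap-shift-1 h₀ x (- gap h₀ x) simple-straddles) (-‿inverseʳ (gap h₀ x))
      ; good  = λ h ¬h₀ → [ (λ s → good-above h foot (straddle-above h s ¬h₀) (>0-cong (sym (gap-shift-1 h x
          (- gap h₀ x) s)) (straddle-gap h s ¬h₀)))
                          , (λ ¬s → good-≈ h x foot (gap-shift-0 h x (- gap h₀ x) ¬s) (signed⇒ h x x (side x c h) (λ h →
                              (λ a → a) , λ b → b))) ]′ (straddles? (CatHyperplane.α h))
      }

    R : Region
    R = region x c

    face⊆closure : ∀ v → Face v → Closure (R ∋_) v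
    face⊆closure v F r r>0 = let (ρ , ρ>0 , near) = near-shift e r>0 in
      shift v (½ * ρ) e , near-v (½ * ρ) (near v (within ρ ρ>0)) , same-side⇒component c (shift v (½ * ρ) e)
          (face-shift v (½ * ρ) F (½>0 *ₚ ρ>0))
      where
      within : ∀ ρ → ρ >0 → Within ρ 0# (½ * ρ)
      within ρ ρ>0 = >0⇒< (½>0 *ₚ ρ>0 +ₚ ρ>0) (ring-solve 2 (λ h r → h :+ r :- :0 := h :+ r) refl (½ * ρ) ρ)
        , >0⇒< (½>0 *ₚ ρ>0) (trans (+-congʳ (+-congˡ (sym (halves ρ)))) (ring-solve 1 (λ h → :0 :+
            (h :+ h) :- h := h) refl (½ * ρ)))
      near-v : ∀ τ → Near r (shift v 0# e) (shift v τ e) → Near r v (shift v τ e)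
      near-v τ near l = <-respˡ (v0 (coord v l) (coord e l)) (proj₁ (near l)) , <-respʳ (+-congʳ (v0 (coord v l)
          (coord e l))) (proj₂ (near l))
        where
        v0 : ∀ v e → v + 0# * e ≈ v
        v0 = ring-solve 2 (λ v e → v :+ :0 :* e := v) refl

    module _ (v : V) (on : gap h₀ v ≈ 0#) where

      q : Carrier → V
      q τ = line foot v τ

      -- Quantifying over all s below τ makes the property downward closed, as `small-hyperplanes`
      -- requires; for this reason τ is afterwards half of the bound found.
      Q : CatHyperplane n m → Carrier → Set
      Q h τ = ∀ s → s >0 → s < τ → ¬ IsH₀ h → Good h (q s)

      A B : CatHyperplane n m → Carrier
      A h = signed h x (side x c h) (gap h foot)
      B h = signed h x (side x c h) (gap h v) - A h

      good-q : ∀ h s → A h + s * B h >0 → Good h (q s)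
      good-q h s = >0-cong (sym (signed-affine h x (side x c h) (gap h foot) (gap h v) s (gap-line h foot v s)))

      stays-positive : ∀ {a b s C C⁻¹} → a >0 → s >0 → C >0 → C * C⁻¹ ≈ 1# → - b < C → s < a * C⁻¹ → a + s * b >0
      stays-positive {a} {b} {s} {C} {C⁻¹} a>0 s>0 C>0 e -b<C s< = >0-cong
        (trans (+-congʳ (trans (ring-solve 4 (λ a s C r → (a :* r :- s) :* C := a :* (C :* r) :- s :* C) refl a s C C⁻¹)
            (+-congʳ (trans (*-congˡ e) (*-identityʳ a)))))
          (ring-solve 4 (λ a s C b → (a :- s :* C) :+ s :* (C :- (:- b)) := a :+ s :* b) refl a s C b))
        (<⇒>0 s< *ₚ C>0 +ₚ s>0 *ₚ <⇒>0 -b<C)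

      small-Q : ∀ h → Small (Q h)
      small-Q h = [ (λ is → 1# , 1>0 , λ _ _ _ ¬is → contradiction is ¬is) , off ]′ (isH₀? h)
        where
        off : ¬ IsH₀ h → Small (Q h)
        off ¬h₀ = let (C , C>0 , _ , -B<C) = absolute-bound (B h) ; (C⁻¹ , C⁻¹>0 , e) = inverse C>0 in
          A h * C⁻¹ , Face.good foot-face h ¬h₀ *ₚ C⁻¹>0 ,
          λ s s>0 s< _ → good-q h s (stays-positive (Face.good foot-face h ¬h₀) s>0 C>0 e -B<C s<)

      opaque
        small-all : Small (λ τ → ∀ h → Q h τ)
        small-all = small-hyperplanes Q (λ h s<t Qt r r>0 r<s → Qt r r>0 (<-trans r<s s<t)) small-Q

      τ : Carrier
      τ = ½ * proj₁ small-all

      τ>0 : τ >0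
      τ>0 = ½>0 *ₚ proj₁ (proj₂ small-all)

      τ< : τ < proj₁ small-all
      τ< = >0⇒< τ>0 (trans (+-congʳ (sym (halves (proj₁ small-all)))) (ring-solve 1 (λ h → h :+ h :- h := h) refl τ))

      q-face : Face (q τ)
      q-face = record
        { on-h₀ = trans (gap-line h₀ foot v τ) (trans (+-cong (Face.on-h₀ foot-face) (*-congˡ (+-cong on (-‿cong
            (Face.on-h₀ foot-face)))))
            (ring-solve 1 (λ t → :0 :+ t :* (:0 :- :0) := :0) refl τ))
        ; good  = λ h ¬h₀ → proj₂ (proj₂ small-all) h τ τ>0 τ< ¬h₀
        }

      -- With σ = 1 / τ, v is the affine combination (1 - σ) foot + σ (q τ): the segment towards v
      -- is followed only as far as the facet reaches and then extrapolated.
      in-hull : AffineHull (Closure (R ∋_) ∩ On h₀) v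
      in-hull = let (σ , _ , τσ≈1) = inverse τ>0 in
        2 , (λ { zero → foot ; (suc zero) → q τ }) , (λ { zero → 1# - σ ; (suc zero) → σ })
        , (λ { zero → face⊆closure foot foot-face , on⇐ foot (Face.on-h₀ foot-face) ; (suc zero) → face⊆closure
            (q τ) q-face , on⇐ (q τ) (Face.on-h₀ q-face) })
        , ring-solve 1 (λ s → :1 :- s :+ (s :+ :0) := :1) refl σ
        , λ l → sym (trans (ring-solve 4 (λ p v t s → (:1 :- s) :* p :+ (s :* (p :+ t :* (v :+
            (:- :1) :* p)) :+ :0) := p :+ (t :* s) :* (v :- p)) refl (coord foot l) (coord v l) τ σ)
            (trans (+-congˡ (*-congʳ τσ≈1)) (ring-solve 2 (λ p v → p :+ :1 :* (v :- p) := v) refl (coord foot l) (coord v l))))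
        where
        on⇐ : ∀ w → gap h₀ w ≈ 0# → On h₀ w
        on⇐ w e = trans (inner≈diff w (simple i)) (trans (ring-solve 2 (λ d m → d := (d :- m) :+ m) refl (diff w
            (simple i)) (m · 1#)) (trans (+-congʳ e) (+-identityˡ (m · 1#))))

    isWall : IsWall R h₀
    isWall {v} on = in-hull v (trans (+-congʳ (trans (sym (inner≈diff v (simple i))) on)) (-‿inverseʳ (m · 1#)))

-- Dominant regions, their shapes and the bijection

module Correspondence (ℝ : RealNumbers) (n m : ℕ) .{{nonZero : NonZero m}} where

  open OrderedField ℝ hiding (setoid)
  open Arrangement ℝ n m
  open Geometry ℝ n m
  open Walls ℝ n m
  open Patterns n m
  open Dissections n m using (code; code-mono; code-bound; code-cong; code-injective; containsNegativeSimple; module Decode)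

  -- Truncating at n makes the coordinates a total function on ℕ, the index type of patterns.
  clamp : ℕ → Fin (suc n)
  clamp i = fromℕ< (ℕ.s≤s (ℕ.m⊓n≤n i n))

  toℕ-clamp : ∀ {i} → i ℕ.≤ n → toℕ (clamp i) ≡ i
  toℕ-clamp {i} i≤n = ≡.trans (Fin.toℕ-fromℕ< (ℕ.s≤s (ℕ.m⊓n≤n i n))) (ℕ.m≤n⇒m⊓n≡m i≤n)

  clamp-≡ : ∀ {i} {p : Fin (suc n)} → toℕ p ≡ i → clamp i ≡ p
  clamp-≡ {p = p} ≡.refl = Fin.toℕ-injective (toℕ-clamp (Fin.toℕ≤pred[n] p))

  X : V → ℕ → Carrier
  X x i = coord x (clamp i)

  gapAt : V → ℕ → ℕ → ℕ → Carrier
  gapAt x i j k = X x i - X x j - k · 1#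

  Valid : ℕ → ℕ → ℕ → Set
  Valid i j k = i ℕ.< j × j ℕ.≤ n × k ℕ.≤ m

  valid? : ∀ i j k → Dec (Valid i j k)
  valid? i j k = i ℕ.<? j ×-dec j ℕ.≤? n ×-dec k ℕ.≤? m

  hyperplane : ∀ {i j k} → Valid i j k → CatHyperplane n m
  hyperplane {i} {suc j} {k} (i<j , j<n , k≤m) = H (root (fromℕ< (ℕ.≤-trans i<j j<n)) (fromℕ< j<n)
    (≡.subst₂ ℕ._≤_ (≡.sym (Fin.toℕ-fromℕ< (ℕ.≤-trans i<j j<n))) (≡.sym (Fin.toℕ-fromℕ< j<n)) (ℕ.s≤s⁻¹ i<j))) k k≤m

  gap-hyperplane : ∀ {i j k} (v : Valid i j k) x → gap (hyperplane v) x ≡ gapAt x i j k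
  gap-hyperplane {i} {suc j} {k} (i<j , j<n , k≤m) x = ≡.cong₂ (λ p q → coord x p - coord x q - k · 1#)
    (≡.sym (clamp-≡ (≡.trans (Fin.toℕ-inject₁ _) (Fin.toℕ-fromℕ< (ℕ.≤-trans i<j j<n))))) (≡.sym (clamp-≡ (≡.cong suc
        (Fin.toℕ-fromℕ< j<n))))

  valid : ∀ (a b : Fin n) → a Fin.≤ b → ∀ k → k ℕ.≤ m → Valid (toℕ a) (suc (toℕ b)) k
  valid a b a≤b k k≤m = ℕ.s≤s a≤b , Fin.toℕ<n b , k≤m

  gap-position : ∀ a b a≤b k k≤m x → gap (H (root a b a≤b) k k≤m) x ≡ gapAt x (toℕ a) (suc (toℕ b)) k
  gap-position a b a≤b k k≤m x = ≡.cong₂ (λ p q → coord x p - coord x q - k · 1#) (≡.sym (clamp-≡ (Fin.toℕ-inject₁ a)))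
      (≡.sym (clamp-≡ ≡.refl))

  ·-+ : ∀ k l → (k ℕ.+ l) · 1# ≈ k · 1# + l · 1#
  ·-+ = Mult.×-homo-+ (CommutativeRing.semiring commutativeRing) 1#

  ·-* : ∀ k l → (k ℕ.* l) · 1# ≈ (k · 1#) * (l · 1#)
  ·-* = Mult.×1-homo-* (CommutativeRing.semiring commutativeRing)

  module PointPattern (x : V) (c : Complement x) where

    isAbove : ∀ h → Side h x → Bool
    isAbove h (inj₁ _) = true
    isAbove h (inj₂ _) = false

    decide : ∀ {i j k} → Dec (Valid i j k) → Bool
    decide (yes v) = isAbove (hyperplane v) (side x c (hyperplane v))
    decide (no _)  = false

    -- The value is read off the apartness evidence in `c`, as no decision procedure compares reals;
    -- `spec` ties it to the actual side.
    σ : ℕ → ℕ → ℕ → Bool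
    σ i j k = decide (valid? i j k)

    Spec : ℕ → ℕ → ℕ → Bool → Set
    Spec i j k b = (b ≡ true × gapAt x i j k >0) ⊎ (b ≡ false × - gapAt x i j k >0)

    spec : ∀ {i j k} → Valid i j k → Spec i j k (σ i j k)
    spec {i} {j} {k} v = go (valid? i j k)
      where
      at : ∀ (v : Valid i j k) (s : Side (hyperplane v) x) → Spec i j k (isAbove (hyperplane v) s)
      at v (inj₁ a) = inj₁ (≡.refl , ≡.subst _>0 (gap-hyperplane v x) (above⇒ (hyperplane v) x a))
      at v (inj₂ b) = inj₂ (≡.refl , ≡.subst (λ g → - g >0) (gap-hyperplane v x) (below⇒ (hyperplane v) x b))
      go : (d : Dec (Valid i j k)) → Spec i j k (decide d)
      go (yes v) = at v (side x c (hyperplane v))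
      go (no ¬v) = contradiction v ¬v

    ¬±>0 : ∀ {g} → g >0 → - g >0 → ⊥
    ¬±>0 {g} p q = <-asym p (>0⇒< q (+-identityˡ (- g)))

    true⇒ : ∀ {i j k} → Valid i j k → σ i j k ≡ true → gapAt x i j k >0
    true⇒ v e = [ proj₂ , (λ { (e′ , _) → contradiction (≡.trans (≡.sym e) e′) λ () }) ]′ (spec v)

    false⇒ : ∀ {i j k} → Valid i j k → σ i j k ≡ false → - gapAt x i j k >0
    false⇒ v e = [ (λ { (e′ , _) → contradiction (≡.trans (≡.sym e) e′) λ () }) , proj₂ ]′ (spec v)

    true⇐ : ∀ {i j k} → Valid i j k → gapAt x i j k >0 → σ i j k ≡ true
    true⇐ v g = [ proj₁ , (λ { (_ , g′) → ⊥-elim (¬±>0 g g′) }) ]′ (spec v)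

    false⇐ : ∀ {i j k} → Valid i j k → - gapAt x i j k >0 → σ i j k ≡ false
    false⇐ v g = [ (λ { (_ , g′) → ⊥-elim (¬±>0 g′ g) }) , proj₁ ]′ (spec v)

    isPattern : Decreasing x → IsPattern σ
    isPattern decreasing = record { σ-zero = zero′ ; σ-down = down ; σ-true = compose-true ; σ-false = compose-false }
      where
      split : ∀ i j l a b → gapAt x i j a + gapAt x j l b ≈ gapAt x i l (a ℕ.+ b)
      split i j l a b = trans (ring-solve 5 (λ A B C k l → (A :- B :- k) :+ (B :- C :- l) := A :- C :- (k :+ l)) refl
          (X x i) (X x j) (X x l) (a · 1#) (b · 1#))
        (+-congˡ (-‿cong (sym (·-+ a b))))
      zero′ : ∀ {i j} → i ℕ.< j → j ℕ.≤ n → σ i j 0 ≡ true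
      zero′ {i} {j} i<j j≤n = true⇐ (i<j , j≤n , ℕ.z≤n) (>0-cong (ring-solve 2 (λ A B → A :- B := A :- B :- :0) refl
          (X x i) (X x j))
        (decreasing (clamp i) (clamp j) (≡.subst₂ ℕ._<_ (≡.sym (toℕ-clamp (ℕ.≤-trans (ℕ.<⇒≤ i<j) j≤n))) (≡.sym
            (toℕ-clamp j≤n)) i<j)))
      down : ∀ {i j a b} → i ℕ.< j → j ℕ.≤ n → a ℕ.≤ b → b ℕ.≤ m → σ i j b ≡ true → σ i j a ≡ true
      down {i} {j} {a} {b} i<j j≤n a≤b b≤m e = [ (λ { ≡.refl → e }) , (λ a<b → true⇐ (i<j , j≤n , ℕ.≤-trans a≤b b≤m)
        (>0-cong (ring-solve 4 (λ A B k l → (A :- B :- l) :+ (l :- k) := A :- B :- k) refl (X x i) (X x j) (a · 1#) (b · 1#))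
          (true⇒ (i<j , j≤n , b≤m) e +ₚ <⇒>0 a<b))) ]′ (·-mono-≤ a≤b)
      compose-true : ∀ {i j l a b} → i ℕ.< j → j ℕ.< l → l ℕ.≤ n → a ℕ.+ b ℕ.≤ m → σ i j a ≡ true → σ j l b ≡ true → σ i l (a ℕ.+ b) ≡ true
      compose-true {i} {j} {l} {a} {b} i<j j<l l≤n a+b≤m e e′ = true⇐ (ℕ.<-trans i<j j<l , l≤n , a+b≤m) (>0-cong (split i j l a b)
        (true⇒ (i<j , ℕ.≤-trans (ℕ.<⇒≤ j<l) l≤n , ℕ.m+n≤o⇒m≤o a a+b≤m) e +ₚ true⇒ (j<l , l≤n , ℕ.m+n≤o⇒n≤o a a+b≤m) e′))
      compose-false : ∀ {i j l a b} → i ℕ.< j → j ℕ.< l → l ℕ.≤ n → a ℕ.+ b ℕ.≤ m → σ i j a ≡ false → σ j l b ≡ false → σ i l (a ℕ.+ b) ≡ false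
      compose-false {i} {j} {l} {a} {b} i<j j<l l≤n a+b≤m e e′ = false⇐ (ℕ.<-trans i<j j<l , l≤n , a+b≤m)
        (>0-cong (trans (ring-solve 2 (λ g h → :- g :+ :- h := :- (g :+ h)) refl (gapAt x i j a) (gapAt x j l b))
            (-‿cong (split i j l a b)))
        (false⇒ (i<j , ℕ.≤-trans (ℕ.<⇒≤ j<l) l≤n , ℕ.m+n≤o⇒m≤o a a+b≤m) e +ₚ false⇒ (j<l , l≤n , ℕ.m+n≤o⇒n≤o a a+b≤m) e′))

  open PointPattern using (σ; isPattern; true⇒; true⇐; false⇒; false⇐)

  module _ (x y : V) (c : Complement x) (d : Complement y) where

    same-pattern⇒same-side : (∀ {i j k} → Valid i j k → σ x c i j k ≡ σ y d i j k) → SameSide x y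
    same-pattern⇒same-side same h@(H (root a b a≤b) k k≤m) =
      (λ p → above⇐ h y (≡.subst _>0 (≡.sym (gap-position a b a≤b k k≤m y)) (true⇒ y d v (≡.trans (≡.sym (same v))
        (true⇐ x c v (≡.subst _>0 (gap-position a b a≤b k k≤m x) (above⇒ h x p))))))) ,
      (λ p → below⇐ h y (≡.subst (λ g → - g >0) (≡.sym (gap-position a b a≤b k k≤m y)) (false⇒ y d v (≡.trans (≡.sym (same v))
        (false⇐ x c v (≡.subst (λ g → - g >0) (gap-position a b a≤b k k≤m x) (below⇒ h x p)))))))
      where
      v : Valid (toℕ a) (suc (toℕ b)) k
      v = valid a b a≤b k k≤m

    same-side⇒same-pattern : SameSide x y → ∀ {i j k} → Valid i j k → σ x c i j k ≡ σ y d i j k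
    same-side⇒same-pattern same {i} {j} {k} v = go (side x c (hyperplane v))
      where
      go : Side (hyperplane v) x → σ x c i j k ≡ σ y d i j k
      go (inj₁ p) = ≡.trans (true⇐ x c v (≡.subst _>0 (gap-hyperplane v x) (above⇒ (hyperplane v) x p)))
        (≡.sym (true⇐ y d v (≡.subst _>0 (gap-hyperplane v y) (above⇒ (hyperplane v) y (proj₁ (same (hyperplane v)) p)))))
      go (inj₂ p) = ≡.trans (false⇐ x c v (≡.subst (λ g → - g >0) (gap-hyperplane v x) (below⇒ (hyperplane v) x p)))
        (≡.sym (false⇐ y d v (≡.subst (λ g → - g >0) (gap-hyperplane v y) (below⇒ (hyperplane v) y (proj₂ (same
            (hyperplane v)) p)))))

    same-pattern⇒same-shape : (∀ {i j k} → Valid i j k → σ x c i j k ≡ σ y d i j k) → ∀ j → j ℕ.≤ n → shape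
        (σ x c) j ≡ shape (σ y d) j
    same-pattern⇒same-shape same j j≤n = count-cong (sep? (σ x c) j) (sep? (σ y d) j) (m ℕ.* j)
      λ t t< → (λ e → ≡.trans (≡.sym (same (row t< , j≤n , column t))) e) , (λ e → ≡.trans (same (row t< , j≤n , column t)) e)

  -- Dominance merely excludes negative values. Strictness comes from the hyperplanes H_{α,0}, which
  -- belong to the arrangement and so are avoided by the point.
  dominant⇒decreasing : ((R , _) : DominantRegion) → Decreasing (Region.point R)
  dominant⇒decreasing (R@(region x c) , dominant) p q p<q = go (side x c (hyperplane v))
    where
    v : Valid (toℕ p) (toℕ q) 0
    v = p<q , Fin.toℕ≤pred[n] q , ℕ.z≤n
    gap≡ : gap (hyperplane v) x ≡ coord x p - coord x q - 0#
    gap≡ = ≡.trans (gap-hyperplane v x) (≡.cong₂ (λ a b → coord x a - coord x b - 0#) (clamp-≡ ≡.refl) (clamp-≡ ≡.refl))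
    ¬below : ∀ (h : CatHyperplane n m) → CatHyperplane.k h ≡ 0 → ¬ Below h x
    ¬below (H α _ _) ≡.refl = dominant {x} (Setoid.refl regionSetoid {R}) α
    k≡0 : ∀ {i j} (v : Valid i j 0) → CatHyperplane.k (hyperplane v) ≡ 0
    k≡0 {j = suc j} v = ≡.refl
    go : Side (hyperplane v) x → coord x p - coord x q >0
    go (inj₁ a) = >0-cong (ring-solve 2 (λ a b → a :- b :- :0 := a :- b) refl (coord x p) (coord x q)) (≡.subst _>0 gap≡
        (above⇒ (hyperplane v) x a))
    go (inj₂ b) = ⊥-elim (¬below (hyperplane v) (k≡0 v) b)

  shapeOf : DominantRegion → ℕ → ℕ
  shapeOf (region x c , _) = shape (σ x c)

  patternOf : (R : DominantRegion) → IsPattern (σ (Region.point (proj₁ R)) (Region.inComplement (proj₁ R)))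
  patternOf R@(region x c , _) = isPattern x c (dominant⇒decreasing R)

  same-shape⇒≈ : ∀ R R′ → (∀ j → j ℕ.≤ n → shapeOf R j ≡ shapeOf R′ j) → proj₁ R ≈ᴿ proj₁ R′
  same-shape⇒≈ R@(region x c , _) R′@(region y d , _) eq = same-side⇒component c y
    (same-pattern⇒same-side x y c d (λ { (i<j , j≤n , k≤m) → same-shape (patternOf R) (patternOf R′) eq i<j j≤n k≤m }))

  ≈⇒same-shape : ∀ R R′ → proj₁ R ≈ᴿ proj₁ R′ → ∀ j → j ℕ.≤ n → shapeOf R j ≡ shapeOf R′ j
  ≈⇒same-shape (region x c , _) (region y d , _) eq =
    same-pattern⇒same-shape x y c d (same-side⇒same-pattern x y c d (component⇒same-side x y eq))

  module Realisation (l : ℕ → ℕ) (l-mono : ∀ {j k} → j ℕ.≤ k → k ℕ.≤ n → l j ℕ.≤ l k) (l-bound : ∀ j → j ℕ.≤ n → l j ℕ.≤ m ℕ.* j) where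

    open IntegerPoints n m l l-mono l-bound

    U : ℕ
    U = proj₁ (points n ℕ.≤-refl)

    Y : ℕ → ℕ
    Y = proj₁ (proj₂ (points n ℕ.≤-refl))

    P : Points n U Y
    P = proj₂ (proj₂ (points n ℕ.≤-refl))

    open Points P

    U>0 : U · 1# >0
    U>0 = ·-mono-< unit

    u : Carrier
    u = proj₁ (inverse U>0)

    u>0 : u >0
    u>0 = proj₁ (proj₂ (inverse U>0))

    Uu≈1 : U · 1# * u ≈ 1#
    Uu≈1 = proj₂ (proj₂ (inverse U>0))

    -- Dividing by U makes U the unit of length, the sign turns increasing Y into decreasing
    -- coordinates, and `centre` moves the point into V without changing differences.
    x : V
    x = centre (λ l → - (Y (toℕ l) · 1#) * u)

    difference : ∀ p q → coord x p - coord x q ≈ (Y (toℕ q) · 1# - Y (toℕ p) · 1#) * u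
    difference p q = trans (centre-difference _ p q) (ring-solve 3 (λ a b u → :- a :* u :- :- b :* u :=
        (b :- a) :* u) refl (Y (toℕ p) · 1#) (Y (toℕ q) · 1#) u)

    gap≈ : ∀ {i j} k → i ℕ.≤ n → j ℕ.≤ n → gapAt x i j k ≈ (Y j · 1# - (Y i ℕ.+ k ℕ.* U) · 1#) * u
    gap≈ {i} {j} k i≤n j≤n = trans (+-cong (≡.subst₂ (λ p q → coord x (clamp i) - coord x (clamp j) ≈ (Y q · 1# - Y p · 1#) * u)
        (toℕ-clamp i≤n) (toℕ-clamp j≤n) (difference (clamp i) (clamp j))) (-‿cong (trans (sym (*-identityʳ (k · 1#)))
            (*-congˡ (sym Uu≈1)))))
      (trans (ring-solve 5 (λ y y′ k U u → (y :- y′) :* u :- k :* (U :* u) := (y :- (y′ :+ k :* U)) :* u) refl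
          (Y j · 1#) (Y i · 1#) (k · 1#) (U · 1#) u)
        (*-congʳ (+-congˡ (-‿cong (trans (+-congˡ (sym (·-* k U))) (sym (·-+ (Y i) (k ℕ.* U))))))))

    gap-pos : ∀ {i j} k → i ℕ.≤ n → j ℕ.≤ n → Y i ℕ.+ k ℕ.* U ℕ.< Y j → gapAt x i j k >0
    gap-pos k i≤n j≤n h = >0-cong (sym (gap≈ k i≤n j≤n)) (<⇒>0 (·-mono-< h) *ₚ u>0)

    gap-neg : ∀ {i j} k → i ℕ.≤ n → j ℕ.≤ n → Y j ℕ.< Y i ℕ.+ k ℕ.* U → - gapAt x i j k >0
    gap-neg {i} {j} k i≤n j≤n h = >0-cong (trans (ring-solve 3 (λ a b u → (b :- a) :* u := :- ((a :- b) :* u)) refl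
        (Y j · 1#) ((Y i ℕ.+ k ℕ.* U) · 1#) u)
      (-‿cong (sym (gap≈ k i≤n j≤n)))) (<⇒>0 (·-mono-< h) *ₚ u>0)

    gap-sign : ∀ {i j} k → i ℕ.< j → j ℕ.≤ n → gapAt x i j k >0 ⊎ - gapAt x i j k >0
    gap-sign {i} {j} k i<j j≤n with ℕ.<-cmp (Y i ℕ.+ k ℕ.* U) (Y j)
    ... | tri< h _ _ = inj₁ (gap-pos k (ℕ.≤-trans (ℕ.<⇒≤ i<j) j≤n) j≤n h)
    ... | tri≈ _ e _ = contradiction (≡.sym e) (generic i<j j≤n k)
    ... | tri> _ _ h = inj₂ (gap-neg k (ℕ.≤-trans (ℕ.<⇒≤ i<j) j≤n) j≤n h)

    inComplement : Complement x
    inComplement = side⇒complement x sides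
      where
      sides : ∀ h → Side h x
      sides h@(H (root a b a≤b) k k≤m) = [ (λ g → inj₁ (above⇐ h x (≡.subst _>0 (≡.sym (gap-position a b a≤b k k≤m x)) g)))
                                         , (λ g → inj₂ (below⇐ h x (≡.subst (λ g → - g >0) (≡.sym
                                             (gap-position a b a≤b k k≤m x)) g))) ]′
                                           (gap-sign k (ℕ.s≤s a≤b) (Fin.toℕ<n b))

    isDominant : IsDominant (region x inComplement)
    isDominant {w} R∋w α@(root a b a≤b) = <-asym (proj₁ (component⇒same-side x w R∋w h) (above⇐ h x
      (≡.subst _>0 (≡.sym (gap-position a b a≤b 0 ℕ.z≤n x)) (gap-pos 0 (ℕ.<⇒≤ (Fin.toℕ<n a)) (Fin.toℕ<n b)
        (≡.subst (ℕ._< Y (suc (toℕ b))) (≡.sym (ℕ.+-identityʳ _)) (increasing (ℕ.s≤s a≤b) (Fin.toℕ<n b)))))))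
      where
      h : CatHyperplane n m
      h = H α 0 ℕ.z≤n

    dominantRegion : DominantRegion
    dominantRegion = region x inComplement , isDominant

    shape≡l : ∀ j → j ℕ.≤ n → shapeOf dominantRegion j ≡ l j
    shape≡l j j≤n = ≡.trans (count-cong (sep? (σ x inComplement) j) (λ t → threshold U Y t ℕ.<? Y j) (m ℕ.* j) at) (shape≡ j j≤n)
      where
      at : ∀ t → t ℕ.< m ℕ.* j → (Sep (σ x inComplement) j t → threshold U Y t ℕ.< Y j) × (threshold U Y t ℕ.< Y j → Sep
          (σ x inComplement) j t)
      at t t< = to , λ h → true⇐ x inComplement v (gap-pos k i≤n j≤n h)
        where
        k : ℕ
        k = suc (t % m)
        v : Valid (t / m) j k
        v = row t< , j≤n , column t
        i≤n : t / m ℕ.≤ n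
        i≤n = ℕ.≤-trans (ℕ.<⇒≤ (row t<)) j≤n
        to : Sep (σ x inComplement) j t → threshold U Y t ℕ.< Y j
        to e = [ (λ h → h) , (λ ≤ → ⊥-elim (PointPattern.¬±>0 x inComplement (true⇒ x inComplement v e)
          (gap-neg k i≤n j≤n (ℕ.≤∧≢⇒< ≤ (generic (row t<) j≤n k))))) ]′ (ℕ.<-≤-connex (threshold U Y t) (Y j))

  opaque
    realised : ∀ D → ∃ λ R → ∀ j → j ℕ.≤ n → shapeOf R j ≡ code D j
    realised D = dominantRegion , shape≡l
      where open Realisation (code D) (λ j≤k _ → code-mono D j≤k) (λ _ _ → code-bound D)

  toRegion : Dissection n m → DominantRegion
  toRegion D = proj₁ (realised D)

  toRegion-shape : ∀ D j → j ℕ.≤ n → shapeOf (toRegion D) j ≡ code D j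
  toRegion-shape D = proj₂ (realised D)

  bijection : Bijection (dissections n m) dominantRegions
  bijection = record
    { to        = toRegion
    ; cong      = λ {D} {D′} D≈D′ → same-shape⇒≈ (toRegion D) (toRegion D′) λ j j≤n →
        ≡.trans (toRegion-shape D j j≤n) (≡.trans (code-cong {D} {D′} D≈D′ j) (≡.sym (toRegion-shape D′ j j≤n)))
    ; bijective = (λ {D} {D′} eq → code-injective {D} {D′} λ j j≤n →
        ≡.trans (≡.sym (toRegion-shape D j j≤n)) (≡.trans (≈⇒same-shape (toRegion D) (toRegion D′) eq j j≤n)
            (toRegion-shape D′ j j≤n)))
      , surjective
    }
    where
    surjective : ∀ R → ∃ λ D → ∀ {D′} → Setoid._≈_ (dissections n m) D′ D → proj₁ (toRegion D′) ≈ᴿ proj₁ R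
    surjective R@(region x c , _) = let (D , code≡) = Decode.code-surjective (shapeOf R) (shape-mono (patternOf R)) (λ j _ → shape-bound (σ x c) j) in
      D , λ {D′} D′≈D → same-shape⇒≈ (toRegion D′) R λ j j≤n →
        ≡.trans (toRegion-shape D′ j j≤n) (≡.trans (code-cong {D′} {D} D′≈D j) (code≡ j j≤n))

  -- The origin lies below H_{α_i,m} because m > 0, so separation can only mean that the region lies
  -- above. `shape-full` translates this into the shape, and `Wall.isWall` supplies the wall in
  -- return.
  separatingWall : ∀ (i : Fin n) R → IsSeparatingWall (proj₁ R) (H (simple i) m ℕ.≤-refl) ⇔ shapeOf R (suc
      (toℕ i)) ≡ m ℕ.* suc (toℕ i)
  separatingWall i R@(Rᴿ@(region x c) , _) = mk⇔
    (λ { (_ , inj₁ (R⊆ , _)) → to (R⊆ {x} (Setoid.refl regionSetoid {Rᴿ}))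
       ; (_ , inj₂ (_ , o)) → ⊥-elim (<-asym m>0 (<-respʳ origin≈ o)) })
    (λ e → let a = from e in (λ {w} → Wall.isWall i c (dominant⇒decreasing R) (above⇒ h x a) {w})
      , inj₁ ((λ {w} R∋w → proj₁ (component⇒same-side x w R∋w h) a) , <-respˡ (sym origin≈) m>0))
    where
    h : CatHyperplane n m
    h = H (simple i) m ℕ.≤-refl
    v : Valid (toℕ i) (suc (toℕ i)) m
    v = valid i i ℕ.≤-refl m ℕ.≤-refl
    open Equivalence (shape-full (patternOf R) (Fin.toℕ<n i)) renaming (to to full⇒; from to full⇐)
    to : Above h x → shapeOf R (suc (toℕ i)) ≡ m ℕ.* suc (toℕ i)
    to a = full⇒ (true⇐ x c v (≡.subst _>0 (gap-position i i ℕ.≤-refl m ℕ.≤-refl x) (above⇒ h x a)))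
    from : shapeOf R (suc (toℕ i)) ≡ m ℕ.* suc (toℕ i) → Above h x
    from e = above⇐ h x (≡.subst _>0 (≡.sym (gap-position i i ℕ.≤-refl m ℕ.≤-refl x)) (true⇒ x c v (full⇐ e)))
    m>0 : 0# < m · 1#
    m>0 = ·-mono-< (ℕ.>-nonZero⁻¹ m)
    origin≈ : ⟨ coord origin , rootVector (simple i) ⟩ ≈ 0#
    origin≈ = trans (inner≈diff origin (simple i)) (-‿inverseʳ 0#)

theorem1p1 : (ℝ : RealNumbers) (n m : ℕ) .{{_ : NonZero n}} .{{_ : NonZero m}} →
    ∃ λ (ω : Bijection (dissections n m) (Arrangement.dominantRegions ℝ n m)) →
    ∀ (i : Fin n) (D : Dissection n m) →
    ContainsNegativeSimple D i ⇔
    Arrangement.IsSeparatingWall ℝ n m (proj₁ (Bijection.to ω D)) (H (simple i) m ≤-refl)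
theorem1p1 ℝ n m = bijection , λ i D → mk⇔
  (λ c → Equivalence.from (separatingWall i (toRegion D)) (≡.trans (toRegion-shape D (suc (toℕ i)) (Fin.toℕ<n i))
    (Equivalence.to (Dissections.containsNegativeSimple n m D i) c)))
  (λ w → Equivalence.from (Dissections.containsNegativeSimple n m D i) (≡.trans (≡.sym (toRegion-shape D (suc (toℕ i))
      (Fin.toℕ<n i)))
    (Equivalence.to (separatingWall i (toRegion D)) w)))
  where open Correspondence ℝ n m
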